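{- Out of all rooted ordered binary trees $T$ of size $k$, the trees for which $\mathbb{P}(\mathrm{DTCS}(k)=T)$ is maximal are the orderings of $\mathrm{CBT}(k)$. Moreover, $$\mathbb{P}(\mathrm{DTCS}(k)=\mathrm{CBT}(k))=2^{ -(\alpha+o(1))k}\qquad\text{as }k\to\infty,$$ where $$\alpha=1+\sum_{i=1}^\infty\frac{\log_2 h_{2^i-1}}{2^i}=1.637\ldots$$
   Context: Binary trees are rooted full binary trees: every internal vertex has exactly two children. The size of a tree is its number of leaves. Ordered trees (plane trees) are trees in which the left and right subtrees of each internal vertex are distinguished; $T=T'$ means identical as rooted ordered trees, and $T\cong T'$ means identical as rooted unordered trees. An ordering of a rooted binary tree $T$ is any rooted ordered tree $T'$ with $T'\cong T$. For $m\ge 2$ let $h_{m-1}=\sum_{j=1}^{m-1}1/j$ and let $q_m$ be the probability distribution on $\{1,\dots,m-1\}$ given by $$q_m(i)=\frac{m}{2h_{m-1}}\,\frac{1}{i(m-i)}.$$ The discrete-time critical beta-splitting tree $\mathrm{DTCS}(n)$ is the random rooted ordered binary tree with $n$ leaves built as follows: split $[n]=\{1,\dots,n\}$ into a left subtree on $\{1,\dots,L_n\}$ and a right subtree on $\{L_n+1,\dots,n\}$, where $L_n$ has distribution $q_n$; then recursively and independently split each interval of size $m\ge2$ into left and right parts according to $q_m$, stopping at intervals of size $m=1$ (the leaves). Leaf labels are disregarded when comparing shapes. $\mathrm{CBT}(k)$ is the complete binary tree with $k$ leaves: every level is completely full except possibly the last, which is filled from the left. $\log_2$ is the base-two logarithm.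 -}

module Defs where

open import Algebra.Bundles using (module CommutativeMonoid)
open import Data.Bool.Base using (Bool; true; false; if_then_else_)
open import Data.Nat.Base as ℕ using (ℕ; zero; suc; z≤n; s≤s; _∸_; _⊓_; ⌊_/2⌋; ⌈_/2⌉)
import Data.Nat.Properties as ℕₚ
open import Data.Nat.Induction using (<-wellFounded)
open import Data.Nat.Logarithm using (⌊log₂_⌋)
open import Data.Nat.Logarithm.Core using (⌊log2⌋)
open import Data.Integer.Base as ℤ using (ℤ; +_; -[1+_]; +[1+_])
import Data.Integer.Properties as ℤₚ
open import Data.Fin.Base using (Fin; zero; suc; toℕ)
open import Data.Fin.Properties using (toℕ<n)
open import Data.Rational.Base as ℚ
  using (ℚ; mkℚ; 0ℚ; 1ℚ; _/_; 1/_; Positive; NonNegative; ↥_; ↧ₙ_; toℚᵘ; fromℚᵘ)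
import Data.Rational.Properties as ℚₚ
open import Data.Rational.Unnormalised.Base as ℚᵘ using (mkℚᵘ; *≡*; *<*; *≤*)
import Data.Rational.Unnormalised.Properties as ℚᵘₚ
open import Data.Rational.Solver using (module +-*-Solver)
import Data.Integer.Solver
open import Data.List.Base using (List; []; _∷_; map; concatMap; foldr; tabulate; _++_; replicate)
import Data.List.Properties as Listₚ
open import Data.List.Relation.Unary.All using (All; []; _∷_)
import Data.List.Relation.Unary.All.Properties as Allₚ
open import Data.Product.Base using (_×_; _,_; proj₁; proj₂; ∃; ∃-syntax)
open import Data.Empty using (⊥-elim)
open import Data.Sum.Base using (inj₁; inj₂)
open import Function.Base using (_∘_)
open import Induction.WellFounded using (Acc; acc)
open import Relation.Binary.Definitions using (DecidableEquality)
open import Relation.Binary.PropositionalEquality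
open import Relation.Nullary.Decidable using (yes; no; does; map′; _×-dec_)

data Tree : Set where
  leaf : Tree
  node : (l r : Tree) → Tree

size : Tree → ℕ
size leaf       = 1
size (node l r) = size l ℕ.+ size r

_≟_ : DecidableEquality Tree
leaf     ≟ leaf       = yes refl
leaf     ≟ node _ _   = no λ ()
node _ _ ≟ leaf       = no λ ()
node l r ≟ node l′ r′ = map′ (λ { (refl , refl) → refl }) (λ { refl → refl , refl }) (l ≟ l′ ×-dec r ≟ r′)

infix 4 _≅_

-- Equality as rooted unordered trees; propositional equality is equality as
-- rooted ordered trees.
data _≅_ : Tree → Tree → Set where
  leaf : leaf ≅ leaf
  node : ∀ {l r l′ r′} → l ≅ l′ → r ≅ r′ → node l r ≅ node l′ r′
  swap : ∀ {l r l′ r′} → l ≅ r′ → r ≅ l′ → node l r ≅ node l′ r′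

-- All vertices of depth ≤ d are present, and exactly the r leftmost of the 2^d
-- vertices of depth d have children (these are leaves), for r ≤ 2^d.
filled : (d r : ℕ) → Tree
filled zero    zero    = leaf
filled zero    (suc _) = node leaf leaf
filled (suc d) r       = node (filled d (r ⊓ 2 ℕ.^ d)) (filled d (r ∸ 2 ℕ.^ d))

-- See CBT-size and CBT-complete below.
CBT : ℕ → Tree
CBT k = filled ⌊log₂ k ⌋ (k ∸ 2 ℕ.^ ⌊log₂ k ⌋)

-- Which of the 2^e possible positions at depth e, from left to right, are
-- vertices of the tree.
level : ℕ → Tree → List Bool
level zero    _          = true ∷ []
level (suc e) leaf       = replicate (2 ℕ.^ suc e) false
level (suc e) (node l r) = level e l ++ level e r

Complete : Tree → Set
Complete T = ∃[ d ]
    (∀ e → e ℕ.≤ d → level e T ≡ replicate (2 ℕ.^ e) true)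
  × (∃[ a ] ∃[ b ] level (suc d) T ≡ replicate a true ++ replicate b false)
  × (∀ e → suc d ℕ.< e → level e T ≡ replicate (2 ℕ.^ e) false)

2^⌊log₂⌋≤ : ∀ n .{{_ : ℕ.NonZero n}} → 2 ℕ.^ ⌊log₂ n ⌋ ℕ.≤ n
2^⌊log₂⌋≤ n = go n (<-wellFounded n)
  where
  go : ∀ n .{{_ : ℕ.NonZero n}} a → 2 ℕ.^ ⌊log2⌋ n a ℕ.≤ n
  go 1             _        = s≤s z≤n
  go (suc (suc n)) (acc rs) = begin
    2 ℕ.* 2 ℕ.^ ⌊log2⌋ (suc ⌊ n /2⌋) _     ≤⟨ ℕₚ.*-monoʳ-≤ 2 (go (suc ⌊ n /2⌋) _) ⟩
    2 ℕ.* suc ⌊ n /2⌋                      ≡⟨ ℕₚ.*-suc 2 ⌊ n /2⌋ ⟩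
    2 ℕ.+ 2 ℕ.* ⌊ n /2⌋                    ≡⟨ cong (λ z → 2 ℕ.+ (⌊ n /2⌋ ℕ.+ z)) (ℕₚ.+-identityʳ _) ⟩
    2 ℕ.+ (⌊ n /2⌋ ℕ.+ ⌊ n /2⌋)            ≤⟨ ℕₚ.+-monoʳ-≤ 2 (ℕₚ.+-monoʳ-≤ ⌊ n /2⌋ (ℕₚ.⌊n/2⌋≤⌈n/2⌉ n)) ⟩
    2 ℕ.+ (⌊ n /2⌋ ℕ.+ ⌈ n /2⌉)            ≡⟨ cong (2 ℕ.+_) (ℕₚ.⌊n/2⌋+⌈n/2⌉≡n n) ⟩
    suc (suc n)                            ∎
    where open ℕₚ.≤-Reasoning

<2^suc⌊log₂⌋ : ∀ n → n ℕ.< 2 ℕ.^ suc ⌊log₂ n ⌋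
<2^suc⌊log₂⌋ n = go n (<-wellFounded n)
  where
  go : ∀ n a → n ℕ.< 2 ℕ.^ suc (⌊log2⌋ n a)
  go 0             _        = s≤s z≤n
  go 1             _        = s≤s (s≤s z≤n)
  go (suc (suc n)) (acc rs) = begin
    3 ℕ.+ n                                ≡⟨ cong (3 ℕ.+_) (ℕₚ.⌊n/2⌋+⌈n/2⌉≡n n) ⟨
    3 ℕ.+ (⌊ n /2⌋ ℕ.+ ⌈ n /2⌉)            ≤⟨ ℕₚ.+-monoʳ-≤ 3 (ℕₚ.+-monoʳ-≤ ⌊ n /2⌋ (ℕₚ.⌊n/2⌋-mono (ℕₚ.n≤1+n (suc n)))) ⟩
    3 ℕ.+ (⌊ n /2⌋ ℕ.+ suc ⌊ n /2⌋)        ≡⟨ cong (2 ℕ.+_) (ℕₚ.+-suc ⌊ n /2⌋ (suc ⌊ n /2⌋)) ⟨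
    2 ℕ.+ (⌊ n /2⌋ ℕ.+ (2 ℕ.+ ⌊ n /2⌋))    ≡⟨ cong (λ z → 2 ℕ.+ (⌊ n /2⌋ ℕ.+ z)) (ℕₚ.+-identityʳ _) ⟨
    2 ℕ.* suc (suc ⌊ n /2⌋)                ≤⟨ ℕₚ.*-monoʳ-≤ 2 (go (suc ⌊ n /2⌋) _) ⟩
    2 ℕ.* 2 ℕ.^ suc (⌊log2⌋ (suc ⌊ n /2⌋) _) ∎
    where open ℕₚ.≤-Reasoning

2^suc : ∀ d → 2 ℕ.^ suc d ≡ 2 ℕ.^ d ℕ.+ 2 ℕ.^ d
2^suc d = cong (2 ℕ.^ d ℕ.+_) (ℕₚ.+-identityʳ _)

∸≤ : ∀ d {r} → r ℕ.≤ 2 ℕ.^ suc d → r ∸ 2 ℕ.^ d ℕ.≤ 2 ℕ.^ d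
∸≤ d {r} p = ℕₚ.m≤n+o⇒m∸n≤o r (2 ℕ.^ d) (subst (r ℕ.≤_) (2^suc d) p)

r≤ : ∀ k → k ∸ 2 ℕ.^ ⌊log₂ k ⌋ ℕ.≤ 2 ℕ.^ ⌊log₂ k ⌋
r≤ k = ∸≤ ⌊log₂ k ⌋ (ℕₚ.<⇒≤ (<2^suc⌊log₂⌋ k))

++-replicate : ∀ (a b : ℕ) (x : Bool) → replicate a x ++ replicate b x ≡ replicate (a ℕ.+ b) x
++-replicate zero    b x = refl
++-replicate (suc a) b x = cong (x ∷_) (++-replicate a b x)

size-filled : ∀ d r → r ℕ.≤ 2 ℕ.^ d → size (filled d r) ≡ 2 ℕ.^ d ℕ.+ r
size-filled zero    zero          _         = refl
size-filled zero    (suc zero)    _         = refl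
size-filled zero    (suc (suc _)) (s≤s ())
size-filled (suc d) r             p = begin
  size (filled d (r ⊓ D)) ℕ.+ size (filled d (r ∸ D))
    ≡⟨ cong₂ ℕ._+_ (size-filled d (r ⊓ D) (ℕₚ.m⊓n≤n r D)) (size-filled d (r ∸ D) (∸≤ d p)) ⟩
  (D ℕ.+ r ⊓ D) ℕ.+ (D ℕ.+ (r ∸ D))
    ≡⟨ interchange D (r ⊓ D) D (r ∸ D) ⟩
  (D ℕ.+ D) ℕ.+ (r ⊓ D ℕ.+ (r ∸ D))
    ≡⟨ cong₂ ℕ._+_ (sym (2^suc d)) (trans (cong (ℕ._+ (r ∸ D)) (ℕₚ.⊓-comm r D)) (ℕₚ.m⊓n+n∸m≡n D r)) ⟩
  2 ℕ.^ suc d ℕ.+ r ∎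
  where
  open ≡-Reasoning
  open import Algebra.Properties.CommutativeSemigroup ℕₚ.+-commutativeSemigroup using (interchange)
  D = 2 ℕ.^ d

level-full : ∀ d r e → e ℕ.≤ d → level e (filled d r) ≡ replicate (2 ℕ.^ e) true
level-full d       r zero    _       = refl
level-full (suc d) r (suc e) (s≤s p) = trans
  (cong₂ _++_ (level-full d _ e p) (level-full d _ e p))
  (trans (++-replicate (2 ℕ.^ e) _ true) (cong (λ n → replicate n true) (sym (2^suc e))))

level-empty : ∀ d r e → suc d ℕ.< e → level e (filled d r) ≡ replicate (2 ℕ.^ e) false
level-empty zero    zero    (suc zero)    (s≤s ())
level-empty zero    zero    (suc (suc e)) _       = refl
level-empty zero    (suc _) (suc zero)    (s≤s ())
level-empty zero    (suc _) (suc (suc e)) _       =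
  trans (++-replicate (2 ℕ.^ suc e) _ false) (cong (λ n → replicate n false) (sym (2^suc (suc e))))
level-empty (suc d) r       (suc e)       (s≤s p) = trans
  (cong₂ _++_ (level-empty d _ e p) (level-empty d _ e p))
  (trans (++-replicate (2 ℕ.^ e) _ false) (cong (λ n → replicate n false) (sym (2^suc e))))

level-last : ∀ d r → r ℕ.≤ 2 ℕ.^ d →
  level (suc d) (filled d r) ≡ replicate (r ℕ.+ r) true ++ replicate ((2 ℕ.^ d ∸ r) ℕ.+ (2 ℕ.^ d ∸ r)) false
level-last zero    zero          _ = refl
level-last zero    (suc zero)    _ = refl
level-last zero    (suc (suc _)) (s≤s ())
level-last (suc d) r p with ℕₚ.≤-total r (2 ℕ.^ d)
... | inj₁ r≤D = begin
  level (suc d) (filled d (r ⊓ D)) ++ level (suc d) (filled d (r ∸ D))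
    ≡⟨ cong₂ (λ u v → level (suc d) (filled d u) ++ level (suc d) (filled d v)) (ℕₚ.m≤n⇒m⊓n≡m r≤D) (ℕₚ.m≤n⇒m∸n≡0 r≤D) ⟩
  level (suc d) (filled d r) ++ level (suc d) (filled d 0)
    ≡⟨ cong₂ _++_ (level-last d r r≤D) (level-last d 0 z≤n) ⟩
  (replicate (r ℕ.+ r) true ++ replicate (x ℕ.+ x) false) ++ replicate (D ℕ.+ D) false
    ≡⟨ Listₚ.++-assoc (replicate (r ℕ.+ r) true) _ _ ⟩
  replicate (r ℕ.+ r) true ++ (replicate (x ℕ.+ x) false ++ replicate (D ℕ.+ D) false)
    ≡⟨ cong (replicate (r ℕ.+ r) true ++_) (++-replicate (x ℕ.+ x) (D ℕ.+ D) false) ⟩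
  replicate (r ℕ.+ r) true ++ replicate ((x ℕ.+ x) ℕ.+ (D ℕ.+ D)) false
    ≡⟨ cong (λ n → replicate (r ℕ.+ r) true ++ replicate n false) (trans (interchange x x D D) (cong₂ ℕ._+_ eq eq)) ⟩
  replicate (r ℕ.+ r) true ++ replicate ((2 ℕ.^ suc d ∸ r) ℕ.+ (2 ℕ.^ suc d ∸ r)) false ∎
  where
  open ≡-Reasoning
  open import Algebra.Properties.CommutativeSemigroup ℕₚ.+-commutativeSemigroup using (interchange)
  D = 2 ℕ.^ d
  x = D ∸ r
  eq : x ℕ.+ D ≡ 2 ℕ.^ suc d ∸ r
  eq = trans (sym (ℕₚ.+-∸-comm D r≤D)) (cong (_∸ r) (sym (2^suc d)))
... | inj₂ D≤r = begin
  level (suc d) (filled d (r ⊓ D)) ++ level (suc d) (filled d y)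
    ≡⟨ cong (λ u → level (suc d) (filled d u) ++ level (suc d) (filled d y)) (ℕₚ.m≥n⇒m⊓n≡n D≤r) ⟩
  level (suc d) (filled d D) ++ level (suc d) (filled d y)
    ≡⟨ cong₂ _++_ (level-last d D ℕₚ.≤-refl) (level-last d y (∸≤ d p)) ⟩
  (replicate (D ℕ.+ D) true ++ replicate ((D ∸ D) ℕ.+ (D ∸ D)) false) ++ (replicate (y ℕ.+ y) true ++ F)
    ≡⟨ cong (λ n → (replicate (D ℕ.+ D) true ++ replicate (n ℕ.+ n) false) ++ (replicate (y ℕ.+ y) true ++ F)) (ℕₚ.n∸n≡0 D) ⟩
  (replicate (D ℕ.+ D) true ++ []) ++ (replicate (y ℕ.+ y) true ++ F)
    ≡⟨ cong (_++ (replicate (y ℕ.+ y) true ++ F)) (Listₚ.++-identityʳ (replicate (D ℕ.+ D) true)) ⟩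
  replicate (D ℕ.+ D) true ++ (replicate (y ℕ.+ y) true ++ F)
    ≡⟨ Listₚ.++-assoc (replicate (D ℕ.+ D) true) _ _ ⟨
  (replicate (D ℕ.+ D) true ++ replicate (y ℕ.+ y) true) ++ F
    ≡⟨ cong (_++ F) (++-replicate (D ℕ.+ D) (y ℕ.+ y) true) ⟩
  replicate ((D ℕ.+ D) ℕ.+ (y ℕ.+ y)) true ++ F
    ≡⟨ cong (λ n → replicate n true ++ F) (trans (interchange D D y y) (cong₂ ℕ._+_ (ℕₚ.m+[n∸m]≡n D≤r) (ℕₚ.m+[n∸m]≡n D≤r))) ⟩
  replicate (r ℕ.+ r) true ++ F
    ≡⟨ cong (λ n → replicate (r ℕ.+ r) true ++ replicate (n ℕ.+ n) false) eq ⟩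
  replicate (r ℕ.+ r) true ++ replicate ((2 ℕ.^ suc d ∸ r) ℕ.+ (2 ℕ.^ suc d ∸ r)) false ∎
  where
  open ≡-Reasoning
  open import Algebra.Properties.CommutativeSemigroup ℕₚ.+-commutativeSemigroup using (interchange)
  D = 2 ℕ.^ d
  y = r ∸ D
  F = replicate ((D ∸ y) ℕ.+ (D ∸ y)) false
  eq : D ∸ y ≡ 2 ℕ.^ suc d ∸ r
  eq = begin
    D ∸ (r ∸ D)                 ≡⟨ ℕₚ.[m+n]∸[m+o]≡n∸o D D y ⟨
    (D ℕ.+ D) ∸ (D ℕ.+ (r ∸ D)) ≡⟨ cong₂ _∸_ (sym (2^suc d)) (ℕₚ.m+[n∸m]≡n D≤r) ⟩
    2 ℕ.^ suc d ∸ r             ∎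

CBT-size : ∀ k .{{_ : ℕ.NonZero k}} → size (CBT k) ≡ k
CBT-size k = trans (size-filled ⌊log₂ k ⌋ _ (r≤ k)) (ℕₚ.m+[n∸m]≡n (2^⌊log₂⌋≤ k))

CBT-complete : ∀ k → Complete (CBT k)
CBT-complete k =
  ⌊log₂ k ⌋ , level-full ⌊log₂ k ⌋ r , (r ℕ.+ r , _ , level-last ⌊log₂ k ⌋ r (r≤ k)) , level-empty ⌊log₂ k ⌋ r
  where r = k ∸ 2 ℕ.^ ⌊log₂ k ⌋

mass : ∀ {A : Set} → List (A × ℚ) → ℚ
mass []             = 0ℚ
mass ((_ , w) ∷ ws) = w ℚ.+ mass ws

-- The same outcome may be listed several times; its probability is then the
-- sum of the listed weights.
record Dist (A : Set) : Set where
  constructor dist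
  field
    weights : List (A × ℚ)
    nonNeg  : All (NonNegative ∘ proj₂) weights
    total   : mass weights ≡ 1ℚ

open Dist public

mass-++ : ∀ {A : Set} (us vs : List (A × ℚ)) → mass (us ++ vs) ≡ mass us ℚ.+ mass vs
mass-++ []             vs = sym (ℚₚ.+-identityˡ _)
mass-++ ((_ , w) ∷ us) vs = trans (cong (w ℚ.+_) (mass-++ us vs)) (sym (ℚₚ.+-assoc w _ _))

scale : ∀ {A : Set} → ℚ → List (A × ℚ) → List (A × ℚ)
scale c = map λ (a , w) → a , c ℚ.* w

mass-scale : ∀ {A : Set} c (ws : List (A × ℚ)) → mass (scale c ws) ≡ c ℚ.* mass ws
mass-scale c []             = sym (ℚₚ.*-zeroʳ c)
mass-scale c ((_ , w) ∷ ws) =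
  trans (cong (c ℚ.* w ℚ.+_) (mass-scale c ws)) (sym (ℚₚ.*-distribˡ-+ c w (mass ws)))

return : ∀ {A : Set} → A → Dist A
return a = dist ((a , 1ℚ) ∷ []) (_ ∷ []) refl

infixl 1 _>>=_

_>>=_ : ∀ {A B : Set} → Dist A → (A → Dist B) → Dist B
_>>=_ {A} {B} d f = dist (concatMap branch (weights d)) (nn (nonNeg d)) (trans (tot (weights d)) (total d))
  where
  branch : A × ℚ → List (B × ℚ)
  branch (a , w) = scale w (weights (f a))

  nn-branch : ∀ w → NonNegative w → ∀ {vs : List (B × ℚ)} →
              All (NonNegative ∘ proj₂) vs → All (NonNegative ∘ proj₂) (scale w vs)
  nn-branch w p []       = []
  nn-branch w p (_∷_ {x = _ , v} q qs) = ℚₚ.nonNeg*nonNeg⇒nonNeg w {{p}} v {{q}} ∷ nn-branch w p qs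

  nn : ∀ {ws} → All (NonNegative ∘ proj₂) ws → All (NonNegative ∘ proj₂) (concatMap branch ws)
  nn []                         = []
  nn (_∷_ {x = a , w} p ps) = Allₚ.++⁺ (nn-branch w p (nonNeg (f a))) (nn ps)

  tot : ∀ ws → mass (concatMap branch ws) ≡ mass ws
  tot []             = refl
  tot ((a , w) ∷ ws) = trans (mass-++ (branch (a , w)) _) (cong₂ ℚ._+_
    (trans (mass-scale w (weights (f a))) (trans (cong (w ℚ.*_) (total (f a))) (ℚₚ.*-identityʳ w)))
    (tot ws))

ℙ[_≡_] : Dist Tree → Tree → ℚ
ℙ[ d ≡ T ] = mass (map (λ (T′ , w) → T′ , (if does (T′ ≟ T) then w else 0ℚ)) (weights d))

h : ℕ → ℚ
h zero    = 0ℚ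
h (suc n) = h n ℚ.+ + 1 / suc n

1/suc-pos : ∀ n → Positive (+ 1 / suc n)
1/suc-pos n = ℚₚ.normalize-pos 1 (suc n)

h-nonNeg : ∀ n → NonNegative (h n)
h-nonNeg zero    = _
h-nonNeg (suc n) = ℚₚ.nonNeg+nonNeg⇒nonNeg (h n) {{h-nonNeg n}} (+ 1 / suc n) {{ℚₚ.pos⇒nonNeg (+ 1 / suc n) {{1/suc-pos n}}}}

h-pos : ∀ n .{{_ : ℕ.NonZero n}} → Positive (h n)
h-pos (suc n) = ℚₚ.nonNeg+pos⇒pos (h n) {{h-nonNeg n}} (+ 1 / suc n) {{1/suc-pos n}}

2h-pos : ∀ n → Positive (+ 2 / 1 ℚ.* h (suc n))
2h-pos n = ℚₚ.pos*pos⇒pos (+ 2 / 1) (h (suc n)) {{h-pos (suc n)}}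

2h-nonZero : ∀ n → ℚ.NonZero (+ 2 / 1 ℚ.* h (suc n))
2h-nonZero n = ℚₚ.pos⇒nonZero (+ 2 / 1 ℚ.* h (suc n)) {{2h-pos n}}

1/2h : ℕ → ℚ
1/2h n = (1/ (+ 2 / 1 ℚ.* h (suc n))) {{2h-nonZero n}}

-- q n t is q_m(i) for m = n + 2 and i = t + 1, so that m - i = (n - t) + 1 and
-- h_{m-1} = h (suc n).
q : (n t : ℕ) → ℚ
q n t = + (2 ℕ.+ n) / 1 ℚ.* 1/2h n ℚ.* (+ 1 / (suc t ℕ.* suc (n ∸ t)))

fromℚᵘ-+ : ∀ x y → fromℚᵘ x ℚ.+ fromℚᵘ y ≡ fromℚᵘ (x ℚᵘ.+ y)
fromℚᵘ-+ x y = ℚₚ.toℚᵘ-injective (ℚᵘₚ.≃-trans (ℚₚ.toℚᵘ-homo-+ (fromℚᵘ x) (fromℚᵘ y))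
  (ℚᵘₚ.≃-trans (ℚᵘₚ.+-cong (ℚₚ.toℚᵘ-fromℚᵘ x) (ℚₚ.toℚᵘ-fromℚᵘ y)) (ℚᵘₚ.≃-sym (ℚₚ.toℚᵘ-fromℚᵘ (x ℚᵘ.+ y)))))

fromℚᵘ-* : ∀ x y → fromℚᵘ x ℚ.* fromℚᵘ y ≡ fromℚᵘ (x ℚᵘ.* y)
fromℚᵘ-* x y = ℚₚ.toℚᵘ-injective (ℚᵘₚ.≃-trans (ℚₚ.toℚᵘ-homo-* (fromℚᵘ x) (fromℚᵘ y))
  (ℚᵘₚ.≃-trans (ℚᵘₚ.*-cong (ℚₚ.toℚᵘ-fromℚᵘ x) (ℚₚ.toℚᵘ-fromℚᵘ y)) (ℚᵘₚ.≃-sym (ℚₚ.toℚᵘ-fromℚᵘ (x ℚᵘ.* y)))))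

partial-fraction : ∀ a b → + (suc a ℕ.+ suc b) / 1 ℚ.* (+ 1 / (suc a ℕ.* suc b)) ≡ + 1 / suc a ℚ.+ + 1 / suc b
partial-fraction a b = trans
  (fromℚᵘ-* (mkℚᵘ (+ (suc a ℕ.+ suc b)) 0) (mkℚᵘ (+ 1) (b ℕ.+ a ℕ.* suc b)))
  (trans (ℚₚ.fromℚᵘ-cong {x} {y} (*≡* eq)) (sym (fromℚᵘ-+ (mkℚᵘ (+ 1) a) (mkℚᵘ (+ 1) b))))
  where
  x = mkℚᵘ (+ (suc a ℕ.+ suc b)) 0 ℚᵘ.* mkℚᵘ (+ 1) (b ℕ.+ a ℕ.* suc b)
  y = mkℚᵘ (+ 1) a ℚᵘ.+ mkℚᵘ (+ 1) b
  eq : + (suc a ℕ.+ suc b) ℤ.* + 1 ℤ.* + (suc a ℕ.* suc b)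
     ≡ (+ 1 ℤ.* + suc b ℤ.+ + 1 ℤ.* + suc a) ℤ.* + (1 ℕ.* (suc a ℕ.* suc b))
  eq = cong₂ ℤ._*_
    (trans (ℤₚ.*-identityʳ _) (trans (cong +_ (ℕₚ.+-comm (suc a) (suc b)))
      (sym (cong₂ ℤ._+_ (ℤₚ.*-identityˡ (+ suc b)) (ℤₚ.*-identityˡ (+ suc a))))))
    (cong +_ (sym (ℕₚ.*-identityˡ (suc a ℕ.* suc b))))

ΣFin : ∀ n → (Fin n → ℚ) → ℚ
ΣFin zero    f = 0ℚ
ΣFin (suc n) f = f zero ℚ.+ ΣFin n (f ∘ suc)

ΣFin-cong : ∀ n {f g : Fin n → ℚ} → (∀ i → f i ≡ g i) → ΣFin n f ≡ ΣFin n g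
ΣFin-cong zero    e = refl
ΣFin-cong (suc n) e = cong₂ ℚ._+_ (e zero) (ΣFin-cong n (e ∘ suc))

ΣFin-* : ∀ n c (f : Fin n → ℚ) → ΣFin n (λ i → c ℚ.* f i) ≡ c ℚ.* ΣFin n f
ΣFin-* zero    c f = sym (ℚₚ.*-zeroʳ c)
ΣFin-* (suc n) c f = trans (cong (c ℚ.* f zero ℚ.+_) (ΣFin-* n c (f ∘ suc))) (sym (ℚₚ.*-distribˡ-+ c (f zero) (ΣFin n (f ∘ suc))))

ΣFin-+ : ∀ n (f g : Fin n → ℚ) → ΣFin n (λ i → f i ℚ.+ g i) ≡ ΣFin n f ℚ.+ ΣFin n g
ΣFin-+ zero    f g = refl
ΣFin-+ (suc n) f g = trans (cong (f zero ℚ.+ g zero ℚ.+_) (ΣFin-+ n (f ∘ suc) (g ∘ suc)))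
  (interchange (f zero) (g zero) (ΣFin n (f ∘ suc)) (ΣFin n (g ∘ suc)))
  where open import Algebra.Properties.CommutativeSemigroup (CommutativeMonoid.commutativeSemigroup ℚₚ.+-0-commutativeMonoid) using (interchange)

ΣFin-snoc : ∀ n (f : ℕ → ℚ) → ΣFin (suc n) (f ∘ toℕ) ≡ ΣFin n (f ∘ toℕ) ℚ.+ f n
ΣFin-snoc zero    f = ℚₚ.+-comm (f 0) 0ℚ
ΣFin-snoc (suc n) f = trans (cong (f 0 ℚ.+_) (ΣFin-snoc n (f ∘ suc))) (sym (ℚₚ.+-assoc (f 0) _ _))

ΣFin-h : ∀ n → ΣFin n (λ t → + 1 / suc (toℕ t)) ≡ h n
ΣFin-h zero    = refl
ΣFin-h (suc n) = trans (ΣFin-snoc n (λ t → + 1 / suc t)) (cong (ℚ._+ + 1 / suc n) (ΣFin-h n))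

ΣFin-h-rev : ∀ n → ΣFin (suc n) (λ t → + 1 / suc (n ∸ toℕ t)) ≡ h (suc n)
ΣFin-h-rev zero    = refl
ΣFin-h-rev (suc n) = trans (cong (+ 1 / suc (suc n) ℚ.+_) (ΣFin-h-rev n)) (ℚₚ.+-comm _ (h (suc n)))

mass-tabulate : ∀ {A : Set} n (a : Fin n → A) (f : Fin n → ℚ) → mass (tabulate (λ i → a i , f i)) ≡ ΣFin n f
mass-tabulate zero    a f = refl
mass-tabulate (suc n) a f = cong (f zero ℚ.+_) (mass-tabulate n (a ∘ suc) (f ∘ suc))

q-split : ∀ n (t : Fin (suc n)) →
          q n (toℕ t) ≡ 1/2h n ℚ.* (+ 1 / suc (toℕ t) ℚ.+ + 1 / suc (n ∸ toℕ t))
q-split n t = begin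
  + (2 ℕ.+ n) / 1 ℚ.* 1/2h n ℚ.* r   ≡⟨ cong (ℚ._* r) (ℚₚ.*-comm (+ (2 ℕ.+ n) / 1) (1/2h n)) ⟩
  1/2h n ℚ.* (+ (2 ℕ.+ n) / 1) ℚ.* r ≡⟨ ℚₚ.*-assoc (1/2h n) _ r ⟩
  1/2h n ℚ.* (+ (2 ℕ.+ n) / 1 ℚ.* r) ≡⟨ cong (λ m → 1/2h n ℚ.* (+ m / 1 ℚ.* r)) 2+n ⟩
  1/2h n ℚ.* (+ (suc (toℕ t) ℕ.+ suc (n ∸ toℕ t)) / 1 ℚ.* r)
                                     ≡⟨ cong (1/2h n ℚ.*_) (partial-fraction (toℕ t) (n ∸ toℕ t)) ⟩
  1/2h n ℚ.* (+ 1 / suc (toℕ t) ℚ.+ + 1 / suc (n ∸ toℕ t)) ∎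
  where
  open ≡-Reasoning
  r = + 1 / (suc (toℕ t) ℕ.* suc (n ∸ toℕ t))
  2+n : 2 ℕ.+ n ≡ suc (toℕ t) ℕ.+ suc (n ∸ toℕ t)
  2+n = cong suc (sym (trans (ℕₚ.+-suc (toℕ t) (n ∸ toℕ t)) (cong suc (ℕₚ.m+[n∸m]≡n (ℕₚ.≤-pred (toℕ<n t))))))

q-total : ∀ n → ΣFin (suc n) (q n ∘ toℕ) ≡ 1ℚ
q-total n = begin
  ΣFin (suc n) (q n ∘ toℕ)                              ≡⟨ ΣFin-cong (suc n) (q-split n) ⟩
  ΣFin (suc n) (λ t → 1/2h n ℚ.* (u t ℚ.+ v t))         ≡⟨ ΣFin-* (suc n) (1/2h n) (λ t → u t ℚ.+ v t) ⟩
  1/2h n ℚ.* ΣFin (suc n) (λ t → u t ℚ.+ v t)           ≡⟨ cong (1/2h n ℚ.*_) (ΣFin-+ (suc n) u v) ⟩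
  1/2h n ℚ.* (ΣFin (suc n) u ℚ.+ ΣFin (suc n) v)           ≡⟨ cong (1/2h n ℚ.*_) (cong₂ ℚ._+_ (ΣFin-h (suc n)) (ΣFin-h-rev n)) ⟩
  1/2h n ℚ.* (h (suc n) ℚ.+ h (suc n))
    ≡⟨ cong (1/2h n ℚ.*_) (cong₂ ℚ._+_ (ℚₚ.*-identityˡ (h (suc n))) (ℚₚ.*-identityˡ (h (suc n)))) ⟨
  1/2h n ℚ.* (1ℚ ℚ.* h (suc n) ℚ.+ 1ℚ ℚ.* h (suc n)) ≡⟨ cong (1/2h n ℚ.*_) (ℚₚ.*-distribʳ-+ (h (suc n)) 1ℚ 1ℚ) ⟨
  1/2h n ℚ.* (+ 2 / 1 ℚ.* h (suc n))                 ≡⟨ ℚₚ.*-inverseˡ (+ 2 / 1 ℚ.* h (suc n)) {{2h-nonZero n}} ⟩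
  1ℚ                                                 ∎
  where
  open ≡-Reasoning
  u v : Fin (suc n) → ℚ
  u t = + 1 / suc (toℕ t)
  v t = + 1 / suc (n ∸ toℕ t)

q-nonNeg : ∀ n t → NonNegative (q n t)
q-nonNeg n t = ℚₚ.nonNeg*nonNeg⇒nonNeg (+ (2 ℕ.+ n) / 1 ℚ.* 1/2h n)
  {{ℚₚ.nonNeg*nonNeg⇒nonNeg (+ (2 ℕ.+ n) / 1) {{ℚₚ.normalize-nonNeg (2 ℕ.+ n) 1}} (1/2h n)
    {{ℚₚ.pos⇒nonNeg (1/2h n) {{ℚₚ.1/pos⇒pos (+ 2 / 1 ℚ.* h (suc n)) {{2h-pos n}}}}}}}}
  (+ 1 / (suc t ℕ.* suc (n ∸ t))) {{ℚₚ.normalize-nonNeg 1 (suc t ℕ.* suc (n ∸ t))}}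

split : ∀ n → Dist (Fin (suc n))
split n = dist (tabulate (λ t → t , q n (toℕ t)))
               (Allₚ.tabulate⁺ {f = λ t → t , q n (toℕ t)} (λ t → q-nonNeg n (toℕ t)))
               (trans (mass-tabulate (suc n) (λ t → t) (λ t → q n (toℕ t))) (q-total n))

dtcs : ∀ m .{{_ : ℕ.NonZero m}} → Acc ℕ._<_ m → Dist Tree
dtcs 1             _        = return leaf
dtcs (suc (suc n)) (acc rs) =
  split n                                                      >>= λ t →
  dtcs (suc (toℕ t))     (rs (s≤s (toℕ<n t)))                  >>= λ l →
  dtcs (suc (n ∸ toℕ t)) (rs (s≤s (s≤s (ℕₚ.m∸n≤m n (toℕ t))))) >>= λ r →
  return (node l r)

DTCS : ∀ n .{{_ : ℕ.NonZero n}} → Dist Tree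
DTCS n = dtcs n (<-wellFounded n)

MostLikely : ∀ k .{{_ : ℕ.NonZero k}} → Tree → Set
MostLikely k T = ∀ T′ → size T′ ≡ k → ℙ[ DTCS k ≡ T′ ] ℚ.≤ ℙ[ DTCS k ≡ T ]

record ℝ : Set where
  field
    seq    : ℕ → ℚ
    cauchy : ∀ ε → 0ℚ ℚ.< ε → ∃[ N ] ∀ m n → N ℕ.≤ m → N ℕ.≤ n → ℚ.∣ seq m ℚ.- seq n ∣ ℚ.< ε

open ℝ public

fromℚ : ℚ → ℝ
fromℚ p .seq    _     = p
fromℚ p .cauchy ε 0<ε = 0 , λ _ _ _ _ → subst (λ z → ℚ.∣ z ∣ ℚ.< ε) (sym (ℚₚ.+-inverseʳ p)) 0<ε

half : ∀ {ε} → 0ℚ ℚ.< ε → 0ℚ ℚ.< ℚ.½ ℚ.* ε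
half {ε} 0<ε = subst (ℚ._< ℚ.½ ℚ.* ε) (ℚₚ.*-zeroʳ ℚ.½) (ℚₚ.*-monoʳ-<-pos ℚ.½ 0<ε)

half+half : ∀ ε → ℚ.½ ℚ.* ε ℚ.+ ℚ.½ ℚ.* ε ≡ ε
half+half ε = trans (sym (ℚₚ.*-distribʳ-+ ε ℚ.½ ℚ.½)) (ℚₚ.*-identityˡ ε)

infixl 6 _+ᴿ_ _-ᴿ_
infixr 7 _⋆_
infix  4 _<ᴿ_ _⟶_ _SumsTo_

_+ᴿ_ : ℝ → ℝ → ℝ
(x +ᴿ y) .seq n        = seq x n ℚ.+ seq y n
(x +ᴿ y) .cauchy ε 0<ε =
  let M , p = cauchy x (ℚ.½ ℚ.* ε) (half 0<ε)
      N , q = cauchy y (ℚ.½ ℚ.* ε) (half 0<ε)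
  in M ℕ.⊔ N , λ m n m≥ n≥ → begin-strict
    ℚ.∣ (seq x m ℚ.+ seq y m) ℚ.- (seq x n ℚ.+ seq y n) ∣
      ≡⟨ cong ℚ.∣_∣ (solve 4 (λ a b c d → (a :+ b) :+ :- (c :+ d) := (a :+ :- c) :+ (b :+ :- d)) refl
                       (seq x m) (seq y m) (seq x n) (seq y n)) ⟩
    ℚ.∣ (seq x m ℚ.- seq x n) ℚ.+ (seq y m ℚ.- seq y n) ∣
      ≤⟨ ℚₚ.∣p+q∣≤∣p∣+∣q∣ (seq x m ℚ.- seq x n) (seq y m ℚ.- seq y n) ⟩
    ℚ.∣ seq x m ℚ.- seq x n ∣ ℚ.+ ℚ.∣ seq y m ℚ.- seq y n ∣
      <⟨ ℚₚ.+-mono-< (p m n (ℕₚ.≤-trans (ℕₚ.m≤m⊔n M N) m≥) (ℕₚ.≤-trans (ℕₚ.m≤m⊔n M N) n≥))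
                     (q m n (ℕₚ.≤-trans (ℕₚ.m≤n⊔m M N) m≥) (ℕₚ.≤-trans (ℕₚ.m≤n⊔m M N) n≥)) ⟩
    ℚ.½ ℚ.* ε ℚ.+ ℚ.½ ℚ.* ε
      ≡⟨ half+half ε ⟩
    ε ∎
  where open ℚₚ.≤-Reasoning
        open +-*-Solver

_⋆_ : ℚ → ℝ → ℝ
(c ⋆ x) .seq n        = c ℚ.* seq x n
(c ⋆ x) .cauchy ε 0<ε =
  let N , p = cauchy x (1/C ℚ.* ε) 0<ε/C
  in N , λ m n m≥ n≥ → begin-strict
    ℚ.∣ c ℚ.* seq x m ℚ.- c ℚ.* seq x n ∣
      ≡⟨ cong ℚ.∣_∣ (solve 3 (λ c a b → c :* a :+ :- (c :* b) := c :* (a :+ :- b)) refl c (seq x m) (seq x n)) ⟩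
    ℚ.∣ c ℚ.* (seq x m ℚ.- seq x n) ∣
      ≡⟨ ℚₚ.∣p*q∣≡∣p∣*∣q∣ c (seq x m ℚ.- seq x n) ⟩
    ℚ.∣ c ∣ ℚ.* ℚ.∣ seq x m ℚ.- seq x n ∣
      ≤⟨ ℚₚ.*-monoʳ-≤-nonNeg ℚ.∣ seq x m ℚ.- seq x n ∣ {{ℚₚ.∣-∣-nonNeg (seq x m ℚ.- seq x n)}} c≤C ⟩
    C ℚ.* ℚ.∣ seq x m ℚ.- seq x n ∣
      <⟨ ℚₚ.*-monoʳ-<-pos C {{C-pos}} (p m n m≥ n≥) ⟩
    C ℚ.* (1/C ℚ.* ε)
      ≡⟨ ℚₚ.*-assoc C 1/C ε ⟨
    C ℚ.* 1/C ℚ.* ε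
      ≡⟨ cong (ℚ._* ε) (ℚₚ.*-inverseʳ C {{C-nonZero}}) ⟩
    1ℚ ℚ.* ε
      ≡⟨ ℚₚ.*-identityˡ ε ⟩
    ε ∎
  where
  open ℚₚ.≤-Reasoning
  open +-*-Solver
  C : ℚ
  C = ℚ.∣ c ∣ ℚ.+ 1ℚ
  C-pos : Positive C
  C-pos = ℚₚ.nonNeg+pos⇒pos ℚ.∣ c ∣ {{ℚₚ.∣-∣-nonNeg c}} 1ℚ
  C-nonZero : ℚ.NonZero C
  C-nonZero = ℚₚ.pos⇒nonZero C {{C-pos}}
  1/C : ℚ
  1/C = (1/ C) {{C-nonZero}}
  c≤C : ℚ.∣ c ∣ ℚ.≤ C
  c≤C = subst (ℚ._≤ C) (ℚₚ.+-identityʳ ℚ.∣ c ∣) (ℚₚ.+-monoʳ-≤ ℚ.∣ c ∣ {0ℚ} {1ℚ} (ℚₚ.nonNegative⁻¹ 1ℚ))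
  0<ε/C : 0ℚ ℚ.< 1/C ℚ.* ε
  0<ε/C = subst (ℚ._< 1/C ℚ.* ε) (ℚₚ.*-zeroʳ 1/C) (ℚₚ.*-monoʳ-<-pos 1/C {{ℚₚ.1/pos⇒pos C {{C-pos}}}} 0<ε)

_-ᴿ_ : ℝ → ℝ → ℝ
x -ᴿ y = x +ᴿ (ℚ.- 1ℚ) ⋆ y

_<ᴿ_ : ℝ → ℝ → Set
x <ᴿ y = ∃[ δ ] (0ℚ ℚ.< δ × ∃[ N ] ∀ n → N ℕ.≤ n → seq x n ℚ.+ δ ℚ.≤ seq y n)

_⟶_ : (ℕ → ℝ) → ℝ → Set
f ⟶ x = ∀ ε → 0ℚ ℚ.< ε → ∃[ N ] ∀ n → N ℕ.≤ n →
  (fromℚ (ℚ.- ε) <ᴿ f n -ᴿ x) × (f n -ᴿ x <ᴿ fromℚ ε)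

partialSum : (∀ i → .{{_ : ℕ.NonZero i}} → ℝ) → ℕ → ℝ
partialSum a zero    = fromℚ 0ℚ
partialSum a (suc n) = partialSum a n +ᴿ a (suc n)

_SumsTo_ : (∀ i → .{{_ : ℕ.NonZero i}} → ℝ) → ℝ → Set
a SumsTo s = partialSum a ⟶ s

infixr 8 _^_

_^_ : ℚ → ℕ → ℚ
x ^ zero  = 1ℚ
x ^ suc n = x ℚ.* x ^ n

2ᶻ : ℤ → ℚ
2ᶻ (+ n)    = (+ 2 / 1) ^ n
2ᶻ -[1+ n ] = ℚ.½ ^ suc n

infix 4 2^_≐_

-- The real power 2^x equals the rational y: x and y > 0 compare in the same way
-- with each rational p/d and with 2^(p/d) respectively, the d-th root being
-- avoided by comparing 2^p with y^d.
2^_≐_ : ℝ → ℚ → Set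
2^ x ≐ y = 0ℚ ℚ.< y × (∀ (p : ℤ) (d : ℕ) .{{_ : ℕ.NonZero d}} →
  (fromℚ (p / d) <ᴿ x → 2ᶻ p ℚ.< y ^ d) × (x <ᴿ fromℚ (p / d) → y ^ d ℚ.< 2ᶻ p))

/-mono-< : ∀ (a b : ℤ) m n → a ℤ.* + suc n ℤ.< b ℤ.* + suc m → a / suc m ℚ.< b / suc n
/-mono-< a b m n p = ℚₚ.toℚᵘ-cancel-<
  (ℚᵘₚ.<-respˡ-≃ (ℚᵘₚ.≃-sym (ℚₚ.toℚᵘ-fromℚᵘ (mkℚᵘ a m)))
    (ℚᵘₚ.<-respʳ-≃ (ℚᵘₚ.≃-sym (ℚₚ.toℚᵘ-fromℚᵘ (mkℚᵘ b n))) (*<* p)))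

/-mono-≤ : ∀ (a b : ℤ) m n → a ℤ.* + suc n ℤ.≤ b ℤ.* + suc m → a / suc m ℚ.≤ b / suc n
/-mono-≤ a b m n p = ℚₚ.toℚᵘ-cancel-≤
  (ℚᵘₚ.≤-respˡ-≃ (ℚᵘₚ.≃-sym (ℚₚ.toℚᵘ-fromℚᵘ (mkℚᵘ a m)))
    (ℚᵘₚ.≤-respʳ-≃ (ℚᵘₚ.≃-sym (ℚₚ.toℚᵘ-fromℚᵘ (mkℚᵘ b n))) (*≤* p)))

/-cancel-≤ : ∀ (a b : ℤ) m n → a / suc m ℚ.≤ b / suc n → a ℤ.* + suc n ℤ.≤ b ℤ.* + suc m
/-cancel-≤ a b m n p with ℚᵘₚ.≤-respˡ-≃ (ℚₚ.toℚᵘ-fromℚᵘ (mkℚᵘ a m))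
    (ℚᵘₚ.≤-respʳ-≃ (ℚₚ.toℚᵘ-fromℚᵘ (mkℚᵘ b n)) (ℚₚ.toℚᵘ-mono-≤ p))
... | *≤* r = r

/-+ : ∀ a b n → a / suc n ℚ.+ b / suc n ≡ (a ℤ.+ b) / suc n
/-+ a b n = trans (fromℚᵘ-+ (mkℚᵘ a n) (mkℚᵘ b n))
  (ℚₚ.fromℚᵘ-cong {mkℚᵘ a n ℚᵘ.+ mkℚᵘ b n} {mkℚᵘ (a ℤ.+ b) n}
    (*≡* (trans (cong (ℤ._* + suc n) (sym (ℤₚ.*-distribʳ-+ (+ suc n) a b)))
      (ℤₚ.*-assoc (a ℤ.+ b) (+ suc n) (+ suc n)))))

-- Every positive rational is at least 1/(M+1) for some M.
archimedean : ∀ ε → 0ℚ ℚ.< ε → ∃[ M ] (+ 1 / suc M ℚ.≤ ε)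
archimedean ε 0<ε with ε | ℚ.positive 0<ε
... | mkℚ +[1+ n ] d c | _ = d , subst (+ 1 / suc d ℚ.≤_) (ℚₚ.fromℚᵘ-toℚᵘ (mkℚ +[1+ n ] d c))
  (/-mono-≤ (+ 1) +[1+ n ] d d (ℤₚ.*-monoʳ-≤-nonNeg (+ suc d) {+ 1} {+[1+ n ]} (ℤ.+≤+ (s≤s z≤n))))

⌊lg⌋ : ℕ → ℕ → ℕ
⌊lg⌋ a n = ⌊log₂ (a ℕ.^ suc n) ⌋

lower : ∀ a .{{_ : ℕ.NonZero a}} n → 2 ℕ.^ ⌊lg⌋ a n ℕ.≤ a ℕ.^ suc n
lower a n = 2^⌊log₂⌋≤ (a ℕ.^ suc n) {{ℕₚ.m^n≢0 a (suc n)}}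

upper : ∀ a n → a ℕ.^ suc n ℕ.< 2 ℕ.^ suc (⌊lg⌋ a n)
upper a n = <2^suc⌊log₂⌋ (a ℕ.^ suc n)

2^-cancel-< : ∀ {m n} → 2 ℕ.^ m ℕ.< 2 ℕ.^ n → m ℕ.< n
2^-cancel-< {m} {n} p with ℕₚ.<-≤-connex m n
... | inj₁ m<n = m<n
... | inj₂ n≤m = ⊥-elim (ℕₚ.<⇒≱ p (ℕₚ.^-monoʳ-≤ 2 n≤m))

lg-close : ∀ a .{{_ : ℕ.NonZero a}} m n → ⌊lg⌋ a m ℕ.* suc n ℕ.< suc (⌊lg⌋ a n) ℕ.* suc m
lg-close a m n = 2^-cancel-< (begin-strict
  2 ℕ.^ (⌊lg⌋ a m ℕ.* suc n)       ≡⟨ ℕₚ.^-*-assoc 2 (⌊lg⌋ a m) (suc n) ⟨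
  (2 ℕ.^ ⌊lg⌋ a m) ℕ.^ suc n       ≤⟨ ℕₚ.^-monoˡ-≤ (suc n) (lower a m) ⟩
  (a ℕ.^ suc m) ℕ.^ suc n          ≡⟨ ℕₚ.^-*-assoc a (suc m) (suc n) ⟩
  a ℕ.^ (suc m ℕ.* suc n)          ≡⟨ cong (a ℕ.^_) (ℕₚ.*-comm (suc m) (suc n)) ⟩
  a ℕ.^ (suc n ℕ.* suc m)          ≡⟨ ℕₚ.^-*-assoc a (suc n) (suc m) ⟨
  (a ℕ.^ suc n) ℕ.^ suc m          <⟨ ℕₚ.^-monoˡ-< (suc m) (upper a n) ⟩
  (2 ℕ.^ suc (⌊lg⌋ a n)) ℕ.^ suc m ≡⟨ ℕₚ.^-*-assoc 2 (suc (⌊lg⌋ a n)) (suc m) ⟩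
  2 ℕ.^ (suc (⌊lg⌋ a n) ℕ.* suc m) ∎)
  where open ℕₚ.≤-Reasoning

+n/ : ∀ k m → + (suc k) / suc m ≡ + k / suc m ℚ.+ + 1 / suc m
+n/ k m = trans (cong (λ j → + j / suc m) (ℕₚ.+-comm 1 k)) (sym (/-+ (+ k) (+ 1) m))

+*+-< : ∀ {a b c d} → a ℕ.* b ℕ.< c ℕ.* d → + a ℤ.* + b ℤ.< + c ℤ.* + d
+*+-< {a} {b} {c} {d} p = subst₂ ℤ._<_ (ℤₚ.pos-* a b) (ℤₚ.pos-* c d) (ℤ.+<+ p)

∣-∣-< : ∀ {p q r} → p ℚ.- q ℚ.< r → q ℚ.- p ℚ.< r → ℚ.∣ p ℚ.- q ∣ ℚ.< r
∣-∣-< {p} {q} {r} u v with ℚₚ.∣p∣≡p∨∣p∣≡-p (p ℚ.- q)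
... | inj₁ e = subst (ℚ._< r) (sym e) u
... | inj₂ e = subst (ℚ._< r) (sym (trans e (solve 2 (λ a b → :- (a :+ :- b) := b :+ :- a) refl p q))) v
  where open +-*-Solver

-- For a ≥ 1 the integer ⌊log₂ (a^m)⌋ = ⌊m log₂ a⌋ divided by m is within 1/m of log₂ a.
lg : ∀ a .{{_ : ℕ.NonZero a}} → ℝ
lg a .seq n        = + ⌊log₂ (a ℕ.^ suc n) ⌋ / suc n
lg a .cauchy ε 0<ε =
  let M , M≤ε = archimedean ε 0<ε
  in M , λ m n m≥ n≥ → ∣-∣-< {seq (lg a) m} {seq (lg a) n} (one M M≤ε m n n≥) (one M M≤ε n m m≥)
  where
  one : ∀ M → + 1 / suc M ℚ.≤ ε → ∀ m n → M ℕ.≤ n →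
        + ⌊lg⌋ a m / suc m ℚ.- + ⌊lg⌋ a n / suc n ℚ.< ε
  one M M≤ε m n n≥ = begin-strict
    s ℚ.- t                          <⟨ ℚₚ.+-monoˡ-< (ℚ.- t) (/-mono-< (+ ⌊lg⌋ a m) (+ suc (⌊lg⌋ a n)) m n (+*+-< {⌊lg⌋ a m} {suc n} {suc (⌊lg⌋ a n)} {suc m} (lg-close a m n))) ⟩
    + suc (⌊lg⌋ a n) / suc n ℚ.- t   ≡⟨ cong (ℚ._- t) (+n/ (⌊lg⌋ a n) n) ⟩
    t ℚ.+ + 1 / suc n ℚ.- t          ≡⟨ solve 2 (λ a b → a :+ b :+ :- a := b) refl t (+ 1 / suc n) ⟩
    + 1 / suc n                      ≤⟨ /-mono-≤ (+ 1) (+ 1) n M (ℤₚ.*-monoˡ-≤-nonNeg (+ 1) (ℤ.+≤+ (s≤s n≥))) ⟩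
    + 1 / suc M                      ≤⟨ M≤ε ⟩
    ε                                ∎
    where
    open ℚₚ.≤-Reasoning
    open +-*-Solver
    s t : ℚ
    s = + ⌊lg⌋ a m / suc m
    t = + ⌊lg⌋ a n / suc n

-- See log₂-correct below.
log₂ : ∀ y .{{_ : Positive y}} → ℝ
log₂ (mkℚ +[1+ n ] d _) = lg (suc n) -ᴿ lg (suc d)

ι : ℕ → ℚ
ι n = + n / 1

ι-pos : ∀ n .{{_ : ℕ.NonZero n}} → Positive (ι n)
ι-pos n = ℚₚ.normalize-pos n 1

ι-* : ∀ m n → ι (m ℕ.* n) ≡ ι m ℚ.* ι n
ι-* m n = trans (cong (_/ 1) (ℤₚ.pos-* m n)) (sym (fromℚᵘ-* (mkℚᵘ (+ m) 0) (mkℚᵘ (+ n) 0)))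

ι-^ : ∀ m n → ι (m ℕ.^ n) ≡ ι m ^ n
ι-^ m zero    = refl
ι-^ m (suc n) = trans (ι-* m (m ℕ.^ n)) (cong (ι m ℚ.*_) (ι-^ m n))

ι-mono-< : ∀ {m n} → m ℕ.< n → ι m ℚ.< ι n
ι-mono-< {m} {n} p = /-mono-< (+ m) (+ n) 0 0 (ℤₚ.*-monoʳ-<-pos (+ 1) (ℤ.+<+ p))

^-distrib-* : ∀ x y n → (x ℚ.* y) ^ n ≡ x ^ n ℚ.* y ^ n
^-distrib-* x y zero    = refl
^-distrib-* x y (suc n) = trans (cong (x ℚ.* y ℚ.*_) (^-distrib-* x y n))
  (solve 4 (λ x y a b → x :* y :* (a :* b) := x :* a :* (y :* b)) refl x y (x ^ n) (y ^ n))
  where open +-*-Solver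

1^ : ∀ n → 1ℚ ^ n ≡ 1ℚ
1^ zero    = refl
1^ (suc n) = trans (ℚₚ.*-identityˡ (1ℚ ^ n)) (1^ n)

/-neg : ∀ a n → (ℤ.- a) / suc n ≡ ℚ.- (a / suc n)
/-neg (+ zero)  n = trans (ℚₚ.0/n≡0 (suc n)) (cong ℚ.-_ (sym (ℚₚ.0/n≡0 (suc n))))
/-neg +[1+ _ ]  n = refl
/-neg -[1+ a ]  n = solve 1 (λ x → x := :- (:- x)) refl (+[1+ a ] / suc n)
  where open +-*-Solver

/-minus : ∀ a b n → a / suc n ℚ.- b / suc n ≡ (a ℤ.- b) / suc n
/-minus a b n = trans (cong (a / suc n ℚ.+_) (sym (/-neg b n))) (/-+ a (ℤ.- b) n)

_⁺ _⁻ : ℤ → ℕ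
(+ n)    ⁺ = n
-[1+ n ] ⁺ = 0
(+ n)    ⁻ = 0
-[1+ n ] ⁻ = suc n

⁺-⁻ : ∀ p → p ≡ + (p ⁺) ℤ.- + (p ⁻)
⁺-⁻ (+ n)    = sym (ℤₚ.+-identityʳ (+ n))
⁺-⁻ -[1+ n ] = refl

2ᶻ-⁺-⁻ : ∀ p → 2ᶻ p ℚ.* ι (2 ℕ.^ (p ⁻)) ≡ ι (2 ℕ.^ (p ⁺))
2ᶻ-⁺-⁻ (+ n)    = trans (ℚₚ.*-identityʳ ((+ 2 / 1) ^ n)) (sym (ι-^ 2 n))
2ᶻ-⁺-⁻ -[1+ n ] = trans (cong (ℚ.½ ^ suc n ℚ.*_) (ι-^ 2 (suc n)))
  (trans (sym (^-distrib-* ℚ.½ (+ 2 / 1) (suc n))) (1^ (suc n)))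

power-bound : ∀ a b m d C E U V .{{_ : ℕ.NonZero a}} .{{_ : ℕ.NonZero m}} .{{_ : ℕ.NonZero d}} →
  2 ℕ.^ U ℕ.≤ a ℕ.^ m → b ℕ.^ m ℕ.< 2 ℕ.^ suc V →
  C ℕ.* m ℕ.+ suc V ℕ.* d ℕ.≤ U ℕ.* d ℕ.+ E ℕ.* m →
  2 ℕ.^ C ℕ.* b ℕ.^ d ℕ.< 2 ℕ.^ E ℕ.* a ℕ.^ d
power-bound a b m d C E U V lo hi le = cancel (begin-strict
  (2 ℕ.^ C ℕ.* b ℕ.^ d) ℕ.^ m                 ≡⟨ ^-distribʳ-* m (2 ℕ.^ C) (b ℕ.^ d) ⟩
  (2 ℕ.^ C) ℕ.^ m ℕ.* (b ℕ.^ d) ℕ.^ m         ≡⟨ cong₂ ℕ._*_ (ℕₚ.^-*-assoc 2 C m) (^-swap b d m) ⟩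
  2 ℕ.^ (C ℕ.* m) ℕ.* (b ℕ.^ m) ℕ.^ d         <⟨ ℕₚ.*-monoʳ-< (2 ℕ.^ (C ℕ.* m)) {{ℕₚ.m^n≢0 2 (C ℕ.* m)}} (ℕₚ.^-monoˡ-< d hi) ⟩
  2 ℕ.^ (C ℕ.* m) ℕ.* (2 ℕ.^ suc V) ℕ.^ d     ≡⟨ cong (2 ℕ.^ (C ℕ.* m) ℕ.*_) (ℕₚ.^-*-assoc 2 (suc V) d) ⟩
  2 ℕ.^ (C ℕ.* m) ℕ.* 2 ℕ.^ (suc V ℕ.* d)     ≡⟨ ℕₚ.^-distribˡ-+-* 2 (C ℕ.* m) (suc V ℕ.* d) ⟨
  2 ℕ.^ (C ℕ.* m ℕ.+ suc V ℕ.* d)             ≤⟨ ℕₚ.^-monoʳ-≤ 2 le ⟩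
  2 ℕ.^ (U ℕ.* d ℕ.+ E ℕ.* m)                 ≡⟨ cong (2 ℕ.^_) (ℕₚ.+-comm (U ℕ.* d) (E ℕ.* m)) ⟩
  2 ℕ.^ (E ℕ.* m ℕ.+ U ℕ.* d)                 ≡⟨ ℕₚ.^-distribˡ-+-* 2 (E ℕ.* m) (U ℕ.* d) ⟩
  2 ℕ.^ (E ℕ.* m) ℕ.* 2 ℕ.^ (U ℕ.* d)         ≡⟨ cong₂ ℕ._*_ (ℕₚ.^-*-assoc 2 E m) (ℕₚ.^-*-assoc 2 U d) ⟨
  (2 ℕ.^ E) ℕ.^ m ℕ.* (2 ℕ.^ U) ℕ.^ d         ≤⟨ ℕₚ.*-monoʳ-≤ ((2 ℕ.^ E) ℕ.^ m) (ℕₚ.^-monoˡ-≤ d lo) ⟩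
  (2 ℕ.^ E) ℕ.^ m ℕ.* (a ℕ.^ m) ℕ.^ d         ≡⟨ cong ((2 ℕ.^ E) ℕ.^ m ℕ.*_) (^-swap a m d) ⟩
  (2 ℕ.^ E) ℕ.^ m ℕ.* (a ℕ.^ d) ℕ.^ m         ≡⟨ ^-distribʳ-* m (2 ℕ.^ E) (a ℕ.^ d) ⟨
  (2 ℕ.^ E ℕ.* a ℕ.^ d) ℕ.^ m                 ∎)
  where
  open ℕₚ.≤-Reasoning
  ^-swap : ∀ x i j → (x ℕ.^ i) ℕ.^ j ≡ (x ℕ.^ j) ℕ.^ i
  ^-swap x i j = trans (ℕₚ.^-*-assoc x i j) (trans (cong (x ℕ.^_) (ℕₚ.*-comm i j)) (sym (ℕₚ.^-*-assoc x j i)))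
  ^-distribʳ-* : ∀ n x y → (x ℕ.* y) ℕ.^ n ≡ x ℕ.^ n ℕ.* y ℕ.^ n
  ^-distribʳ-* zero    x y = refl
  ^-distribʳ-* (suc n) x y = trans (cong (x ℕ.* y ℕ.*_) (^-distribʳ-* n x y)) (interchange x y (x ℕ.^ n) (y ℕ.^ n))
    where open import Algebra.Properties.CommutativeSemigroup ℕₚ.*-commutativeSemigroup using (interchange)
  cancel : ∀ {x y} → x ℕ.^ m ℕ.< y ℕ.^ m → x ℕ.< y
  cancel {x} {y} p with ℕₚ.<-≤-connex x y
  ... | inj₁ x<y = x<y
  ... | inj₂ y≤x = ⊥-elim (ℕₚ.<⇒≱ p (ℕₚ.^-monoˡ-≤ m y≤x))

transpose : ∀ C E U W m d → (+ C ℤ.- + E) ℤ.* + m ℤ.≤ (+ U ℤ.- + W) ℤ.* + d →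
  C ℕ.* m ℕ.+ W ℕ.* d ℕ.≤ U ℕ.* d ℕ.+ E ℕ.* m
transpose C E U W m d le = ℤₚ.drop‿+≤+ (subst₂ ℤ._≤_ eqˡ eqʳ (ℤₚ.+-monoˡ-≤ (+ E ℤ.* + m ℤ.+ + W ℤ.* + d) le))
  where
  open Data.Integer.Solver.+-*-Solver
  +*+ : ∀ i j k l → + i ℤ.* + j ℤ.+ + k ℤ.* + l ≡ + (i ℕ.* j ℕ.+ k ℕ.* l)
  +*+ i j k l = sym (trans (ℤₚ.pos-+ (i ℕ.* j) (k ℕ.* l)) (cong₂ ℤ._+_ (ℤₚ.pos-* i j) (ℤₚ.pos-* k l)))
  eqˡ : (+ C ℤ.- + E) ℤ.* + m ℤ.+ (+ E ℤ.* + m ℤ.+ + W ℤ.* + d) ≡ + (C ℕ.* m ℕ.+ W ℕ.* d)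
  eqˡ = trans (solve 5 (λ c e w m d → (c :+ :- e) :* m :+ (e :* m :+ w :* d) := c :* m :+ w :* d) refl
                 (+ C) (+ E) (+ W) (+ m) (+ d)) (+*+ C m W d)
  eqʳ : (+ U ℤ.- + W) ℤ.* + d ℤ.+ (+ E ℤ.* + m ℤ.+ + W ℤ.* + d) ≡ + (U ℕ.* d ℕ.+ E ℕ.* m)
  eqʳ = trans (solve 5 (λ u e w m d → (u :+ :- w) :* d :+ (e :* m :+ w :* d) := u :* d :+ e :* m) refl
                 (+ U) (+ E) (+ W) (+ m) (+ d)) (+*+ U d E m)

log₂-correct : ∀ y .{{_ : Positive y}} → 2^ log₂ y ≐ y
log₂-correct y@(mkℚ +[1+ n′ ] d′ _) = ℚₚ.positive⁻¹ y , λ { p (suc d) → below p d , above p d }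
  where
  open +-*-Solver
  a b : ℕ
  a = suc n′
  b = suc d′

  y*b : y ℚ.* ι b ≡ ι a
  y*b = trans (cong (ℚ._* ι b) (sym (ℚₚ.fromℚᵘ-toℚᵘ y))) (trans (fromℚᵘ-* (mkℚᵘ (+ a) d′) (mkℚᵘ (+ b) 0))
    (ℚₚ.fromℚᵘ-cong {mkℚᵘ (+ a) d′ ℚᵘ.* mkℚᵘ (+ b) 0} {mkℚᵘ (+ a) 0}
      (*≡* (trans (ℤₚ.*-identityʳ (+ a ℤ.* + b)) (cong (λ z → + a ℤ.* + z) (sym (ℕₚ.*-identityʳ b)))))))

  y^d*b^d : ∀ d → y ^ d ℚ.* ι (b ℕ.^ d) ≡ ι (a ℕ.^ d)
  y^d*b^d d = trans (cong (y ^ d ℚ.*_) (ι-^ b d)) (trans (sym (^-distrib-* y (ι b) d))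
    (trans (cong (_^ d) y*b) (sym (ι-^ a d))))

  module _ (p : ℤ) (d : ℕ) where
    B E C A : ℕ
    B = b ℕ.^ suc d
    A = a ℕ.^ suc d
    E = 2 ℕ.^ (p ⁻)
    C = 2 ℕ.^ (p ⁺)

    EB-nonNeg : NonNegative (ι E ℚ.* ι B)
    EB-nonNeg = ℚₚ.nonNeg*nonNeg⇒nonNeg (ι E) {{ℚₚ.normalize-nonNeg E 1}} (ι B) {{ℚₚ.normalize-nonNeg B 1}}

    lhs : 2ᶻ p ℚ.* (ι E ℚ.* ι B) ≡ ι (C ℕ.* B)
    lhs = trans (sym (ℚₚ.*-assoc (2ᶻ p) (ι E) (ι B))) (trans (cong (ℚ._* ι B) (2ᶻ-⁺-⁻ p)) (sym (ι-* C B)))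

    rhs : y ^ suc d ℚ.* (ι E ℚ.* ι B) ≡ ι (E ℕ.* A)
    rhs = trans (solve 3 (λ x e b → x :* (e :* b) := e :* (x :* b)) refl (y ^ suc d) (ι E) (ι B))
      (trans (cong (ι E ℚ.*_) (y^d*b^d (suc d))) (sym (ι-* E A)))

    below : fromℚ (p / suc d) <ᴿ log₂ y → 2ᶻ p ℚ.< y ^ suc d
    below (δ , 0<δ , N , f) =
      ℚₚ.*-cancelʳ-<-nonNeg (ι E ℚ.* ι B) {{EB-nonNeg}} (subst₂ ℚ._<_ (sym lhs) (sym rhs) (ι-mono-<
        (power-bound a b (suc n) (suc d) (p ⁺) (p ⁻) U V (lower a n) (upper b n) nat)))
      where
      M n U V : ℕ
      M = proj₁ (archimedean δ 0<δ)
      n = N ℕ.⊔ M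
      U = ⌊lg⌋ a n
      V = ⌊lg⌋ b n
      u v r : ℚ
      u = + U / suc n
      v = + V / suc n
      r = + 1 / suc n
      r≤δ : r ℚ.≤ δ
      r≤δ = ℚₚ.≤-trans (/-mono-≤ (+ 1) (+ 1) n M (ℤₚ.*-monoˡ-≤-nonNeg (+ 1) (ℤ.+≤+ (s≤s (ℕₚ.m≤n⊔m N M)))))
                       (proj₂ (archimedean δ 0<δ))
      rat : p / suc d ℚ.≤ (+ U ℤ.- + suc V) / suc n
      rat = begin
        p / suc d                                 ≡⟨ solve 2 (λ x r → x := x :+ r :+ :- r) refl (p / suc d) r ⟩
        p / suc d ℚ.+ r ℚ.- r                     ≤⟨ ℚₚ.+-monoˡ-≤ (ℚ.- r) (ℚₚ.+-monoʳ-≤ (p / suc d) r≤δ) ⟩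
        p / suc d ℚ.+ δ ℚ.- r                     ≤⟨ ℚₚ.+-monoˡ-≤ (ℚ.- r) (f n (ℕₚ.m≤m⊔n N M)) ⟩
        u ℚ.+ (ℚ.- 1ℚ) ℚ.* v ℚ.- r                ≡⟨ solve 3 (λ u v r → u :+ con (ℚ.- 1ℚ) :* v :+ :- r := u :+ :- (v :+ r)) refl u v r ⟩
        u ℚ.- (v ℚ.+ r)                           ≡⟨ cong (λ z → u ℚ.- z) (+n/ V n) ⟨
        u ℚ.- + suc V / suc n                     ≡⟨ /-minus (+ U) (+ suc V) n ⟩
        (+ U ℤ.- + suc V) / suc n                 ∎
        where open ℚₚ.≤-Reasoning
      nat : p ⁺ ℕ.* suc n ℕ.+ suc V ℕ.* suc d ℕ.≤ U ℕ.* suc d ℕ.+ p ⁻ ℕ.* suc n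
      nat = transpose (p ⁺) (p ⁻) U (suc V) (suc n) (suc d)
        (subst (λ z → z ℤ.* + suc n ℤ.≤ (+ U ℤ.- + suc V) ℤ.* + suc d) (⁺-⁻ p) (/-cancel-≤ p (+ U ℤ.- + suc V) d n rat))

    above : log₂ y <ᴿ fromℚ (p / suc d) → y ^ suc d ℚ.< 2ᶻ p
    above (δ , 0<δ , N , f) =
      ℚₚ.*-cancelʳ-<-nonNeg (ι E ℚ.* ι B) {{EB-nonNeg}} (subst₂ ℚ._<_ (sym rhs) (sym lhs) (ι-mono-<
        (power-bound b a (suc n) (suc d) (p ⁻) (p ⁺) V U (lower b n) (upper a n) nat)))
      where
      M n U V : ℕ
      M = proj₁ (archimedean δ 0<δ)
      n = N ℕ.⊔ M
      U = ⌊lg⌋ a n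
      V = ⌊lg⌋ b n
      u v r : ℚ
      u = + U / suc n
      v = + V / suc n
      r = + 1 / suc n
      r≤δ : r ℚ.≤ δ
      r≤δ = ℚₚ.≤-trans (/-mono-≤ (+ 1) (+ 1) n M (ℤₚ.*-monoˡ-≤-nonNeg (+ 1) (ℤ.+≤+ (s≤s (ℕₚ.m≤n⊔m N M)))))
                       (proj₂ (archimedean δ 0<δ))
      rat : (+ suc U ℤ.- + V) / suc n ℚ.≤ p / suc d
      rat = begin
        (+ suc U ℤ.- + V) / suc n                 ≡⟨ /-minus (+ suc U) (+ V) n ⟨
        + suc U / suc n ℚ.- v                     ≡⟨ cong (ℚ._- v) (+n/ U n) ⟩
        u ℚ.+ r ℚ.- v                             ≡⟨ solve 3 (λ u v r → u :+ r :+ :- v := u :+ con (ℚ.- 1ℚ) :* v :+ r) refl u v r ⟩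
        u ℚ.+ (ℚ.- 1ℚ) ℚ.* v ℚ.+ r                ≤⟨ ℚₚ.+-monoʳ-≤ (u ℚ.+ (ℚ.- 1ℚ) ℚ.* v) r≤δ ⟩
        u ℚ.+ (ℚ.- 1ℚ) ℚ.* v ℚ.+ δ                ≤⟨ f n (ℕₚ.m≤m⊔n N M) ⟩
        p / suc d                                 ∎
        where open ℚₚ.≤-Reasoning
      nat : p ⁻ ℕ.* suc n ℕ.+ suc U ℕ.* suc d ℕ.≤ V ℕ.* suc d ℕ.+ p ⁺ ℕ.* suc n
      nat = subst₂ ℕ._≤_ (ℕₚ.+-comm (suc U ℕ.* suc d) (p ⁻ ℕ.* suc n)) (ℕₚ.+-comm (p ⁺ ℕ.* suc n) (V ℕ.* suc d))
        (transpose (suc U) V (p ⁺) (p ⁻) (suc d) (suc n)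
          (subst (λ z → (+ suc U ℤ.- + V) ℤ.* + suc d ℤ.≤ z ℤ.* + suc n) (⁺-⁻ p) (/-cancel-≤ (+ suc U ℤ.- + V) p n d rat)))

h[2^i-1]-pos : ∀ i .{{_ : ℕ.NonZero i}} → Positive (h (2 ℕ.^ i ∸ 1))
h[2^i-1]-pos (suc i) = h-pos (2 ℕ.^ suc i ∸ 1)
  {{ℕ.>-nonZero (ℕₚ.m<n⇒0<n∸m (ℕₚ.^-monoʳ-< 2 (s≤s (s≤s z≤n)) {0} {suc i} (s≤s z≤n)))}}

αTerm : ∀ i → .{{_ : ℕ.NonZero i}} → ℝ
αTerm i = (+ 1 / (2 ℕ.^ i)) {{ℕₚ.m^n≢0 2 i}} ⋆ log₂ (h (2 ℕ.^ i ∸ 1)) {{h[2^i-1]-pos i}}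

{-# OPTIONS --safe #-}
module Submission where

-- By telescoping, ℙ(DTCS(k) = T) = k / X(T) where X(T) is the product of
-- 2 h_{m-1} over the internal vertices of T with m leaves below them.  As h is
-- increasing and log-concave, two complete trees of equal height get a smaller
-- X when their last rows are merged into one (spreading), and rotating a small
-- uncle down below a bigger nephew also lowers X; together these moves bring
-- every tree to CBT, strictly unless it already is an ordering of it.  The
-- number of subtrees of CBT(k) with 2^i leaves is k/2^i up to a bounded error
-- and all but about log₂ k subtrees are of this kind, whence
-- log₂ X(CBT(k)) = k (1 + Σ_{i ≤ log₂ k} log₂ h_{2^i-1} / 2^i) + O(log² k).

open import Defs
open import Data.Bool.Base using (Bool; true; false; T; _∧_; if_then_else_)
open import Data.Bool.Properties using (T-∧)
open import Data.Empty using (⊥; ⊥-elim)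
open import Data.Empty.Irrelevant using () renaming (⊥-elim to ⊥-elim-irr)
open import Data.Fin.Base as Fin using (Fin; zero; suc; toℕ; fromℕ<)
import Data.Fin.Properties as Finₚ
open import Data.Integer.Base as ℤ using (+_; +[1+_])
import Data.Integer.Properties as ℤₚ
open import Data.List.Base using (List; []; _∷_; map; concatMap; tabulate; _++_)
open import Data.Nat.Base as ℕ using (ℕ; zero; suc; NonZero; z≤n; s≤s; _∸_; _⊓_)
open import Data.Nat.DivMod using (m/n*n≤m; m≡m%n+[m/n]*n; m%n<n)
open import Data.Nat.Induction using (<-wellFounded)
open import Data.Nat.Logarithm using (⌊log₂_⌋; ⌊log₂⌋-mono-≤; ⌊log₂[2^n]⌋≡n)
import Data.Nat.Properties as ℕₚ
import Data.Nat.Tactic.RingSolver as ℕ-Tactic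
open import Data.Product.Base using (Σ-syntax; ∃-syntax; _×_; _,_; proj₁; proj₂)
open import Data.Rational.Base as ℚ using (ℚ; mkℚ; _/_; -_; 0ℚ; 1ℚ; Positive)
import Data.Rational.Properties as ℚₚ
open import Data.Rational.Solver using (module +-*-Solver)
open import Data.Rational.Unnormalised.Base as ℚᵘ using (mkℚᵘ; *≡*)
open import Data.Sum.Base using (_⊎_; inj₁; inj₂)
open import Data.Unit.Base using (tt)
open import Function.Base using (_∘_)
open import Function.Bundles using (_⇔_; mk⇔; module Equivalence)
open import Induction.WellFounded using (Acc; acc)
open import Relation.Binary.PropositionalEquality hiding ([_])
open import Relation.Nullary.Decidable using (does; yes; no)

-- Log-concavity of the harmonic numbers

-- Minimality and uniqueness come together: each move either keeps the unordered tree or lowers `X`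
-- strictly, so the chain of moves from a tree to `CBT` also settles the case of equality. As the
-- subtrees may be assumed complete, only pairs of filled trees have to be compared, and the
-- difference of heights decides the move: equal heights are merged, a larger difference is reduced
-- by rotation. A tree with a full last row is also the next higher tree with an empty last row, and
-- this double reading makes the cases fit together. The obstacle in the asymptotics is that reals
-- are Cauchy sequences and that `log₂` turns products into sums only up to a rounding error of
-- order 1/n at index n. Logarithms are therefore compared index by index up to such errors. The
-- bounds on which the tail of the series rests are free of rounding errors, hence uniform in n, and
-- so the diagonal of the partial sums is a Cauchy sequence that represents the limit.

*-pos : ∀ {a b} → 0ℚ ℚ.< a → 0ℚ ℚ.< b → 0ℚ ℚ.< a ℚ.* b
*-pos {a} {b} p q = ℚₚ.positive⁻¹ (a ℚ.* b) {{ℚₚ.pos*pos⇒pos a {{ℚ.positive p}} b {{ℚ.positive q}}}}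

*-mono-≤-pos : ∀ {a b c d} → 0ℚ ℚ.< a → 0ℚ ℚ.< c → a ℚ.≤ b → c ℚ.≤ d → a ℚ.* c ℚ.≤ b ℚ.* d
*-mono-≤-pos {a} {b} {c} {d} 0<a 0<c a≤b c≤d = ℚₚ.≤-trans
  (ℚₚ.*-monoˡ-≤-nonNeg a {{ℚ.nonNegative (ℚₚ.<⇒≤ 0<a)}} c≤d)
  (ℚₚ.*-monoʳ-≤-nonNeg d {{ℚ.nonNegative (ℚₚ.≤-trans (ℚₚ.<⇒≤ 0<c) c≤d)}} a≤b)

*-mono-<-≤-pos : ∀ {a b c d} → 0ℚ ℚ.< a → 0ℚ ℚ.< c → a ℚ.< b → c ℚ.≤ d → a ℚ.* c ℚ.< b ℚ.* d
*-mono-<-≤-pos {a} {b} {c} {d} 0<a 0<c a<b c≤d = ℚₚ.≤-<-trans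
  (ℚₚ.*-monoˡ-≤-nonNeg a {{ℚ.nonNegative (ℚₚ.<⇒≤ 0<a)}} c≤d)
  (ℚₚ.*-monoˡ-<-pos d {{ℚ.positive (ℚₚ.<-≤-trans 0<c c≤d)}} a<b)

*-mono-≤-<-pos : ∀ {a b c d} → 0ℚ ℚ.< a → 0ℚ ℚ.< c → a ℚ.≤ b → c ℚ.< d → a ℚ.* c ℚ.< b ℚ.* d
*-mono-≤-<-pos {a} {b} {c} {d} 0<a 0<c a≤b c<d =
  subst₂ ℚ._<_ (ℚₚ.*-comm c a) (ℚₚ.*-comm d b) (*-mono-<-≤-pos 0<c 0<a c<d a≤b)

p<p+q : ∀ p {q} → 0ℚ ℚ.< q → p ℚ.< p ℚ.+ q
p<p+q p {q} 0<q = subst (ℚ._< p ℚ.+ q) (ℚₚ.+-identityʳ p) (ℚₚ.+-monoʳ-< p 0<q)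

p≤p+q : ∀ p {q} → 0ℚ ℚ.≤ q → p ℚ.≤ p ℚ.+ q
p≤p+q p {q} 0≤q = subst (ℚ._≤ p ℚ.+ q) (ℚₚ.+-identityʳ p) (ℚₚ.+-monoʳ-≤ p 0≤q)

p<q⇒0<q-p : ∀ {p q} → p ℚ.< q → 0ℚ ℚ.< q ℚ.- p
p<q⇒0<q-p {p} {q} p<q = subst (ℚ._< q ℚ.- p) (ℚₚ.+-inverseʳ p) (ℚₚ.+-monoˡ-< (ℚ.- p) p<q)

p≤q⇒0≤q-p : ∀ {p q} → p ℚ.≤ q → 0ℚ ℚ.≤ q ℚ.- p
p≤q⇒0≤q-p {p} {q} p≤q = subst (ℚ._≤ q ℚ.- p) (ℚₚ.+-inverseʳ p) (ℚₚ.+-monoˡ-≤ (ℚ.- p) p≤q)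

1/suc>0 : ∀ n → 0ℚ ℚ.< + 1 / suc n
1/suc>0 n = ℚₚ.positive⁻¹ (+ 1 / suc n) {{1/suc-pos n}}

1/suc-antimono : ∀ {m n} → m ℕ.≤ n → + 1 / suc n ℚ.≤ + 1 / suc m
1/suc-antimono {m} {n} p = /-mono-≤ (+ 1) (+ 1) n m (ℤₚ.*-monoˡ-≤-nonNeg (+ 1) (ℤ.+≤+ (s≤s p)))

h>0 : ∀ n .{{_ : NonZero n}} → 0ℚ ℚ.< h n
h>0 n = ℚₚ.positive⁻¹ (h n) {{h-pos n}}

h-step : ∀ n → h n ℚ.< h (suc n)
h-step n = p<p+q (h n) (1/suc>0 n)

h-mono-≤ : ∀ {m n} → m ℕ.≤ n → h m ℚ.≤ h n
h-mono-≤ {m} p = go (ℕₚ.≤⇒≤′ p)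
  where
  go : ∀ {n} → m ℕ.≤′ n → h m ℚ.≤ h n
  go ℕ.≤′-refl     = ℚₚ.≤-refl
  go (ℕ.≤′-step {n} q) = ℚₚ.≤-trans (go q) (ℚₚ.<⇒≤ (h-step n))

h-mono-< : ∀ {m n} → m ℕ.< n → h m ℚ.< h n
h-mono-< {m} p = ℚₚ.<-≤-trans (h-step m) (h-mono-≤ p)

-- Both sides are sums of `j` consecutive reciprocals; those on the left start later and are
-- termwise smaller.
h-increment : ∀ n i j → h (n ℕ.+ i ℕ.+ j) ℚ.- h (n ℕ.+ i) ℚ.≤ h (n ℕ.+ j) ℚ.- h n
h-increment n i zero rewrite ℕₚ.+-identityʳ (n ℕ.+ i) | ℕₚ.+-identityʳ n =
  ℚₚ.≤-reflexive (trans (ℚₚ.+-inverseʳ (h (n ℕ.+ i))) (sym (ℚₚ.+-inverseʳ (h n))))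
h-increment n i (suc j) rewrite ℕₚ.+-suc (n ℕ.+ i) j | ℕₚ.+-suc n j = begin
  h (n ℕ.+ i ℕ.+ j) ℚ.+ + 1 / suc (n ℕ.+ i ℕ.+ j) ℚ.- h (n ℕ.+ i)   ≡⟨ move (h (n ℕ.+ i ℕ.+ j)) _ (h (n ℕ.+ i)) ⟩
  h (n ℕ.+ i ℕ.+ j) ℚ.- h (n ℕ.+ i) ℚ.+ + 1 / suc (n ℕ.+ i ℕ.+ j)
    ≤⟨ ℚₚ.+-mono-≤ (h-increment n i j) (1/suc-antimono (ℕₚ.+-monoˡ-≤ j (ℕₚ.m≤m+n n i))) ⟩
  h (n ℕ.+ j) ℚ.- h n ℚ.+ + 1 / suc (n ℕ.+ j)                       ≡⟨ move (h (n ℕ.+ j)) _ (h n) ⟨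
  h (n ℕ.+ j) ℚ.+ + 1 / suc (n ℕ.+ j) ℚ.- h n                       ∎
  where
  open ℚₚ.≤-Reasoning
  move : ∀ a b c → a ℚ.+ b ℚ.- c ≡ a ℚ.- c ℚ.+ b
  move = solve 3 (λ a b c → a :+ b :+ :- c := a :+ :- c :+ b) refl
    where open +-*-Solver

module _ (n i j : ℕ) where
  private
    a u v w : ℚ
    a = h n
    u = h (n ℕ.+ i) ℚ.- a
    v = h (n ℕ.+ j) ℚ.- a
    w = h (n ℕ.+ i ℕ.+ j) ℚ.- h (n ℕ.+ i)
    open +-*-Solver
    lhs : a ℚ.* h (n ℕ.+ i ℕ.+ j) ≡ a ℚ.* a ℚ.+ a ℚ.* u ℚ.+ a ℚ.* w
    lhs = solve 3 (λ a b c → a :* c := a :* a :+ a :* (b :+ :- a) :+ a :* (c :+ :- b)) refl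
            a (h (n ℕ.+ i)) (h (n ℕ.+ i ℕ.+ j))
    rhs : h (n ℕ.+ i) ℚ.* h (n ℕ.+ j) ≡ a ℚ.* a ℚ.+ a ℚ.* u ℚ.+ a ℚ.* v ℚ.+ u ℚ.* v
    rhs = solve 3 (λ a b c → b :* c := a :* a :+ a :* (b :+ :- a) :+ a :* (c :+ :- a) :+ (b :+ :- a) :* (c :+ :- a)) refl
            a (h (n ℕ.+ i)) (h (n ℕ.+ j))
    mid : a ℚ.* a ℚ.+ a ℚ.* u ℚ.+ a ℚ.* w ℚ.≤ a ℚ.* a ℚ.+ a ℚ.* u ℚ.+ a ℚ.* v
    mid = ℚₚ.+-monoʳ-≤ (a ℚ.* a ℚ.+ a ℚ.* u) (ℚₚ.*-monoˡ-≤-nonNeg a {{h-nonNeg n}} (h-increment n i j))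
    diff≥0 : ∀ k → 0ℚ ℚ.≤ h (n ℕ.+ k) ℚ.- a
    diff≥0 k = p≤q⇒0≤q-p (h-mono-≤ (ℕₚ.m≤m+n n k))
    diff>0 : ∀ k → 0 ℕ.< k → 0ℚ ℚ.< h (n ℕ.+ k) ℚ.- a
    diff>0 k p = p<q⇒0<q-p (h-mono-< (ℕₚ.m<m+n n p))

  -- In terms of the increments this is a(a + u + w) ≤ (a + u)(a + v): concavity gives w ≤ v, and
  -- the right side exceeds a(a + u + v) by u v ≥ 0.
  h-log-concave : h n ℚ.* h (n ℕ.+ i ℕ.+ j) ℚ.≤ h (n ℕ.+ i) ℚ.* h (n ℕ.+ j)
  h-log-concave = subst₂ ℚ._≤_ (sym lhs) (sym rhs) (ℚₚ.≤-trans mid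
    (p≤p+q (a ℚ.* a ℚ.+ a ℚ.* u ℚ.+ a ℚ.* v)
      (ℚₚ.nonNegative⁻¹ (u ℚ.* v) {{ℚₚ.nonNeg*nonNeg⇒nonNeg u {{ℚ.nonNegative (diff≥0 i)}} v {{ℚ.nonNegative (diff≥0 j)}}}})))

  -- The strict gain is the product u v of two positive increments.
  h-log-concave-strict : 0 ℕ.< i → 0 ℕ.< j → h n ℚ.* h (n ℕ.+ i ℕ.+ j) ℚ.< h (n ℕ.+ i) ℚ.* h (n ℕ.+ j)
  h-log-concave-strict 0<i 0<j = subst₂ ℚ._<_ (sym lhs) (sym rhs) (ℚₚ.≤-<-trans mid
    (p<p+q (a ℚ.* a ℚ.+ a ℚ.* u ℚ.+ a ℚ.* v)
      (*-pos (diff>0 i 0<i) (diff>0 j 0<j))))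

-- The factor of 1/q_m that survives the telescoping. `pred` identifies the arguments 0 and 1, where
-- the value is 0, hence the lower bounds on sizes in the lemmas below.
toll : ℕ → ℚ
toll m = + 2 / 1 ℚ.* h (ℕ.pred m)

-- X is normalised so that ℙ[ DTCS (size T) ≡ T ] = size T / X T.
X : Tree → ℚ
X leaf       = 1ℚ
X (node l r) = toll (size l ℕ.+ size r) ℚ.* (X l ℚ.* X r)

toll>0 : ∀ {m} → 2 ℕ.≤ m → 0ℚ ℚ.< toll m
toll>0 {suc zero} (s≤s ())
toll>0 {suc (suc n)} _ = ℚₚ.positive⁻¹ (toll (suc (suc n))) {{2h-pos n}}

toll-mono-< : ∀ {m n} → 1 ℕ.≤ m → m ℕ.< n → toll m ℚ.< toll n
toll-mono-< {suc m} {suc n} _ (s≤s p) = ℚₚ.*-monoʳ-<-pos (+ 2 / 1) (h-mono-< p)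

private
  4* : ∀ a b → (+ 2 / 1 ℚ.* a) ℚ.* (+ 2 / 1 ℚ.* b) ≡ + 4 / 1 ℚ.* (a ℚ.* b)
  4* = solve 2 (λ a b → (con (+ 2 / 1) :* a) :* (con (+ 2 / 1) :* b) := con (+ 4 / 1) :* (a :* b)) refl
    where open +-*-Solver

toll-log-concave : ∀ m i j → 1 ℕ.≤ m → toll m ℚ.* toll (m ℕ.+ i ℕ.+ j) ℚ.≤ toll (m ℕ.+ i) ℚ.* toll (m ℕ.+ j)
toll-log-concave (suc n) i j _ = subst₂ ℚ._≤_
  (sym (4* (h n) (h (n ℕ.+ i ℕ.+ j)))) (sym (4* (h (n ℕ.+ i)) (h (n ℕ.+ j))))
  (ℚₚ.*-monoˡ-≤-nonNeg (+ 4 / 1) (h-log-concave n i j))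

toll-log-concave-strict : ∀ m i j → 1 ℕ.≤ m → 0 ℕ.< i → 0 ℕ.< j →
  toll m ℚ.* toll (m ℕ.+ i ℕ.+ j) ℚ.< toll (m ℕ.+ i) ℚ.* toll (m ℕ.+ j)
toll-log-concave-strict (suc n) i j _ p q = subst₂ ℚ._<_
  (sym (4* (h n) (h (n ℕ.+ i ℕ.+ j)))) (sym (4* (h (n ℕ.+ i)) (h (n ℕ.+ j))))
  (ℚₚ.*-monoʳ-<-pos (+ 4 / 1) (h-log-concave-strict n i j p q))

size>0 : ∀ T → 1 ℕ.≤ size T
size>0 leaf       = s≤s z≤n
size>0 (node l r) = ℕₚ.≤-trans (size>0 l) (ℕₚ.m≤m+n _ _)

X>0 : ∀ T → 0ℚ ℚ.< X T
X>0 leaf       = ℚₚ.positive⁻¹ 1ℚ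
X>0 (node l r) = *-pos (toll>0 (ℕₚ.+-mono-≤ (size>0 l) (size>0 r))) (*-pos (X>0 l) (X>0 r))

-- Unordered equality of trees and comparison by `X`

≅-refl : ∀ T → T ≅ T
≅-refl leaf       = leaf
≅-refl (node l r) = node (≅-refl l) (≅-refl r)

≅-sym : ∀ {T U} → T ≅ U → U ≅ T
≅-sym leaf       = leaf
≅-sym (node p q) = node (≅-sym p) (≅-sym q)
≅-sym (swap p q) = swap (≅-sym q) (≅-sym p)

≅-trans : ∀ {T U V} → T ≅ U → U ≅ V → T ≅ V
≅-trans leaf       leaf       = leaf
≅-trans (node p q) (node r s) = node (≅-trans p r) (≅-trans q s)
≅-trans (node p q) (swap r s) = swap (≅-trans p r) (≅-trans q s)
≅-trans (swap p q) (node r s) = swap (≅-trans p s) (≅-trans q r)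
≅-trans (swap p q) (swap r s) = node (≅-trans p s) (≅-trans q r)

≅⇒size≡ : ∀ {T U} → T ≅ U → size T ≡ size U
≅⇒size≡ leaf       = refl
≅⇒size≡ (node p q) = cong₂ ℕ._+_ (≅⇒size≡ p) (≅⇒size≡ q)
≅⇒size≡ (swap {l} {r} {l′} {r′} p q) =
  trans (cong₂ ℕ._+_ (≅⇒size≡ p) (≅⇒size≡ q)) (ℕₚ.+-comm (size r′) (size l′))

≅⇒X≡ : ∀ {T U} → T ≅ U → X T ≡ X U
≅⇒X≡ leaf       = refl
≅⇒X≡ (node p q) = cong₂ ℚ._*_ (cong toll (≅⇒size≡ (node p q))) (cong₂ ℚ._*_ (≅⇒X≡ p) (≅⇒X≡ q))
≅⇒X≡ (swap {l} {r} {l′} {r′} p q) = cong₂ ℚ._*_ (cong toll (≅⇒size≡ (swap {l} {r} {l′} {r′} p q)))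
  (trans (cong₂ ℚ._*_ (≅⇒X≡ p) (≅⇒X≡ q)) (ℚₚ.*-comm (X r′) (X l′)))

infix 4 _⊒_

-- The alternative to strict descent is unordered equality rather than equality of `X`; this is what
-- makes the minimiser unique up to ordering.
_⊒_ : Tree → Tree → Set
T ⊒ U = T ≅ U ⊎ X U ℚ.< X T

⊒-refl : ∀ {T} → T ⊒ T
⊒-refl {T} = inj₁ (≅-refl T)

⊒-reflexive : ∀ {T U} → T ≡ U → T ⊒ U
⊒-reflexive refl = ⊒-refl

⊒-trans : ∀ {T U V} → T ⊒ U → U ⊒ V → T ⊒ V
⊒-trans         (inj₁ p) (inj₁ q) = inj₁ (≅-trans p q)
⊒-trans {V = V} (inj₁ p) (inj₂ q) = inj₂ (subst (X V ℚ.<_) (sym (≅⇒X≡ p)) q)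
⊒-trans {T}     (inj₂ p) (inj₁ q) = inj₂ (subst (ℚ._< X T) (≅⇒X≡ q) p)
⊒-trans         (inj₂ p) (inj₂ q) = inj₂ (ℚₚ.<-trans q p)

⊒⇒≥ : ∀ {T U} → T ⊒ U → X U ℚ.≤ X T
⊒⇒≥ (inj₁ p) = ℚₚ.≤-reflexive (sym (≅⇒X≡ p))
⊒⇒≥ (inj₂ p) = ℚₚ.<⇒≤ p

⊒-comm : ∀ l r → node l r ⊒ node r l
⊒-comm l r = inj₁ (swap (≅-refl l) (≅-refl r))

X-node-< : ∀ l r l′ r′ → size l ≡ size l′ → size r ≡ size r′ →
           X l′ ℚ.* X r′ ℚ.< X l ℚ.* X r → X (node l′ r′) ℚ.< X (node l r)
X-node-< l r l′ r′ sl sr p = subst (λ m → m ℚ.* (X l′ ℚ.* X r′) ℚ.< X (node l r))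
  (cong toll (cong₂ ℕ._+_ sl sr))
  (*-mono-≤-<-pos (toll>0 (ℕₚ.+-mono-≤ (size>0 l) (size>0 r))) (*-pos (X>0 l′) (X>0 r′)) ℚₚ.≤-refl p)

-- Equal sizes keep the toll of the root fixed, so only the product over the two children is
-- compared.
⊒-node : ∀ {l r l′ r′} → size l ≡ size l′ → size r ≡ size r′ → l ⊒ l′ → r ⊒ r′ → node l r ⊒ node l′ r′
⊒-node {l} {r} {l′} {r′} sl sr p q with p | q
... | inj₁ a | inj₁ b = inj₁ (node a b)
... | inj₁ _ | inj₂ b = inj₂ (X-node-< l r l′ r′ sl sr (*-mono-≤-<-pos (X>0 l′) (X>0 r′) (⊒⇒≥ p) b))
... | inj₂ a | _      = inj₂ (X-node-< l r l′ r′ sl sr (*-mono-<-≤-pos (X>0 l′) (X>0 r′) a (⊒⇒≥ q)))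

-- Optimality of the complete binary tree

F : ℕ → ℕ → ℚ
F d x = X (filled d x)

F>0 : ∀ d x → 0ℚ ℚ.< F d x
F>0 d x = X>0 (filled d x)

-- The value of `X` on the two subtrees of `filled (suc d) x`, without the toll of the root. It is
-- also the product for two trees of height `d` that share `x` places, the first row being filled up
-- first.
P : ℕ → ℕ → ℚ
P d x = F d (x ⊓ 2 ℕ.^ d) ℚ.* F d (x ∸ 2 ℕ.^ d)

P>0 : ∀ d x → 0ℚ ℚ.< P d x
P>0 d x = *-pos (F>0 d (x ⊓ 2 ℕ.^ d)) (F>0 d (x ∸ 2 ℕ.^ d))

F-suc : ∀ d {x} → x ℕ.≤ 2 ℕ.^ suc d → F (suc d) x ≡ toll (2 ℕ.^ suc d ℕ.+ x) ℚ.* P d x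
F-suc d {x} p = cong (λ m → toll m ℚ.* P d x) (size-filled (suc d) x p)

P-low : ∀ d {x} → x ℕ.≤ 2 ℕ.^ d → P d x ≡ F d x ℚ.* F d 0
P-low d p = cong₂ (λ u v → F d u ℚ.* F d v) (ℕₚ.m≤n⇒m⊓n≡m p) (ℕₚ.m≤n⇒m∸n≡0 p)

P-high : ∀ d x → P d (2 ℕ.^ d ℕ.+ x) ≡ F d (2 ℕ.^ d) ℚ.* F d x
P-high d x = cong₂ (λ u v → F d u ℚ.* F d v)
  (ℕₚ.m≥n⇒m⊓n≡n (ℕₚ.m≤m+n (2 ℕ.^ d) x)) (ℕₚ.m+n∸m≡n (2 ℕ.^ d) x)

2^>0 : ∀ d → 1 ℕ.≤ 2 ℕ.^ d
2^>0 d = ℕₚ.m^n>0 2 d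

-- x and y are the numbers of filled places in two last rows with e places each;
-- filling up the first row turns the pair (inner₁ , inner₂) of sizes into (outer₁ , outer₂).
record Spread (e x y : ℕ) : Set where
  field
    m i j  : ℕ
    1≤m    : 1 ℕ.≤ m
    outer₁ : e ℕ.+ (x ℕ.+ y) ⊓ e ≡ m ℕ.+ i ℕ.+ j
    outer₂ : e ℕ.+ (x ℕ.+ y ∸ e) ≡ m
    inner₁ : e ℕ.+ x ≡ m ℕ.+ i
    inner₂ : e ℕ.+ y ≡ m ℕ.+ j
    strict : 0 ℕ.< x → 0 ℕ.< y → x ℕ.< e → y ℕ.< e → 0 ℕ.< i × 0 ℕ.< j

spread : ∀ e x y → 1 ℕ.≤ e → x ℕ.≤ e → y ℕ.≤ e → Spread e x y
spread e x y 1≤e x≤e y≤e with ℕₚ.≤-total (x ℕ.+ y) e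
... | inj₁ s≤e = record
  { m = e ; i = x ; j = y ; 1≤m = 1≤e
  ; outer₁ = trans (cong (e ℕ.+_) (ℕₚ.m≤n⇒m⊓n≡m s≤e)) (sym (ℕₚ.+-assoc e x y))
  ; outer₂ = trans (cong (e ℕ.+_) (ℕₚ.m≤n⇒m∸n≡0 s≤e)) (ℕₚ.+-identityʳ e)
  ; inner₁ = refl ; inner₂ = refl ; strict = λ p q _ _ → p , q }
... | inj₂ e≤s = record
  { m = e ℕ.+ z ; i = e ∸ y ; j = e ∸ x ; 1≤m = ℕₚ.≤-trans 1≤e (ℕₚ.m≤m+n e z)
  ; outer₁ = trans (cong (e ℕ.+_) (trans (ℕₚ.m≥n⇒m⊓n≡n e≤s) (trans (sym (ℕₚ.m∸n+n≡m x≤e))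
      (trans (ℕₚ.+-comm (e ∸ x) x) (cong (ℕ._+ (e ∸ x)) (sym z+e∸y≡x)))))) (reassoc e z (e ∸ y) (e ∸ x))
  ; outer₂ = refl
  ; inner₁ = trans (cong (e ℕ.+_) (sym z+e∸y≡x)) (sym (ℕₚ.+-assoc e z (e ∸ y)))
  ; inner₂ = trans (cong (e ℕ.+_) (sym z+e∸x≡y)) (sym (ℕₚ.+-assoc e z (e ∸ x)))
  ; strict = λ _ _ x<e y<e → ℕₚ.m<n⇒0<n∸m y<e , ℕₚ.m<n⇒0<n∸m x<e }
  where
  z = x ℕ.+ y ∸ e
  reassoc : ∀ a b c d → a ℕ.+ (b ℕ.+ c ℕ.+ d) ≡ a ℕ.+ b ℕ.+ c ℕ.+ d
  reassoc = ℕ-Tactic.solve-∀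
  z+e∸y≡x : z ℕ.+ (e ∸ y) ≡ x
  z+e∸y≡x = ℕₚ.+-cancelʳ-≡ y _ _ (trans (ℕₚ.+-assoc z (e ∸ y) y)
    (trans (cong (z ℕ.+_) (ℕₚ.m∸n+n≡m y≤e)) (ℕₚ.m∸n+n≡m e≤s)))
  z+e∸x≡y : z ℕ.+ (e ∸ x) ≡ y
  z+e∸x≡y = ℕₚ.+-cancelʳ-≡ x _ _ (trans (ℕₚ.+-assoc z (e ∸ x) x)
    (trans (cong (z ℕ.+_) (ℕₚ.m∸n+n≡m x≤e)) (trans (ℕₚ.m∸n+n≡m e≤s) (ℕₚ.+-comm x y))))

-- The two pairs of sizes have the same sum and the outer pair is the wider one, which is the
-- setting of log-concavity.
toll-spread : ∀ e x y → 1 ℕ.≤ e → x ℕ.≤ e → y ℕ.≤ e →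
  toll (e ℕ.+ (x ℕ.+ y) ⊓ e) ℚ.* toll (e ℕ.+ (x ℕ.+ y ∸ e)) ℚ.≤ toll (e ℕ.+ x) ℚ.* toll (e ℕ.+ y)
toll-spread e x y 1≤e p q = subst₂ ℚ._≤_
  (trans (ℚₚ.*-comm (toll m) (toll (m ℕ.+ i ℕ.+ j))) (sym (cong₂ (λ u v → toll u ℚ.* toll v) outer₁ outer₂)))
  (sym (cong₂ (λ u v → toll u ℚ.* toll v) inner₁ inner₂)) (toll-log-concave m i j 1≤m)
  where open Spread (spread e x y 1≤e p q)

toll-spread-strict : ∀ e x y → 1 ℕ.≤ e → 0 ℕ.< x → 0 ℕ.< y → x ℕ.< e → y ℕ.< e →
  toll (e ℕ.+ (x ℕ.+ y) ⊓ e) ℚ.* toll (e ℕ.+ (x ℕ.+ y ∸ e)) ℚ.< toll (e ℕ.+ x) ℚ.* toll (e ℕ.+ y)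
toll-spread-strict e x y 1≤e 0<x 0<y p q = subst₂ ℚ._<_
  (trans (ℚₚ.*-comm (toll m) (toll (m ℕ.+ i ℕ.+ j))) (sym (cong₂ (λ u v → toll u ℚ.* toll v) outer₁ outer₂)))
  (sym (cong₂ (λ u v → toll u ℚ.* toll v) inner₁ inner₂))
  (toll-log-concave-strict m i j 1≤m (proj₁ (strict 0<x 0<y p q)) (proj₂ (strict 0<x 0<y p q)))
  where open Spread (spread e x y 1≤e (ℕₚ.<⇒≤ p) (ℕₚ.<⇒≤ q))

private
  interchange : ∀ a b c d → (a ℚ.* b) ℚ.* (c ℚ.* d) ≡ (a ℚ.* c) ℚ.* (b ℚ.* d)
  interchange = solve 4 (λ a b c d → (a :* b) :* (c :* d) := (a :* c) :* (b :* d)) refl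
    where open +-*-Solver

  ≤2^suc⇒ : ∀ d {x} → x ℕ.≤ 2 ℕ.^ suc d → x ℕ.≤ 2 ℕ.^ d ⊎ (∃[ u ] (u ℕ.≤ 2 ℕ.^ d × x ≡ 2 ℕ.^ d ℕ.+ u))
  ≤2^suc⇒ d {x} p with ℕₚ.≤-total x (2 ℕ.^ d)
  ... | inj₁ q = inj₁ q
  ... | inj₂ q = inj₂ (x ∸ 2 ℕ.^ d , ∸≤ d p , sym (ℕₚ.m+[n∸m]≡n q))

-- The induction statement at one height, named so that the step can treat root tolls and subtrees
-- separately.
SpreadLemma : ℕ → Set
SpreadLemma d = ∀ x y → x ℕ.≤ 2 ℕ.^ d → y ℕ.≤ 2 ℕ.^ d → P d (x ℕ.+ y) ℚ.≤ F d x ℚ.* F d y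

-- Among the four subtrees of two trees of the same height only one pair has to be spread.
P-spread : ∀ d → SpreadLemma d → ∀ x y → x ℕ.≤ 2 ℕ.^ suc d → y ℕ.≤ 2 ℕ.^ suc d →
  P d ((x ℕ.+ y) ⊓ 2 ℕ.^ suc d) ℚ.* P d (x ℕ.+ y ∸ 2 ℕ.^ suc d) ℚ.≤ P d x ℚ.* P d y
P-spread d sp x y x≤ y≤ = go (≤2^suc⇒ d x≤) (≤2^suc⇒ d y≤)
  where
  D = 2 ℕ.^ d
  G : ℕ → ℚ
  G = F d

  mono : ∀ a b c e → a ℚ.≤ b → 0ℚ ℚ.< a → 0ℚ ℚ.< c ℚ.* e → a ℚ.* (c ℚ.* e) ℚ.≤ b ℚ.* (c ℚ.* e)
  mono a b c e a≤b 0<a 0<ce = *-mono-≤-pos 0<a 0<ce a≤b ℚₚ.≤-refl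

  -- The four subtrees have last rows `D`, `u` and `y`, empty. Merging keeps `D` and the empty row
  -- and spreads `u` and `y`.
  mixed : ∀ u y → u ℕ.≤ D → y ℕ.≤ D →
    P d ((D ℕ.+ u ℕ.+ y) ⊓ 2 ℕ.^ suc d) ℚ.* P d (D ℕ.+ u ℕ.+ y ∸ 2 ℕ.^ suc d) ℚ.≤ P d (D ℕ.+ u) ℚ.* P d y
  mixed u y u≤ y≤ = begin
    P d ((D ℕ.+ u ℕ.+ y) ⊓ 2 ℕ.^ suc d) ℚ.* P d (D ℕ.+ u ℕ.+ y ∸ 2 ℕ.^ suc d)
      ≡⟨ cong₂ (λ a b → P d (a ⊓ b) ℚ.* P d (a ∸ b)) (ℕₚ.+-assoc D u y) (2^suc d) ⟩
    P d ((D ℕ.+ w) ⊓ (D ℕ.+ D)) ℚ.* P d (D ℕ.+ w ∸ (D ℕ.+ D))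
      ≡⟨ cong₂ (λ a b → P d a ℚ.* P d b) (sym (ℕₚ.+-distribˡ-⊓ D w D)) (ℕₚ.[m+n]∸[m+o]≡n∸o D w D) ⟩
    P d (D ℕ.+ w ⊓ D) ℚ.* P d (w ∸ D)
      ≡⟨ cong₂ ℚ._*_ (P-high d (w ⊓ D)) (P-low d (∸≤ d (subst (w ℕ.≤_) (sym (2^suc d)) (ℕₚ.+-mono-≤ u≤ y≤)))) ⟩
    (G D ℚ.* G (w ⊓ D)) ℚ.* (G (w ∸ D) ℚ.* G 0)   ≡⟨ shuffle (G D) (G (w ⊓ D)) (G (w ∸ D)) (G 0) ⟩
    P d w ℚ.* (G D ℚ.* G 0)                       ≤⟨ mono (P d w) (G u ℚ.* G y) (G D) (G 0) (sp u y u≤ y≤) (P>0 d w) (*-pos (F>0 d D) (F>0 d 0)) ⟩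
    (G u ℚ.* G y) ℚ.* (G D ℚ.* G 0)               ≡⟨ shuffle (G D) (G u) (G y) (G 0) ⟨
    (G D ℚ.* G u) ℚ.* (G y ℚ.* G 0)               ≡⟨ cong₂ ℚ._*_ (P-high d u) (P-low d y≤) ⟨
    P d (D ℕ.+ u) ℚ.* P d y                       ∎
    where
    open ℚₚ.≤-Reasoning
    w = u ℕ.+ y
    shuffle : ∀ a b c e → (a ℚ.* b) ℚ.* (c ℚ.* e) ≡ (b ℚ.* c) ℚ.* (a ℚ.* e)
    shuffle = solve 4 (λ a b c e → (a :* b) :* (c :* e) := (b :* c) :* (a :* e)) refl
      where open +-*-Solver

  go : x ℕ.≤ D ⊎ (∃[ u ] (u ℕ.≤ D × x ≡ D ℕ.+ u)) → y ℕ.≤ D ⊎ (∃[ u ] (u ℕ.≤ D × y ≡ D ℕ.+ u)) →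
    P d ((x ℕ.+ y) ⊓ 2 ℕ.^ suc d) ℚ.* P d (x ℕ.+ y ∸ 2 ℕ.^ suc d) ℚ.≤ P d x ℚ.* P d y
  go (inj₁ p) (inj₁ q) = begin
    P d ((x ℕ.+ y) ⊓ 2 ℕ.^ suc d) ℚ.* P d (x ℕ.+ y ∸ 2 ℕ.^ suc d)
      ≡⟨ cong₂ (λ a b → P d a ℚ.* P d b) (ℕₚ.m≤n⇒m⊓n≡m s≤) (ℕₚ.m≤n⇒m∸n≡0 s≤) ⟩
    P d (x ℕ.+ y) ℚ.* P d 0               ≡⟨ cong (P d (x ℕ.+ y) ℚ.*_) (P-low d z≤n) ⟩
    P d (x ℕ.+ y) ℚ.* (G 0 ℚ.* G 0)       ≤⟨ mono (P d (x ℕ.+ y)) (G x ℚ.* G y) (G 0) (G 0) (sp x y p q) (P>0 d (x ℕ.+ y)) (*-pos (F>0 d 0) (F>0 d 0)) ⟩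
    (G x ℚ.* G y) ℚ.* (G 0 ℚ.* G 0)       ≡⟨ interchange (G x) (G y) (G 0) (G 0) ⟩
    (G x ℚ.* G 0) ℚ.* (G y ℚ.* G 0)       ≡⟨ cong₂ ℚ._*_ (P-low d p) (P-low d q) ⟨
    P d x ℚ.* P d y                       ∎
    where
    open ℚₚ.≤-Reasoning
    s≤ : x ℕ.+ y ℕ.≤ 2 ℕ.^ suc d
    s≤ = subst (x ℕ.+ y ℕ.≤_) (sym (2^suc d)) (ℕₚ.+-mono-≤ p q)
  go (inj₂ (u , u≤ , refl)) (inj₁ q) = mixed u y u≤ q
  go (inj₁ p) (inj₂ (u , u≤ , refl)) = subst₂ ℚ._≤_
    (cong (λ s → P d (s ⊓ 2 ℕ.^ suc d) ℚ.* P d (s ∸ 2 ℕ.^ suc d)) (ℕₚ.+-comm (D ℕ.+ u) x))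
    (ℚₚ.*-comm (P d (D ℕ.+ u)) (P d x)) (mixed u x u≤ p)
  go (inj₂ (u , u≤ , refl)) (inj₂ (v , v≤ , refl)) = begin
    P d ((D ℕ.+ u ℕ.+ (D ℕ.+ v)) ⊓ 2 ℕ.^ suc d) ℚ.* P d (D ℕ.+ u ℕ.+ (D ℕ.+ v) ∸ 2 ℕ.^ suc d)
      ≡⟨ cong₂ (λ a b → P d (a ⊓ b) ℚ.* P d (a ∸ b)) (regroup D u v) (2^suc d) ⟩
    P d ((D ℕ.+ D ℕ.+ (u ℕ.+ v)) ⊓ (D ℕ.+ D)) ℚ.* P d (D ℕ.+ D ℕ.+ (u ℕ.+ v) ∸ (D ℕ.+ D))
      ≡⟨ cong₂ (λ a b → P d a ℚ.* P d b) (ℕₚ.m≥n⇒m⊓n≡n (ℕₚ.m≤m+n (D ℕ.+ D) (u ℕ.+ v))) (ℕₚ.m+n∸m≡n (D ℕ.+ D) (u ℕ.+ v)) ⟩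
    P d (D ℕ.+ D) ℚ.* P d (u ℕ.+ v)       ≡⟨ cong (ℚ._* P d (u ℕ.+ v)) (P-high d D) ⟩
    (G D ℚ.* G D) ℚ.* P d (u ℕ.+ v)       ≡⟨ ℚₚ.*-comm (G D ℚ.* G D) (P d (u ℕ.+ v)) ⟩
    P d (u ℕ.+ v) ℚ.* (G D ℚ.* G D)       ≤⟨ mono (P d (u ℕ.+ v)) (G u ℚ.* G v) (G D) (G D) (sp u v u≤ v≤) (P>0 d (u ℕ.+ v)) (*-pos (F>0 d D) (F>0 d D)) ⟩
    (G u ℚ.* G v) ℚ.* (G D ℚ.* G D)       ≡⟨ ℚₚ.*-comm (G u ℚ.* G v) (G D ℚ.* G D) ⟩
    (G D ℚ.* G D) ℚ.* (G u ℚ.* G v)       ≡⟨ interchange (G D) (G D) (G u) (G v) ⟩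
    (G D ℚ.* G u) ℚ.* (G D ℚ.* G v)       ≡⟨ cong₂ ℚ._*_ (P-high d u) (P-high d v) ⟨
    P d (D ℕ.+ u) ℚ.* P d (D ℕ.+ v)       ∎
    where
    open ℚₚ.≤-Reasoning
    regroup : ∀ a b c → a ℕ.+ b ℕ.+ (a ℕ.+ c) ≡ a ℕ.+ a ℕ.+ (b ℕ.+ c)
    regroup = ℕ-Tactic.solve-∀

module _ (d x y : ℕ) (x≤ : x ℕ.≤ 2 ℕ.^ suc d) (y≤ : y ℕ.≤ 2 ℕ.^ suc d) where
  private
    E s : ℕ
    E = 2 ℕ.^ suc d
    s = x ℕ.+ y
    T₁ T₂ : ℚ
    T₁ = toll (E ℕ.+ s ⊓ E)
    T₂ = toll (E ℕ.+ (s ∸ E))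
    1≤E+ : ∀ z → 2 ℕ.≤ E ℕ.+ z
    1≤E+ z = ℕₚ.≤-trans (ℕₚ.*-monoʳ-≤ 2 (2^>0 d)) (ℕₚ.m≤m+n E z)

  P-suc : P (suc d) s ≡ (T₁ ℚ.* T₂) ℚ.* (P d (s ⊓ E) ℚ.* P d (s ∸ E))
  P-suc = trans (cong₂ ℚ._*_ (F-suc d (ℕₚ.m⊓n≤n s E)) (F-suc d (∸≤ (suc d)
      (subst (s ℕ.≤_) (sym (2^suc (suc d))) (ℕₚ.+-mono-≤ x≤ y≤)))))
    (interchange T₁ (P d (s ⊓ E)) T₂ (P d (s ∸ E)))

  F*F-suc : F (suc d) x ℚ.* F (suc d) y ≡ (toll (E ℕ.+ x) ℚ.* toll (E ℕ.+ y)) ℚ.* (P d x ℚ.* P d y)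
  F*F-suc = trans (cong₂ ℚ._*_ (F-suc d x≤) (F-suc d y≤)) (interchange (toll (E ℕ.+ x)) (P d x) (toll (E ℕ.+ y)) (P d y))

  -- The product factors into the tolls of the two roots, bounded by log-concavity, and the four
  -- subtrees, bounded by the induction hypothesis.
  spread-suc : SpreadLemma d → P (suc d) s ℚ.≤ F (suc d) x ℚ.* F (suc d) y
  spread-suc sp = subst₂ ℚ._≤_ (sym P-suc) (sym F*F-suc)
    (*-mono-≤-pos (*-pos (toll>0 (1≤E+ _)) (toll>0 (1≤E+ _))) (*-pos (P>0 d (s ⊓ E)) (P>0 d (s ∸ E)))
      (toll-spread E x y (2^>0 (suc d)) x≤ y≤) (P-spread d sp x y x≤ y≤))

  spread-suc-strict : SpreadLemma d → 0 ℕ.< x → 0 ℕ.< y → x ℕ.< E → y ℕ.< E →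
    P (suc d) s ℚ.< F (suc d) x ℚ.* F (suc d) y
  spread-suc-strict sp 0<x 0<y x< y< = subst₂ ℚ._<_ (sym P-suc) (sym F*F-suc)
    (*-mono-<-≤-pos (*-pos (toll>0 (1≤E+ _)) (toll>0 (1≤E+ _))) (*-pos (P>0 d (s ⊓ E)) (P>0 d (s ∸ E)))
      (toll-spread-strict E x y (2^>0 (suc d)) 0<x 0<y x< y<) (P-spread d sp x y x≤ y≤))

F-spread : ∀ d → SpreadLemma d
F-spread zero zero       zero       _ _ = ℚₚ.≤-refl
F-spread zero zero       (suc zero) _ _ = ℚₚ.≤-reflexive (ℚₚ.*-comm (F 0 1) (F 0 0))
F-spread zero (suc zero) zero       _ _ = ℚₚ.≤-refl
F-spread zero (suc zero) (suc zero) _ _ = ℚₚ.≤-refl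
F-spread zero _ (suc (suc _)) _ (s≤s ())
F-spread zero (suc (suc _)) _ (s≤s ()) _
F-spread (suc d) x y x≤ y≤ = spread-suc d x y x≤ y≤ (F-spread d)

-- Strictness comes from the tolls of the two roots; the subtrees contribute a weak inequality.
-- Height 0 is vacuous, since a row of one place is empty or full.
F-spread-strict : ∀ d x y → 0 ℕ.< x → 0 ℕ.< y → x ℕ.< 2 ℕ.^ d → y ℕ.< 2 ℕ.^ d →
  P d (x ℕ.+ y) ℚ.< F d x ℚ.* F d y
F-spread-strict zero    (suc x) y 0<x 0<y (s≤s ()) _
F-spread-strict (suc d) x y 0<x 0<y x< y< =
  spread-suc-strict d x y (ℕₚ.<⇒≤ x<) (ℕₚ.<⇒≤ y<) (F-spread d) 0<x 0<y x< y<

-- The root toll and the values at `a`, `b`, `c` persist. Only the inner vertex changes, from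
-- `size a + size c` leaves to the smaller `size c + size b`.
X-rotate : ∀ a b c → size b ℕ.< size a → X (node (node c b) a) ℚ.< X (node (node a c) b)
X-rotate a b c b<a = subst (ℚ._< X (node (node a c) b)) (sym eq)
  (*-mono-≤-<-pos (toll>0 (ℕₚ.+-mono-≤ (size>0 (node a c)) (size>0 b))) (*-pos (X>0 (node c b)) (X>0 a)) ℚₚ.≤-refl lt)
  where
  t = toll (size a ℕ.+ size c ℕ.+ size b)
  comm : ∀ i j k → i ℕ.+ j ℕ.+ k ≡ k ℕ.+ i ℕ.+ j
  comm = ℕ-Tactic.solve-∀
  eq : X (node (node c b) a) ≡ t ℚ.* (X (node c b) ℚ.* X a)
  eq = cong (λ m → toll m ℚ.* (X (node c b) ℚ.* X a)) (comm (size c) (size b) (size a))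
  lt : X (node c b) ℚ.* X a ℚ.< X (node a c) ℚ.* X b
  lt = subst₂ ℚ._<_
    (solve 4 (λ t a b c → t :* (a :* (b :* c)) := t :* (c :* b) :* a) refl (toll (size c ℕ.+ size b)) (X a) (X b) (X c))
    (solve 4 (λ t a b c → t :* (a :* (b :* c)) := t :* (a :* c) :* b) refl (toll (size a ℕ.+ size c)) (X a) (X b) (X c))
    (*-mono-<-≤-pos (toll>0 (ℕₚ.+-mono-≤ (size>0 c) (size>0 b))) (*-pos (X>0 a) (*-pos (X>0 b) (X>0 c)))
      (toll-mono-< (ℕₚ.≤-trans (size>0 c) (ℕₚ.m≤m+n (size c) (size b)))
        (subst (ℕ._< size a ℕ.+ size c) (ℕₚ.+-comm (size b) (size c)) (ℕₚ.+-monoˡ-< (size c) b<a))) ℚₚ.≤-refl)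
    where open +-*-Solver

-- Reduction of every tree to the complete one

filled-low : ∀ d {r} → r ℕ.≤ 2 ℕ.^ d → filled (suc d) r ≡ node (filled d r) (filled d 0)
filled-low d p = cong₂ (λ u v → node (filled d u) (filled d v)) (ℕₚ.m≤n⇒m⊓n≡m p) (ℕₚ.m≤n⇒m∸n≡0 p)

-- The double reading of a perfect tree; it is what brings two trees of adjacent heights to the same
-- height.
filled-full : ∀ d → filled d (2 ℕ.^ d) ≡ filled (suc d) 0
filled-full zero    = refl
filled-full (suc d) = trans
  (cong₂ (λ u v → node (filled d u) (filled d v)) (ℕₚ.m≥n⇒m⊓n≡n (ℕₚ.m≤m+n D _)) (trans (cong (_∸ D) (2^suc d)) (ℕₚ.m+n∸m≡n D D)))
  (trans (cong₂ node (filled-full d) (filled-full d)) (sym (filled-low (suc d) z≤n)))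
  where D = 2 ℕ.^ d

filled-high : ∀ d r → filled (suc d) (2 ℕ.^ d ℕ.+ r) ≡ node (filled d (2 ℕ.^ d)) (filled d r)
filled-high d r = cong₂ (λ u v → node (filled d u) (filled d v))
  (ℕₚ.m≥n⇒m⊓n≡n (ℕₚ.m≤m+n (2 ℕ.^ d) r)) (ℕₚ.m+n∸m≡n (2 ℕ.^ d) r)

⌊log₂⌋-unique : ∀ d {r} → r ℕ.< 2 ℕ.^ d → ⌊log₂ (2 ℕ.^ d ℕ.+ r) ⌋ ≡ d
⌊log₂⌋-unique d {r} r< = ℕₚ.≤-antisym
  (ℕₚ.≤-pred (2^-cancel-< (ℕₚ.≤-<-trans (2^⌊log₂⌋≤ n {{ℕ.>-nonZero n>0}})
    (subst (n ℕ.<_) (sym (2^suc d)) (ℕₚ.+-monoʳ-< (2 ℕ.^ d) r<)))))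
  (ℕₚ.≤-pred (2^-cancel-< (ℕₚ.≤-<-trans (ℕₚ.m≤m+n (2 ℕ.^ d) r) (<2^suc⌊log₂⌋ n))))
  where
  n = 2 ℕ.^ d ℕ.+ r
  n>0 : 0 ℕ.< n
  n>0 = ℕₚ.≤-trans (2^>0 d) (ℕₚ.m≤m+n (2 ℕ.^ d) r)

-- The full row `r` = 2^d is included although the logarithm jumps to `suc d` there, because merged
-- rows may be full.
CBT-filled : ∀ d {r} → r ℕ.≤ 2 ℕ.^ d → CBT (2 ℕ.^ d ℕ.+ r) ≡ filled d r
CBT-filled d {r} p with ℕₚ.m≤n⇒m<n∨m≡n p
... | inj₁ r< = trans (cong (λ e → filled e (2 ℕ.^ d ℕ.+ r ∸ 2 ℕ.^ e)) (⌊log₂⌋-unique d r<))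
                      (cong (filled d) (ℕₚ.m+n∸m≡n (2 ℕ.^ d) r))
... | inj₂ refl = begin
  CBT (2 ℕ.^ d ℕ.+ 2 ℕ.^ d)                    ≡⟨ cong CBT (trans (sym (2^suc d)) (sym (ℕₚ.+-identityʳ _))) ⟩
  CBT (2 ℕ.^ suc d ℕ.+ 0)                      ≡⟨ cong (λ e → filled e (2 ℕ.^ suc d ℕ.+ 0 ∸ 2 ℕ.^ e)) (⌊log₂⌋-unique (suc d) (2^>0 (suc d))) ⟩
  filled (suc d) (2 ℕ.^ suc d ℕ.+ 0 ∸ 2 ℕ.^ suc d) ≡⟨ cong (filled (suc d)) (ℕₚ.m+n∸m≡n (2 ℕ.^ suc d) 0) ⟩
  filled (suc d) 0                             ≡⟨ filled-full d ⟨
  filled d (2 ℕ.^ d)                           ∎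
  where open ≡-Reasoning

Best : Tree → Set
Best T = T ⊒ CBT (size T)

best-step : ∀ {T U} → T ⊒ U → size U ≡ size T → Best U → Best T
best-step {T} {U} p eq q = ⊒-trans p (subst (λ n → U ⊒ CBT n) eq q)

-- The rotated subtree `node c b` need not be complete. It is replaced by the complete tree of its
-- size, which leaves one pair to be treated.
best-rotate : ∀ a b c → size b ℕ.< size a → Best (node c b) → Best (node (CBT (size (node c b))) a) → Best (node (node a c) b)
best-rotate a b c b<a p q = best-step {node (node a c) b} {node (node c b) a} (inj₂ (X-rotate a b c b<a)) (comm (size a) (size b) (size c))
  (best-step {node (node c b) a} {node (CBT (size (node c b))) a} (⊒-node (sym size≡) refl p ⊒-refl) (cong (ℕ._+ size a) size≡) q)
  where
  comm : ∀ i j k → k ℕ.+ j ℕ.+ i ≡ i ℕ.+ k ℕ.+ j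
  comm = ℕ-Tactic.solve-∀
  size≡ : size (CBT (size (node c b))) ≡ size (node c b)
  size≡ = CBT-size (size (node c b)) {{ℕ.>-nonZero (size>0 (node c b))}}

best-filled : ∀ {T} d {r} → r ℕ.≤ 2 ℕ.^ d → size T ≡ 2 ℕ.^ d ℕ.+ r → T ⊒ filled d r → Best T
best-filled {T} d {r} p s q = subst (T ⊒_) (sym (trans (cong CBT s) (CBT-filled d p))) q

-- If one of the rows is empty or full, merging at most exchanges the two subtrees. Otherwise strict
-- spreading applies.
same-height : ∀ d x y → x ℕ.≤ 2 ℕ.^ d → y ℕ.≤ 2 ℕ.^ d →
              node (filled d x) (filled d y) ⊒ filled (suc d) (x ℕ.+ y)
same-height d zero y _ y≤ = ⊒-trans (⊒-comm (filled d 0) (filled d y)) (⊒-reflexive (sym (filled-low d y≤)))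
same-height d x@(suc _) zero x≤ _ = ⊒-reflexive (sym (trans (cong (filled (suc d)) (ℕₚ.+-identityʳ x)) (filled-low d x≤)))
same-height d x@(suc _) y@(suc _) x≤ y≤ with ℕₚ.m≤n⇒m<n∨m≡n x≤ | ℕₚ.m≤n⇒m<n∨m≡n y≤
... | inj₂ x≡D | _ = subst (λ x → node (filled d x) (filled d y) ⊒ filled (suc d) (x ℕ.+ y)) (sym x≡D)
  (⊒-reflexive (sym (filled-high d y)))
... | _ | inj₂ y≡D = subst (λ y → node (filled d x) (filled d y) ⊒ filled (suc d) (x ℕ.+ y)) (sym y≡D)
  (⊒-trans (⊒-comm (filled d x) (filled d (2 ℕ.^ d)))
    (⊒-reflexive (sym (trans (cong (filled (suc d)) (ℕₚ.+-comm x (2 ℕ.^ d))) (filled-high d x)))))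
... | inj₁ x< | inj₁ y< = inj₂ (subst (λ m → toll m ℚ.* P d (x ℕ.+ y) ℚ.< X (node (filled d x) (filled d y))) (sym eq)
  (*-mono-≤-<-pos (toll>0 (ℕₚ.+-mono-≤ (size>0 (filled d x)) (size>0 (filled d y)))) (P>0 d (x ℕ.+ y)) ℚₚ.≤-refl
    (F-spread-strict d x y (s≤s z≤n) (s≤s z≤n) x< y<)))
  where
  swap-middle : ∀ a b c → a ℕ.+ a ℕ.+ (b ℕ.+ c) ≡ (a ℕ.+ b) ℕ.+ (a ℕ.+ c)
  swap-middle = ℕ-Tactic.solve-∀
  eq : size (filled (suc d) (x ℕ.+ y)) ≡ size (filled d x) ℕ.+ size (filled d y)
  eq = trans (size-filled (suc d) (x ℕ.+ y) (subst (x ℕ.+ y ℕ.≤_) (sym (2^suc d)) (ℕₚ.+-mono-≤ x≤ y≤)))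
    (trans (cong (ℕ._+ (x ℕ.+ y)) (2^suc d)) (trans (swap-middle (2 ℕ.^ d) x y)
      (sym (cong₂ ℕ._+_ (size-filled d x x≤) (size-filled d y y≤)))))

size-node-filled : ∀ e d {x y} → x ℕ.≤ 2 ℕ.^ e → y ℕ.≤ 2 ℕ.^ d →
  size (node (filled e x) (filled d y)) ≡ (2 ℕ.^ e ℕ.+ x) ℕ.+ (2 ℕ.^ d ℕ.+ y)
size-node-filled e d p q = cong₂ ℕ._+_ (size-filled e _ p) (size-filled d _ q)

best-same : ∀ d x y → x ℕ.≤ 2 ℕ.^ d → y ℕ.≤ 2 ℕ.^ d → Best (node (filled d x) (filled d y))
best-same d x y x≤ y≤ = best-filled {node (filled d x) (filled d y)} (suc d)
  (subst (x ℕ.+ y ℕ.≤_) (sym (2^suc d)) (ℕₚ.+-mono-≤ x≤ y≤))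
  (trans (size-node-filled d d x≤ y≤) (trans (swap-middle (2 ℕ.^ d) x y) (cong (ℕ._+ (x ℕ.+ y)) (sym (2^suc d)))))
  (same-height d x y x≤ y≤)
  where
  swap-middle : ∀ a b c → (a ℕ.+ b) ℕ.+ (a ℕ.+ c) ≡ a ℕ.+ a ℕ.+ (b ℕ.+ c)
  swap-middle = ℕ-Tactic.solve-∀

-- A full right row lifts the right tree to height `suc d`. Otherwise there are two cases: if the
-- left row stays within the left half, places are moved to the right tree; if it goes further, the
-- full left half is larger than the right tree and is rotated up.
best-adjacent : ∀ d x y → x ℕ.≤ 2 ℕ.^ suc d → y ℕ.≤ 2 ℕ.^ d → Best (node (filled (suc d) x) (filled d y))
best-adjacent d x y x≤ y≤ with ℕₚ.m≤n⇒m<n∨m≡n y≤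
... | inj₂ refl = subst (λ T → Best (node (filled (suc d) x) T)) (sym (filled-full d)) (best-same (suc d) x 0 x≤ z≤n)
... | inj₁ y< with ℕₚ.<-≤-connex (2 ℕ.^ d) x
...   | inj₂ x≤D = low x x≤D
  where
  D = 2 ℕ.^ d
  -- In the first case the right tree can be read at height `suc d`, in the second the left tree at
  -- height `d`; both lead to equal heights.
  to-CBT : ∀ z w → z ℕ.≤ D → w ≡ D ⊎ (w ℕ.≤ D × z ≡ 0) → Best (node (filled (suc d) z) (filled d w))
  to-CBT z w z≤D (inj₁ refl) = subst (λ T → Best (node (filled (suc d) z) T)) (sym (filled-full d))
    (best-same (suc d) z 0 (ℕₚ.≤-trans z≤D (ℕₚ.^-monoʳ-≤ 2 (ℕₚ.n≤1+n d))) z≤n)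
  to-CBT z w z≤D (inj₂ (w≤D , refl)) = subst (λ T → Best (node T (filled d w))) (filled-full d) (best-same d D w ℕₚ.≤-refl w≤D)

  low : ∀ x → x ℕ.≤ D → Best (node (filled (suc d) x) (filled d y))
  low zero      _   = to-CBT 0 y z≤n (inj₂ (y≤ , refl))
  low x@(suc x′) x≤D = ⊒-trans (inj₂ lt) (subst (λ n → node (filled (suc d) z) (filled d w) ⊒ CBT n) size≡
      (to-CBT z w z≤D alt))
    where
    s z w : ℕ
    s = x ℕ.+ y
    z = s ∸ D
    w = s ⊓ D
    z<x : z ℕ.< x
    z<x = ℕₚ.m<n+o⇒m∸n<o s D (subst (s ℕ.<_) (ℕₚ.+-comm x D) (ℕₚ.+-monoʳ-< x y<))
    z≤D : z ℕ.≤ D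
    z≤D = ℕₚ.≤-trans (ℕₚ.<⇒≤ z<x) x≤D
    D≤2D : D ℕ.≤ 2 ℕ.^ suc d
    D≤2D = ℕₚ.^-monoʳ-≤ 2 (ℕₚ.n≤1+n d)
    alt : w ≡ D ⊎ (w ℕ.≤ D × z ≡ 0)
    alt with ℕₚ.≤-total D s
    ... | inj₁ D≤s = inj₁ (ℕₚ.m≥n⇒m⊓n≡n D≤s)
    ... | inj₂ s≤D = inj₂ (ℕₚ.m⊓n≤n s D , ℕₚ.m≤n⇒m∸n≡0 s≤D)
    z+w : z ℕ.+ w ≡ x ℕ.+ y
    z+w = trans (ℕₚ.+-comm z w) (trans (cong (ℕ._+ z) (ℕₚ.⊓-comm s D)) (ℕₚ.m⊓n+n∸m≡n D s))
    swap-middle : ∀ a b c e → (a ℕ.+ b) ℕ.+ (c ℕ.+ e) ≡ (a ℕ.+ c) ℕ.+ (b ℕ.+ e)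
    swap-middle = ℕ-Tactic.solve-∀
    size≡ : size (node (filled (suc d) z) (filled d w)) ≡ size (node (filled (suc d) x) (filled d y))
    size≡ = begin
      size (node (filled (suc d) z) (filled d w))      ≡⟨ size-node-filled (suc d) d (ℕₚ.≤-trans z≤D D≤2D) (ℕₚ.m⊓n≤n s D) ⟩
      (2 ℕ.^ suc d ℕ.+ z) ℕ.+ (D ℕ.+ w)                ≡⟨ swap-middle (2 ℕ.^ suc d) z D w ⟩
      (2 ℕ.^ suc d ℕ.+ D) ℕ.+ (z ℕ.+ w)                ≡⟨ cong (2 ℕ.^ suc d ℕ.+ D ℕ.+_) z+w ⟩
      (2 ℕ.^ suc d ℕ.+ D) ℕ.+ (x ℕ.+ y)                ≡⟨ swap-middle (2 ℕ.^ suc d) x D y ⟨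
      (2 ℕ.^ suc d ℕ.+ x) ℕ.+ (D ℕ.+ y)                ≡⟨ size-node-filled (suc d) d (ℕₚ.≤-trans x≤D D≤2D) y≤ ⟨
      size (node (filled (suc d) x) (filled d y))      ∎
      where open ≡-Reasoning
    -- Moving places to the right tree lowers the toll of the left child strictly, as z < x, and
    -- spreading bounds the two subtrees with rows `x` and `y`.
    product : F (suc d) z ℚ.* F d w ℚ.< F (suc d) x ℚ.* F d y
    product = subst₂ ℚ._<_
      (trans (regroup t₁ (F d w) (F d z) (F d 0))
        (cong (ℚ._* F d w) (sym (trans (F-suc d (ℕₚ.≤-trans z≤D D≤2D)) (cong (t₁ ℚ.*_) (P-low d z≤D))))))
      (trans (regroup t₂ (F d y) (F d x) (F d 0))
        (cong (ℚ._* F d y) (sym (trans (F-suc d (ℕₚ.≤-trans x≤D D≤2D)) (cong (t₂ ℚ.*_) (P-low d x≤D))))))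
      (*-mono-<-≤-pos (*-pos (toll>0 (ℕₚ.≤-trans 2≤2D (ℕₚ.m≤m+n (2 ℕ.^ suc d) z))) (F>0 d 0)) (P>0 d s)
        (ℚₚ.*-monoˡ-<-pos (F d 0) {{ℚ.positive (F>0 d 0)}}
          (toll-mono-< (ℕₚ.≤-trans (2^>0 (suc d)) (ℕₚ.m≤m+n (2 ℕ.^ suc d) z)) (ℕₚ.+-monoʳ-< (2 ℕ.^ suc d) z<x)))
        (ℚₚ.≤-trans (F-spread d x y x≤D y≤) (ℚₚ.≤-reflexive (ℚₚ.*-comm (F d x) (F d y)))))
      where
      t₁ t₂ : ℚ
      t₁ = toll (2 ℕ.^ suc d ℕ.+ z)
      t₂ = toll (2 ℕ.^ suc d ℕ.+ x)
      2≤2D : 2 ℕ.≤ 2 ℕ.^ suc d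
      2≤2D = ℕₚ.*-monoʳ-≤ 2 (2^>0 d)
      regroup : ∀ t a b c → (t ℚ.* c) ℚ.* (a ℚ.* b) ≡ (t ℚ.* (b ℚ.* c)) ℚ.* a
      regroup = solve 4 (λ t a b c → (t :* c) :* (a :* b) := (t :* (b :* c)) :* a) refl
        where open +-*-Solver
    lt : X (node (filled (suc d) z) (filled d w)) ℚ.< X (node (filled (suc d) x) (filled d y))
    lt = subst (λ m → toll m ℚ.* (F (suc d) z ℚ.* F d w) ℚ.< X (node (filled (suc d) x) (filled d y))) (sym size≡)
      (*-mono-≤-<-pos (toll>0 (ℕₚ.+-mono-≤ (size>0 (filled (suc d) x)) (size>0 (filled d y))))
        (*-pos (F>0 (suc d) z) (F>0 d w)) ℚₚ.≤-refl product)
...   | inj₁ D<x = subst (λ x → Best (node (filled (suc d) x) (filled d y))) (ℕₚ.m+[n∸m]≡n (ℕₚ.<⇒≤ D<x))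
  (subst (λ T → Best (node T (filled d y))) (sym (filled-high d u)) best)
  where
  D u : ℕ
  D = 2 ℕ.^ d
  u = x ∸ D
  A B C : Tree
  A = filled d D
  B = filled d y
  C = filled d u
  u≤ : u ℕ.≤ D
  u≤ = ∸≤ d x≤
  B<A : size B ℕ.< size A
  B<A = subst₂ ℕ._<_ (sym (size-filled d y y≤)) (sym (size-filled d D ℕₚ.≤-refl)) (ℕₚ.+-monoʳ-< D y<)
  swap-middle : ∀ a b c → (a ℕ.+ b) ℕ.+ (a ℕ.+ c) ≡ a ℕ.+ a ℕ.+ (b ℕ.+ c)
  swap-middle = ℕ-Tactic.solve-∀
  u+y≤ : u ℕ.+ y ℕ.≤ 2 ℕ.^ suc d
  u+y≤ = subst (u ℕ.+ y ℕ.≤_) (sym (2^suc d)) (ℕₚ.+-mono-≤ u≤ y≤)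
  CBT-C-B : CBT (size (node C B)) ≡ filled (suc d) (u ℕ.+ y)
  CBT-C-B = trans (cong CBT (trans (size-node-filled d d u≤ y≤)
    (trans (swap-middle D u y) (cong (ℕ._+ (u ℕ.+ y)) (sym (2^suc d)))))) (CBT-filled (suc d) u+y≤)
  best : Best (node (node A C) B)
  best = best-rotate A B C B<A (best-same d u y u≤ y≤) (subst (λ T → Best (node T A)) (sym CBT-C-B)
    (subst (λ T → Best (node (filled (suc d) (u ℕ.+ y)) T)) (sym (filled-full d)) (best-same (suc d) (u ℕ.+ y) 0 u+y≤ z≤n)))

-- Rotation puts `B` beside `C`, which is one level lower than the left tree, so the difference of
-- heights drops by one. The strict bound on `y` ensures that `B` is smaller than `A`.
best-far : ∀ k d x y → x ℕ.≤ 2 ℕ.^ suc (k ℕ.+ d) → y ℕ.< 2 ℕ.^ d → Best (node (filled (suc (k ℕ.+ d)) x) (filled d y))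
best-far zero    d x y x≤ y< = best-adjacent d x y x≤ (ℕₚ.<⇒≤ y<)
best-far (suc k) d x y x≤ y< = best-rotate A B C B<A (best-far k d u y u≤ y<) (merge (ℕₚ.≤-total (u ℕ.+ b) E))
  where
  e E u b : ℕ
  e = suc (k ℕ.+ d)
  E = 2 ℕ.^ e
  u = x ∸ E
  b = 2 ℕ.^ d ℕ.+ y
  A B C : Tree
  A = filled e (x ⊓ E)
  B = filled d y
  C = filled e u
  u≤ : u ℕ.≤ E
  u≤ = ∸≤ e x≤
  b<E : b ℕ.< E
  b<E = ℕₚ.<-≤-trans (ℕₚ.+-monoʳ-< (2 ℕ.^ d) y<) (subst (ℕ._≤ E) (2^suc d) (ℕₚ.^-monoʳ-≤ 2 (s≤s (ℕₚ.m≤n+m d k))))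
  B<A : size B ℕ.< size A
  B<A = subst₂ ℕ._<_ (sym (size-filled d y (ℕₚ.<⇒≤ y<))) (sym (size-filled e (x ⊓ E) (ℕₚ.m⊓n≤n x E)))
    (ℕₚ.<-≤-trans b<E (ℕₚ.m≤m+n E (x ⊓ E)))
  size-C-B : size (node C B) ≡ E ℕ.+ (u ℕ.+ b)
  size-C-B = trans (size-node-filled e d u≤ (ℕₚ.<⇒≤ y<)) (ℕₚ.+-assoc E u b)
  -- `node C B` has at least E and fewer than 3E leaves, so its complete tree has height `e` or
  -- `suc e`, equal or adjacent to the height of `A`.
  merge : u ℕ.+ b ℕ.≤ E ⊎ E ℕ.≤ u ℕ.+ b → Best (node (CBT (size (node C B))) A)
  merge (inj₁ p) = subst (λ T → Best (node T A)) (sym (trans (cong CBT size-C-B) (CBT-filled e p)))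
    (best-same e (u ℕ.+ b) (x ⊓ E) p (ℕₚ.m⊓n≤n x E))
  merge (inj₂ p) = subst (λ T → Best (node T A)) (sym (trans (cong CBT size≡) (CBT-filled (suc e) rest≤)))
    (best-adjacent e r (x ⊓ E) rest≤ (ℕₚ.m⊓n≤n x E))
    where
    r : ℕ
    r = u ℕ.+ b ∸ E
    rest≤ : r ℕ.≤ 2 ℕ.^ suc e
    rest≤ = ℕₚ.≤-trans (ℕₚ.m∸n≤m (u ℕ.+ b) E)
      (subst (u ℕ.+ b ℕ.≤_) (sym (2^suc e)) (ℕₚ.+-mono-≤ u≤ (ℕₚ.<⇒≤ b<E)))
    size≡ : size (node C B) ≡ 2 ℕ.^ suc e ℕ.+ r
    size≡ = trans size-C-B (trans (cong (E ℕ.+_) (sym (ℕₚ.m+[n∸m]≡n p)))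
      (trans (sym (ℕₚ.+-assoc E E r)) (cong (ℕ._+ r) (sym (2^suc e)))))

-- By the choice of the logarithm the last row of `CBT n` is not full, as the case of different
-- heights requires.
best-CBT : ∀ m n .{{_ : NonZero m}} .{{_ : NonZero n}} → ⌊log₂ n ⌋ ℕ.≤ ⌊log₂ m ⌋ → Best (node (CBT m) (CBT n))
best-CBT m n p with ℕₚ.m≤n⇒m<n∨m≡n p
... | inj₂ eq = subst (λ e → Best (node (CBT m) (filled e (n ∸ 2 ℕ.^ e)))) (sym eq)
  (best-same ⌊log₂ m ⌋ (m ∸ 2 ℕ.^ ⌊log₂ m ⌋) (n ∸ 2 ℕ.^ ⌊log₂ m ⌋) (r≤ m) (subst (λ e → n ∸ 2 ℕ.^ e ℕ.≤ 2 ℕ.^ e) eq (r≤ n)))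
... | inj₁ lt = subst (λ e → Best (node (filled e (m ∸ 2 ℕ.^ e)) (CBT n))) e≡
  (best-far k d (m ∸ 2 ℕ.^ suc (k ℕ.+ d)) (n ∸ 2 ℕ.^ d)
    (subst (λ e → m ∸ 2 ℕ.^ e ℕ.≤ 2 ℕ.^ e) (sym e≡) (r≤ m))
    (ℕₚ.+-cancelˡ-< (2 ℕ.^ d) _ _ (subst₂ ℕ._<_ (sym (ℕₚ.m+[n∸m]≡n (2^⌊log₂⌋≤ n))) (2^suc d) (<2^suc⌊log₂⌋ n))))
  where
  d k : ℕ
  d = ⌊log₂ n ⌋
  k = ⌊log₂ m ⌋ ∸ suc d
  e≡ : suc (k ℕ.+ d) ≡ ⌊log₂ m ⌋
  e≡ = trans (sym (ℕₚ.+-suc k d)) (ℕₚ.m∸n+n≡m lt)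

-- By structural induction both subtrees may be replaced by complete trees; the higher one is then
-- put on the left.
best : ∀ T → Best T
best leaf       = inj₁ leaf
best (node l r) = best-step (⊒-node (sym (CBT-size m)) (sym (CBT-size n)) (best l) (best r))
  (cong₂ ℕ._+_ (CBT-size m) (CBT-size n)) (ordered (ℕₚ.≤-total ⌊log₂ n ⌋ ⌊log₂ m ⌋))
  where
  m n : ℕ
  m = size l
  n = size r
  instance
    m≢0 : NonZero m
    m≢0 = ℕ.>-nonZero (size>0 l)
    n≢0 : NonZero n
    n≢0 = ℕ.>-nonZero (size>0 r)
  ordered : ⌊log₂ n ⌋ ℕ.≤ ⌊log₂ m ⌋ ⊎ ⌊log₂ m ⌋ ℕ.≤ ⌊log₂ n ⌋ → Best (node (CBT m) (CBT n))
  ordered (inj₁ p) = best-CBT m n p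
  ordered (inj₂ p) = best-step (⊒-comm (CBT m) (CBT n)) (ℕₚ.+-comm (size (CBT n)) (size (CBT m))) (best-CBT n m p)

-- The law of DTCS

-- Expectations commute with `>>=` and are linear; point probabilities are recovered as expectations
-- of indicators.
𝔼 : ∀ {A : Set} → List (A × ℚ) → (A → ℚ) → ℚ
𝔼 []             φ = 0ℚ
𝔼 ((a , w) ∷ ws) φ = w ℚ.* φ a ℚ.+ 𝔼 ws φ

𝔼-cong : ∀ {A : Set} (ws : List (A × ℚ)) {φ ψ : A → ℚ} → (∀ a → φ a ≡ ψ a) → 𝔼 ws φ ≡ 𝔼 ws ψ
𝔼-cong []             e = refl
𝔼-cong ((a , w) ∷ ws) e = cong₂ (λ x y → w ℚ.* x ℚ.+ y) (e a) (𝔼-cong ws e)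

𝔼-zero : ∀ {A : Set} (ws : List (A × ℚ)) → 𝔼 ws (λ _ → 0ℚ) ≡ 0ℚ
𝔼-zero []             = refl
𝔼-zero ((a , w) ∷ ws) = cong₂ ℚ._+_ (ℚₚ.*-zeroʳ w) (𝔼-zero ws)

𝔼-++ : ∀ {A : Set} (us vs : List (A × ℚ)) φ → 𝔼 (us ++ vs) φ ≡ 𝔼 us φ ℚ.+ 𝔼 vs φ
𝔼-++ []             vs φ = sym (ℚₚ.+-identityˡ (𝔼 vs φ))
𝔼-++ ((a , w) ∷ us) vs φ = trans (cong (w ℚ.* φ a ℚ.+_) (𝔼-++ us vs φ)) (sym (ℚₚ.+-assoc (w ℚ.* φ a) (𝔼 us φ) (𝔼 vs φ)))

𝔼-scale : ∀ {A : Set} c (ws : List (A × ℚ)) φ → 𝔼 (scale c ws) φ ≡ c ℚ.* 𝔼 ws φ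
𝔼-scale c []             φ = sym (ℚₚ.*-zeroʳ c)
𝔼-scale c ((a , w) ∷ ws) φ = trans (cong₂ ℚ._+_ (ℚₚ.*-assoc c w (φ a)) (𝔼-scale c ws φ))
  (sym (ℚₚ.*-distribˡ-+ c (w ℚ.* φ a) (𝔼 ws φ)))

𝔼-*ʳ : ∀ {A : Set} (ws : List (A × ℚ)) φ c → 𝔼 ws (λ a → φ a ℚ.* c) ≡ 𝔼 ws φ ℚ.* c
𝔼-*ʳ []             φ c = sym (ℚₚ.*-zeroˡ c)
𝔼-*ʳ ((a , w) ∷ ws) φ c = trans (cong₂ ℚ._+_ (sym (ℚₚ.*-assoc w (φ a) c)) (𝔼-*ʳ ws φ c))
  (sym (ℚₚ.*-distribʳ-+ c (w ℚ.* φ a) (𝔼 ws φ)))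

𝔼-*ˡ : ∀ {A : Set} (ws : List (A × ℚ)) c φ → 𝔼 ws (λ a → c ℚ.* φ a) ≡ c ℚ.* 𝔼 ws φ
𝔼-*ˡ ws c φ = trans (𝔼-cong ws (λ a → ℚₚ.*-comm c (φ a))) (trans (𝔼-*ʳ ws φ c) (ℚₚ.*-comm (𝔼 ws φ) c))

𝔼->>= : ∀ {A B : Set} (d : Dist A) (f : A → Dist B) φ →
        𝔼 (weights (d >>= f)) φ ≡ 𝔼 (weights d) (λ a → 𝔼 (weights (f a)) φ)
𝔼->>= d f φ = go (weights d)
  where
  go : ∀ ws → 𝔼 (concatMap (λ (a , w) → scale w (weights (f a))) ws) φ ≡ 𝔼 ws (λ a → 𝔼 (weights (f a)) φ)
  go []             = refl
  go ((a , w) ∷ ws) = trans (𝔼-++ (scale w (weights (f a))) (concatMap _ ws) φ)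
    (cong₂ ℚ._+_ (𝔼-scale w (weights (f a)) φ) (go ws))

𝔼-tabulate : ∀ {A : Set} n (a : Fin n → A) (f : Fin n → ℚ) φ →
             𝔼 (tabulate (λ i → a i , f i)) φ ≡ ΣFin n (λ i → f i ℚ.* φ (a i))
𝔼-tabulate zero    a f φ = refl
𝔼-tabulate (suc n) a f φ = cong (f zero ℚ.* φ (a zero) ℚ.+_) (𝔼-tabulate n (a ∘ suc) (f ∘ suc) φ)

ΣFin-zero : ∀ n (f : Fin n → ℚ) → (∀ i → f i ≡ 0ℚ) → ΣFin n f ≡ 0ℚ
ΣFin-zero zero    f e = refl
ΣFin-zero (suc n) f e = cong₂ ℚ._+_ (e zero) (ΣFin-zero n (f ∘ suc) (e ∘ suc))

ΣFin-single : ∀ n (f : Fin n → ℚ) i → (∀ j → j ≢ i → f j ≡ 0ℚ) → ΣFin n f ≡ f i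
ΣFin-single (suc n) f zero    e = trans (cong (f zero ℚ.+_) (ΣFin-zero n (f ∘ suc) (λ j → e (suc j) (λ ()))))
  (ℚₚ.+-identityʳ (f zero))
ΣFin-single (suc n) f (suc i) e = trans (cong₂ ℚ._+_ (e zero (λ ()))
    (ΣFin-single n (f ∘ suc) i (λ j j≢i → e (suc j) (λ { refl → j≢i refl }))))
  (ℚₚ.+-identityˡ (f (suc i)))

[_] : Bool → ℚ
[ b ] = if b then 1ℚ else 0ℚ

[]-∧ : ∀ a b → [ a ∧ b ] ≡ [ a ] ℚ.* [ b ]
[]-∧ true  b = sym (ℚₚ.*-identityˡ [ b ])
[]-∧ false b = sym (ℚₚ.*-zeroˡ [ b ])

ℙ-𝔼 : ∀ d T → ℙ[ d ≡ T ] ≡ 𝔼 (weights d) (λ U → [ does (U ≟ T) ])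
ℙ-𝔼 d T = go (weights d)
  where
  go : ∀ ws → mass (map (λ (T′ , w) → T′ , (if does (T′ ≟ T) then w else 0ℚ)) ws) ≡ 𝔼 ws (λ U → [ does (U ≟ T) ])
  go []             = refl
  go ((U , w) ∷ ws) = cong₂ ℚ._+_ (indicator (does (U ≟ T))) (go ws)
    where
    indicator : ∀ b → (if b then w else 0ℚ) ≡ w ℚ.* [ b ]
    indicator true  = sym (ℚₚ.*-identityʳ w)
    indicator false = sym (ℚₚ.*-zeroʳ w)

module _ (n : ℕ) (rs : ∀ {y} → y ℕ.< suc (suc n) → Acc ℕ._<_ y) where
  private
    left : Fin (suc n) → Dist Tree
    left t = dtcs (suc (toℕ t)) (rs (s≤s (Finₚ.toℕ<n t)))
    right : Fin (suc n) → Dist Tree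
    right t = dtcs (suc (n ∸ toℕ t)) (rs (s≤s (s≤s (ℕₚ.m∸n≤m n (toℕ t)))))

  𝔼-dtcs : ∀ φ → 𝔼 (weights (dtcs (suc (suc n)) (acc rs))) φ ≡
    ΣFin (suc n) (λ t → q n (toℕ t) ℚ.* 𝔼 (weights (left t)) (λ l → 𝔼 (weights (right t)) (λ r → φ (node l r))))
  𝔼-dtcs φ = begin
    𝔼 (weights (split n >>= (λ t → left t >>= λ l → right t >>= λ r → return (node l r)))) φ
      ≡⟨ 𝔼->>= (split n) (λ t → left t >>= λ l → right t >>= λ r → return (node l r)) φ ⟩
    𝔼 (weights (split n)) (λ t → 𝔼 (weights (left t >>= λ l → right t >>= λ r → return (node l r))) φ)
      ≡⟨ 𝔼-tabulate (suc n) (λ t → t) (λ t → q n (toℕ t)) (λ t → 𝔼 (weights (left t >>= λ l → right t >>= λ r → return (node l r))) φ) ⟩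
    ΣFin (suc n) (λ t → q n (toℕ t) ℚ.* 𝔼 (weights (left t >>= λ l → right t >>= λ r → return (node l r))) φ)
      ≡⟨ ΣFin-cong (suc n) (λ t → cong (q n (toℕ t) ℚ.*_) (inner t)) ⟩
    ΣFin (suc n) (λ t → q n (toℕ t) ℚ.* 𝔼 (weights (left t)) (λ l → 𝔼 (weights (right t)) (λ r → φ (node l r)))) ∎
    where
    open ≡-Reasoning
    unit : ∀ x → 1ℚ ℚ.* x ℚ.+ 0ℚ ≡ x
    unit x = trans (ℚₚ.+-identityʳ (1ℚ ℚ.* x)) (ℚₚ.*-identityˡ x)
    inner : ∀ t → 𝔼 (weights (left t >>= λ l → right t >>= λ r → return (node l r))) φ ≡
                  𝔼 (weights (left t)) (λ l → 𝔼 (weights (right t)) (λ r → φ (node l r)))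
    inner t = trans (𝔼->>= (left t) (λ l → right t >>= λ r → return (node l r)) φ)
      (𝔼-cong (weights (left t)) (λ l → trans (𝔼->>= (right t) (λ r → return (node l r)) φ)
        (𝔼-cong (weights (right t)) (λ r → unit (φ (node l r))))))

  ℙ-dtcs-leaf : ℙ[ dtcs (suc (suc n)) (acc rs) ≡ leaf ] ≡ 0ℚ
  ℙ-dtcs-leaf = trans (ℙ-𝔼 (dtcs (suc (suc n)) (acc rs)) leaf) (trans (𝔼-dtcs (λ U → [ does (U ≟ leaf) ]))
    (ΣFin-zero (suc n) _ (λ t → trans (cong (q n (toℕ t) ℚ.*_)
      (trans (𝔼-cong (weights (left t)) (λ l → 𝔼-zero (weights (right t)))) (𝔼-zero (weights (left t)))))
      (ℚₚ.*-zeroʳ (q n (toℕ t))))))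

  -- Given the split, the subtrees are independent: the indicator of `node L R` is a product of
  -- indicators, and the double expectation factors.
  ℙ-dtcs-node : ∀ L R → ℙ[ dtcs (suc (suc n)) (acc rs) ≡ node L R ] ≡
    ΣFin (suc n) (λ t → q n (toℕ t) ℚ.* (ℙ[ left t ≡ L ] ℚ.* ℙ[ right t ≡ R ]))
  ℙ-dtcs-node L R = trans (ℙ-𝔼 (dtcs (suc (suc n)) (acc rs)) (node L R)) (trans (𝔼-dtcs (λ U → [ does (U ≟ node L R) ]))
    (ΣFin-cong (suc n) (λ t → cong (q n (toℕ t) ℚ.*_) (inner t))))
    where
    inner : ∀ t → 𝔼 (weights (left t)) (λ l → 𝔼 (weights (right t)) (λ r → [ does (l ≟ L) ∧ does (r ≟ R) ]))
                ≡ ℙ[ left t ≡ L ] ℚ.* ℙ[ right t ≡ R ]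
    inner t = begin
      𝔼 (weights (left t)) (λ l → 𝔼 (weights (right t)) (λ r → [ does (l ≟ L) ∧ does (r ≟ R) ]))
        ≡⟨ 𝔼-cong (weights (left t)) (λ l → trans
             (𝔼-cong (weights (right t)) (λ r → []-∧ (does (l ≟ L)) (does (r ≟ R))))
             (𝔼-*ˡ (weights (right t)) [ does (l ≟ L) ] (λ r → [ does (r ≟ R) ]))) ⟩
      𝔼 (weights (left t)) (λ l → [ does (l ≟ L) ] ℚ.* 𝔼 (weights (right t)) (λ r → [ does (r ≟ R) ]))
        ≡⟨ 𝔼-*ʳ (weights (left t)) (λ l → [ does (l ≟ L) ]) _ ⟩
      𝔼 (weights (left t)) (λ l → [ does (l ≟ L) ]) ℚ.* 𝔼 (weights (right t)) (λ r → [ does (r ≟ R) ])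
        ≡⟨ cong₂ ℚ._*_ (ℙ-𝔼 (left t) L) (ℙ-𝔼 (right t) R) ⟨
      ℙ[ left t ≡ L ] ℚ.* ℙ[ right t ≡ R ] ∎
      where open ≡-Reasoning

-- At each split at least one of the two subtrees has the wrong size. The lemma serves to reduce the
-- sum over all splits to the one that matches the left subtree.
ℙ-wrong-size : ∀ T m .{{_ : NonZero m}} (a : Acc ℕ._<_ m) → size T ≢ m → ℙ[ dtcs m a ≡ T ] ≡ 0ℚ
ℙ-wrong-size leaf       1             a        ≢m = ⊥-elim (≢m refl)
ℙ-wrong-size leaf       (suc (suc n)) (acc rs) ≢m = ℙ-dtcs-leaf n rs
ℙ-wrong-size (node L R) 1             a        ≢m = refl
ℙ-wrong-size (node L R) (suc (suc n)) (acc rs) ≢m = trans (ℙ-dtcs-node n rs L R) (ΣFin-zero (suc n) _ term)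
  where
  left right : Fin (suc n) → ℚ
  left t  = ℙ[ dtcs (suc (toℕ t)) (rs (s≤s (Finₚ.toℕ<n t))) ≡ L ]
  right t = ℙ[ dtcs (suc (n ∸ toℕ t)) (rs (s≤s (s≤s (ℕₚ.m∸n≤m n (toℕ t))))) ≡ R ]
  vanish : ∀ t → size L ≢ suc (toℕ t) ⊎ size R ≢ suc (n ∸ toℕ t) → left t ℚ.* right t ≡ 0ℚ
  vanish t (inj₁ l≢) = trans (cong (ℚ._* right t) (ℙ-wrong-size L (suc (toℕ t)) (rs (s≤s (Finₚ.toℕ<n t))) l≢)) (ℚₚ.*-zeroˡ (right t))
  vanish t (inj₂ r≢) = trans (cong (left t ℚ.*_) (ℙ-wrong-size R (suc (n ∸ toℕ t)) (rs (s≤s (s≤s (ℕₚ.m∸n≤m n (toℕ t))))) r≢)) (ℚₚ.*-zeroʳ (left t))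
  alternative : ∀ t → size L ≢ suc (toℕ t) ⊎ size R ≢ suc (n ∸ toℕ t)
  alternative t with size L ℕₚ.≟ suc (toℕ t)
  ... | no  l≢ = inj₁ l≢
  ... | yes l≡ = inj₂ λ r≡ → ≢m (trans (cong₂ ℕ._+_ l≡ r≡) (trans (cong suc (ℕₚ.+-suc (toℕ t) (n ∸ toℕ t)))
      (cong (2 ℕ.+_) (ℕₚ.m+[n∸m]≡n (ℕₚ.≤-pred (Finₚ.toℕ<n t))))))
  term : ∀ t → q n (toℕ t) ℚ.* (left t ℚ.* right t) ≡ 0ℚ
  term t = trans (cong (q n (toℕ t) ℚ.*_) (vanish t (alternative t))) (ℚₚ.*-zeroʳ (q n (toℕ t)))

1/*ι : ∀ c .{{_ : NonZero c}} → + 1 / c ℚ.* ι c ≡ 1ℚ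
1/*ι c@(suc c′) = trans (fromℚᵘ-* (mkℚᵘ (+ 1) c′) (mkℚᵘ (+ c) 0))
  (ℚₚ.fromℚᵘ-cong {mkℚᵘ (+ 1) c′ ℚᵘ.* mkℚᵘ (+ c) 0} {mkℚᵘ (+ 1) 0}
    (*≡* (trans (ℤₚ.*-identityʳ (+ 1 ℤ.* + c)) (trans (ℤₚ.*-identityˡ (+ c))
      (trans (cong +_ (sym (ℕₚ.*-identityʳ c))) (sym (ℤₚ.*-identityˡ (+ (c ℕ.* 1)))))))))

-- One step of the telescoping: apart from the toll, the split probability is the size of the whole
-- over the product of the sizes of the parts.
q-toll : ∀ n t → t ℕ.≤ n → q n t ℚ.* toll (suc (suc n)) ℚ.* (ι (suc t) ℚ.* ι (suc (n ∸ t))) ≡ ι (suc (suc n))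
q-toll n t t≤n = begin
  ι m ℚ.* i ℚ.* r ℚ.* toll m ℚ.* ab   ≡⟨ solve 5 (λ m i r t ab → m :* i :* r :* t :* ab := m :* (i :* t) :* (r :* ab)) refl (ι m) i r (toll m) ab ⟩
  ι m ℚ.* (i ℚ.* toll m) ℚ.* (r ℚ.* ab)  ≡⟨ cong₂ (λ x y → ι m ℚ.* x ℚ.* y) (ℚₚ.*-inverseˡ (toll m) {{2h-nonZero n}}) r*ab ⟩
  ι m ℚ.* 1ℚ ℚ.* 1ℚ                   ≡⟨ trans (ℚₚ.*-identityʳ (ι m ℚ.* 1ℚ)) (ℚₚ.*-identityʳ (ι m)) ⟩
  ι m                                 ∎
  where
  open ≡-Reasoning
  open +-*-Solver
  m = suc (suc n)
  c = suc t ℕ.* suc (n ∸ t)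
  i r ab : ℚ
  i = 1/2h n
  r = + 1 / c
  ab = ι (suc t) ℚ.* ι (suc (n ∸ t))
  r*ab : r ℚ.* ab ≡ 1ℚ
  r*ab = trans (cong (r ℚ.*_) (sym (ι-* (suc t) (suc (n ∸ t)))))
    (1/*ι c)

-- The product form avoids dividing by `X T`. The accessibility proof is arbitrary because the
-- recursive calls carry other ones.
ℙ*X : ∀ T m .{{_ : NonZero m}} (a : Acc ℕ._<_ m) → size T ≡ m → ℙ[ dtcs m a ≡ T ] ℚ.* X T ≡ ι m
ℙ*X leaf       1             a        _  = refl
ℙ*X leaf       (suc (suc n)) a        ()
ℙ*X (node L R) 1             a        ≡m = ⊥-elim (ℕₚ.<⇒≢ (ℕₚ.+-mono-≤ (size>0 L) (size>0 R)) (sym ≡m))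
ℙ*X (node L R) (suc (suc n)) (acc rs) ≡m = begin
  ℙ[ dtcs (suc (suc n)) (acc rs) ≡ node L R ] ℚ.* X (node L R)
    ≡⟨ cong₂ ℚ._*_ (trans (ℙ-dtcs-node n rs L R) (ΣFin-single (suc n) term t others))
         (cong (λ m → toll m ℚ.* (X L ℚ.* X R)) ≡m) ⟩
  q n (toℕ t) ℚ.* (pL ℚ.* pR) ℚ.* (toll (suc (suc n)) ℚ.* (X L ℚ.* X R))
    ≡⟨ solve 6 (λ q pL pR t XL XR → q :* (pL :* pR) :* (t :* (XL :* XR)) := q :* t :* ((pL :* XL) :* (pR :* XR))) refl
         (q n (toℕ t)) pL pR (toll (suc (suc n))) (X L) (X R) ⟩
  q n (toℕ t) ℚ.* toll (suc (suc n)) ℚ.* ((pL ℚ.* X L) ℚ.* (pR ℚ.* X R))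
    ≡⟨ cong (q n (toℕ t) ℚ.* toll (suc (suc n)) ℚ.*_) (cong₂ ℚ._*_ (ℙ*X L (suc (toℕ t)) _ L≡) (ℙ*X R (suc (n ∸ toℕ t)) _ R≡)) ⟩
  q n (toℕ t) ℚ.* toll (suc (suc n)) ℚ.* (ι (suc (toℕ t)) ℚ.* ι (suc (n ∸ toℕ t)))
    ≡⟨ q-toll n (toℕ t) (ℕₚ.≤-pred (Finₚ.toℕ<n t)) ⟩
  ι (suc (suc n)) ∎
  where
  open ≡-Reasoning
  open +-*-Solver
  p : ℕ
  p = ℕ.pred (size L)
  suc-p : suc p ≡ size L
  suc-p = ℕₚ.suc-pred (size L) {{ℕ.>-nonZero (size>0 L)}}
  p+R : p ℕ.+ size R ≡ suc n
  p+R = ℕₚ.suc-injective (trans (cong (ℕ._+ size R) suc-p) ≡m)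
  p<suc-n : p ℕ.< suc n
  p<suc-n = subst (p ℕ.<_) p+R (ℕₚ.m<m+n p (size>0 R))
  t : Fin (suc n)
  t = fromℕ< p<suc-n
  toℕ-t : toℕ t ≡ p
  toℕ-t = Finₚ.toℕ-fromℕ< p<suc-n
  L≡ : size L ≡ suc (toℕ t)
  L≡ = trans (sym suc-p) (cong suc (sym toℕ-t))
  R≡ : size R ≡ suc (n ∸ toℕ t)
  R≡ = trans (sym (ℕₚ.m+n∸m≡n p (size R))) (trans (cong₂ _∸_ p+R (sym toℕ-t))
    (ℕₚ.+-∸-assoc 1 (ℕₚ.≤-pred (Finₚ.toℕ<n t))))
  left right : ∀ t → ℚ
  left t  = ℙ[ dtcs (suc (toℕ t)) (rs (s≤s (Finₚ.toℕ<n t))) ≡ L ]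
  right t = ℙ[ dtcs (suc (n ∸ toℕ t)) (rs (s≤s (s≤s (ℕₚ.m∸n≤m n (toℕ t))))) ≡ R ]
  term : Fin (suc n) → ℚ
  term t = q n (toℕ t) ℚ.* (left t ℚ.* right t)
  pL pR : ℚ
  pL = left t
  pR = right t
  others : ∀ j → j ≢ t → term j ≡ 0ℚ
  others j j≢t = trans (cong (λ p → q n (toℕ j) ℚ.* (p ℚ.* right j)) (ℙ-wrong-size L (suc (toℕ j)) _
      (λ L≡j → j≢t (Finₚ.toℕ-injective (ℕₚ.suc-injective (trans (sym L≡j) L≡))))))
    (trans (cong (q n (toℕ j) ℚ.*_) (ℚₚ.*-zeroˡ (right j))) (ℚₚ.*-zeroʳ (q n (toℕ j))))

ℙ-DTCS*X : ∀ T k .{{_ : NonZero k}} → size T ≡ k → ℙ[ DTCS k ≡ T ] ℚ.* X T ≡ ι k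
ℙ-DTCS*X T k = ℙ*X T k (<-wellFounded k)

ι>0 : ∀ k .{{_ : NonZero k}} → 0ℚ ℚ.< ι k
ι>0 k = ℚₚ.positive⁻¹ (ι k) {{ι-pos k}}

ℙ-DTCS>0 : ∀ T k .{{_ : NonZero k}} → size T ≡ k → 0ℚ ℚ.< ℙ[ DTCS k ≡ T ]
ℙ-DTCS>0 T k eq = ℚₚ.*-cancelʳ-<-nonNeg (X T) {{ℚ.nonNegative (ℚₚ.<⇒≤ (X>0 T))}}
  (subst₂ ℚ._<_ (sym (ℚₚ.*-zeroˡ (X T))) (sym (ℙ-DTCS*X T k eq)) (ι>0 k))

mostLikely⇔≅CBT : ∀ k .{{_ : NonZero k}} T → size T ≡ k → MostLikely k T ⇔ T ≅ CBT k
mostLikely⇔≅CBT k T T≡k = mk⇔ to from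
  where
  to : MostLikely k T → T ≅ CBT k
  to ml with subst (λ n → T ⊒ CBT n) T≡k (best T)
  ... | inj₁ T≅    = T≅
  -- For both trees probability times `X` is k, so a strictly smaller `X` cannot come with a
  -- probability that is no larger.
  ... | inj₂ X<    = ⊥-elim (ℚₚ.<-irrefl (trans (ℙ-DTCS*X (CBT k) k (CBT-size k)) (sym (ℙ-DTCS*X T k T≡k)))
    (*-mono-≤-<-pos (ℙ-DTCS>0 (CBT k) k (CBT-size k)) (X>0 (CBT k)) (ml (CBT k) (CBT-size k)) X<))
  from : T ≅ CBT k → MostLikely k T
  from T≅ U U≡k = ℚₚ.*-cancelʳ-≤-pos (X T) {{ℚ.positive (X>0 T)}} (ℚₚ.≤-trans
    (ℚₚ.*-monoˡ-≤-nonNeg ℙ[ DTCS k ≡ U ] {{ℚ.nonNegative (ℚₚ.<⇒≤ (ℙ-DTCS>0 U k U≡k))}}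
      (ℚₚ.≤-trans (ℚₚ.≤-reflexive (≅⇒X≡ T≅)) (⊒⇒≥ (subst (λ n → U ⊒ CBT n) U≡k (best U)))))
    (ℚₚ.≤-reflexive (trans (ℙ-DTCS*X U k U≡k) (sym (ℙ-DTCS*X T k T≡k)))))

-- Binary logarithms

ε : ℕ → ℚ
ε n = + 1 / suc n

infix 4 _≼_

-- Comparison up to O(1/n), the rounding error in the sequences that represent logarithms.
record _≼_ (u v : ℕ → ℚ) : Set where
  constructor bound
  field
    C    : ℚ
    0≤C  : 0ℚ ℚ.≤ C
    u≤v+ : ∀ n → u n ℚ.≤ v n ℚ.+ C ℚ.* ε n

ε>0 : ∀ n → 0ℚ ℚ.< ε n
ε>0 = 1/suc>0

0≤1 : 0ℚ ℚ.≤ 1ℚ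
0≤1 = ℚₚ.nonNegative⁻¹ 1ℚ

pointwise : ∀ u v → (∀ n → u n ℚ.≤ v n) → u ≼ v
pointwise u v p = bound 0ℚ ℚₚ.≤-refl λ n → ℚₚ.≤-trans (p n)
  (ℚₚ.≤-reflexive (sym (trans (cong (v n ℚ.+_) (ℚₚ.*-zeroˡ (ε n))) (ℚₚ.+-identityʳ (v n)))))

≼-trans : ∀ {u v w} → u ≼ v → v ≼ w → u ≼ w
≼-trans {u} {v} {w} (bound C 0≤C p) (bound D 0≤D q) = bound (D ℚ.+ C) (ℚₚ.+-mono-≤ 0≤D 0≤C) λ n → begin
  u n                                          ≤⟨ p n ⟩
  v n ℚ.+ C ℚ.* ε n                            ≤⟨ ℚₚ.+-monoˡ-≤ (C ℚ.* ε n) (q n) ⟩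
  w n ℚ.+ D ℚ.* ε n ℚ.+ C ℚ.* ε n              ≡⟨ solve 4 (λ w d c e → w :+ d :* e :+ c :* e := w :+ (d :+ c) :* e) refl (w n) D C (ε n) ⟩
  w n ℚ.+ (D ℚ.+ C) ℚ.* ε n                    ∎
  where
  open ℚₚ.≤-Reasoning
  open +-*-Solver

≼-+ : ∀ {u v u′ v′} → u ≼ v → u′ ≼ v′ → (λ n → u n ℚ.+ u′ n) ≼ (λ n → v n ℚ.+ v′ n)
≼-+ {u} {v} {u′} {v′} (bound C 0≤C p) (bound D 0≤D q) = bound (C ℚ.+ D) (ℚₚ.+-mono-≤ 0≤C 0≤D) λ n → ℚₚ.≤-trans
  (ℚₚ.+-mono-≤ (p n) (q n))
  (ℚₚ.≤-reflexive (solve 5 (λ v v′ d c e → (v :+ c :* e) :+ (v′ :+ d :* e) := v :+ v′ :+ (c :+ d) :* e) refl (v n) (v′ n) D C (ε n)))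
  where open +-*-Solver

≼-* : ∀ {u v} c → 0ℚ ℚ.≤ c → u ≼ v → (λ n → c ℚ.* u n) ≼ (λ n → c ℚ.* v n)
≼-* {u} {v} c 0≤c (bound C 0≤C p) = bound (c ℚ.* C)
  (ℚₚ.nonNegative⁻¹ (c ℚ.* C) {{ℚₚ.nonNeg*nonNeg⇒nonNeg c {{ℚ.nonNegative 0≤c}} C {{ℚ.nonNegative 0≤C}}}})
  λ n → ℚₚ.≤-trans (ℚₚ.*-monoˡ-≤-nonNeg c {{ℚ.nonNegative 0≤c}} (p n))
    (ℚₚ.≤-reflexive (solve 4 (λ c v d e → c :* (v :+ d :* e) := c :* v :+ c :* d :* e) refl c (v n) C (ε n)))
  where open +-*-Solver

≼-neg : ∀ {u v} → u ≼ v → (λ n → ℚ.- v n) ≼ (λ n → ℚ.- u n)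
≼-neg {u} {v} (bound C 0≤C p) = bound C 0≤C λ n → subst₂ ℚ._≤_
  (solve 2 (λ u v → u :+ (:- u :+ :- v) := :- v) refl (u n) (v n))
  (solve 3 (λ u v e → v :+ e :+ (:- u :+ :- v) := :- u :+ e) refl (u n) (v n) (C ℚ.* ε n))
  (ℚₚ.+-monoˡ-≤ (ℚ.- u n ℚ.- v n) (p n))
  where open +-*-Solver

eventually : ∀ {u v} → u ≼ v → ∀ δ → 0ℚ ℚ.< δ → ∃[ N ] (∀ n → N ℕ.≤ n → u n ℚ.≤ v n ℚ.+ δ)
eventually {u} {v} (bound C 0≤C p) δ 0<δ = proj₁ M , λ n N≤n → begin
  u n                                ≤⟨ p n ⟩
  v n ℚ.+ C ℚ.* ε n                  ≤⟨ ℚₚ.+-monoʳ-≤ (v n) (ℚₚ.*-monoʳ-≤-nonNeg (ε n) {{ℚ.nonNegative (ℚₚ.<⇒≤ (ε>0 n))}} (ℚₚ.<⇒≤ C<D)) ⟩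
  v n ℚ.+ D ℚ.* ε n                  ≤⟨ ℚₚ.+-monoʳ-≤ (v n) (ℚₚ.*-monoˡ-≤-nonNeg D {{ℚ.nonNegative (ℚₚ.<⇒≤ 0<D)}} (ℚₚ.≤-trans (1/suc-antimono N≤n) (proj₂ M))) ⟩
  v n ℚ.+ D ℚ.* (1/D ℚ.* δ)          ≡⟨ cong (v n ℚ.+_) (trans (sym (ℚₚ.*-assoc D 1/D δ)) (trans (cong (ℚ._* δ) (ℚₚ.*-inverseʳ D {{ℚₚ.pos⇒nonZero D {{ℚ.positive 0<D}}}})) (ℚₚ.*-identityˡ δ))) ⟩
  v n ℚ.+ δ                          ∎
  where
  open ℚₚ.≤-Reasoning
  -- `C` may be 0; `C + 1` can be inverted.
  D : ℚ
  D = C ℚ.+ 1ℚ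
  C<D : C ℚ.< D
  C<D = p<p+q C (ℚₚ.positive⁻¹ 1ℚ)
  0<D : 0ℚ ℚ.< D
  0<D = ℚₚ.≤-<-trans 0≤C C<D
  1/D : ℚ
  1/D = (ℚ.1/ D) {{ℚₚ.pos⇒nonZero D {{ℚ.positive 0<D}}}}
  M : ∃[ M ] (ε M ℚ.≤ 1/D ℚ.* δ)
  M = archimedean (1/D ℚ.* δ) (*-pos (ℚₚ.positive⁻¹ 1/D {{ℚₚ.1/pos⇒pos D {{ℚ.positive 0<D}}}}) 0<δ)

ℓ : ℕ → ℕ → ℚ
ℓ a n = + ⌊lg⌋ a n / suc n

ι-mono-≤ : ∀ {m n} → m ℕ.≤ n → ι m ℚ.≤ ι n
ι-mono-≤ {m} {n} p = /-mono-≤ (+ m) (+ n) 0 0 (ℤₚ.*-monoʳ-≤-nonNeg (+ 1) (ℤ.+≤+ p))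

ι-cancel-≤ : ∀ {m n} → ι m ℚ.≤ ι n → m ℕ.≤ n
ι-cancel-≤ {m} {n} p with ℕₚ.<-≤-connex n m
... | inj₁ n<m = ⊥-elim (ℚₚ.<-irrefl refl (ℚₚ.<-≤-trans (ι-mono-< n<m) p))
... | inj₂ m≤n = m≤n

ι-+ : ∀ m n → ι (m ℕ.+ n) ≡ ι m ℚ.+ ι n
ι-+ m n = trans (cong (_/ 1) (ℤₚ.pos-+ m n)) (sym (/-+ (+ m) (+ n) 0))

ι≥0 : ∀ n → 0ℚ ℚ.≤ ι n
ι≥0 n = ι-mono-≤ {0} {n} z≤n

private
  /-mono-num : ∀ a b n → a ℕ.≤ b → + a / suc n ℚ.≤ + b / suc n
  /-mono-num a b n p = /-mono-≤ (+ a) (+ b) n n (ℤₚ.*-monoʳ-≤-nonNeg (+ suc n) (ℤ.+≤+ p))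

  /-+-num : ∀ a b n → + (a ℕ.+ b) / suc n ≡ + a / suc n ℚ.+ + b / suc n
  /-+-num a b n = trans (cong (_/ suc n) (ℤₚ.pos-+ a b)) (sym (/-+ (+ a) (+ b) n))

  /-cancel : ∀ c n → + (c ℕ.* suc n) / suc n ≡ ι c
  /-cancel c n = ℚₚ.fromℚᵘ-cong {mkℚᵘ (+ (c ℕ.* suc n)) n} {mkℚᵘ (+ c) 0}
    (*≡* (trans (ℤₚ.*-identityʳ (+ (c ℕ.* suc n))) (ℤₚ.pos-* c (suc n))))

ℓ-mono : ∀ {a b} n → a ℕ.≤ b → ℓ a n ℚ.≤ ℓ b n
ℓ-mono {a} {b} n p = /-mono-num (⌊lg⌋ a n) (⌊lg⌋ b n) n (⌊log₂⌋-mono-≤ (ℕₚ.^-monoˡ-≤ (suc n) p))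

^-distribʳ-* : ∀ n x y → (x ℕ.* y) ℕ.^ n ≡ x ℕ.^ n ℕ.* y ℕ.^ n
^-distribʳ-* zero    x y = refl
^-distribʳ-* (suc n) x y = trans (cong (x ℕ.* y ℕ.*_) (^-distribʳ-* n x y)) (regroup x y (x ℕ.^ n) (y ℕ.^ n))
  where
  regroup : ∀ a b c d → a ℕ.* b ℕ.* (c ℕ.* d) ≡ a ℕ.* c ℕ.* (b ℕ.* d)
  regroup = ℕ-Tactic.solve-∀

ℓ-*-lower : ∀ a b .{{_ : NonZero a}} .{{_ : NonZero b}} n → ℓ a n ℚ.+ ℓ b n ℚ.≤ ℓ (a ℕ.* b) n
ℓ-*-lower a b n = ℚₚ.≤-trans (ℚₚ.≤-reflexive (sym (/-+-num U V n))) (/-mono-num (U ℕ.+ V) (⌊lg⌋ (a ℕ.* b) n) n (ℕₚ.≤-pred (2^-cancel-< (begin-strict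
  2 ℕ.^ (U ℕ.+ V)                      ≡⟨ ℕₚ.^-distribˡ-+-* 2 U V ⟩
  2 ℕ.^ U ℕ.* 2 ℕ.^ V                  ≤⟨ ℕₚ.*-mono-≤ (lower a n) (lower b n) ⟩
  a ℕ.^ suc n ℕ.* b ℕ.^ suc n          ≡⟨ ^-distribʳ-* (suc n) a b ⟨
  (a ℕ.* b) ℕ.^ suc n                  <⟨ upper (a ℕ.* b) n ⟩
  2 ℕ.^ suc (⌊lg⌋ (a ℕ.* b) n)         ∎))))
  where
  open ℕₚ.≤-Reasoning
  U = ⌊lg⌋ a n
  V = ⌊lg⌋ b n

ℓ-*-upper : ∀ a b .{{_ : NonZero a}} .{{_ : NonZero b}} n → ℓ (a ℕ.* b) n ℚ.≤ ℓ a n ℚ.+ ℓ b n ℚ.+ ε n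
ℓ-*-upper a b n = ℚₚ.≤-trans (/-mono-num W (suc (U ℕ.+ V)) n W≤) (ℚₚ.≤-reflexive
    (trans (+n/ (U ℕ.+ V) n) (cong (ℚ._+ ε n) (/-+-num U V n))))
  where
  U = ⌊lg⌋ a n
  V = ⌊lg⌋ b n
  W = ⌊lg⌋ (a ℕ.* b) n
  W≤ : W ℕ.≤ suc (U ℕ.+ V)
  W≤ = ℕₚ.≤-pred (2^-cancel-< (begin-strict
    2 ℕ.^ W                            ≤⟨ lower (a ℕ.* b) {{ℕₚ.m*n≢0 a b}} n ⟩
    (a ℕ.* b) ℕ.^ suc n                ≡⟨ ^-distribʳ-* (suc n) a b ⟩
    a ℕ.^ suc n ℕ.* b ℕ.^ suc n        <⟨ ℕₚ.*-mono-< (upper a n) (upper b n) ⟩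
    2 ℕ.^ suc U ℕ.* 2 ℕ.^ suc V        ≡⟨ ℕₚ.^-distribˡ-+-* 2 (suc U) (suc V) ⟨
    2 ℕ.^ (suc U ℕ.+ suc V)            ≡⟨ cong (λ k → 2 ℕ.^ suc k) (ℕₚ.+-suc U V) ⟩
    2 ℕ.^ suc (suc (U ℕ.+ V))          ∎))
    where open ℕₚ.≤-Reasoning

-- A power of 2 shifts the floor by the integer c(n+1), so no rounding error arises.
ℓ-2^* : ∀ {a} c b → .{{NonZero a}} → a ℕ.≤ 2 ℕ.^ c ℕ.* b → ∀ n → ℓ a n ℚ.≤ ι c ℚ.+ ℓ b n
ℓ-2^* {a} c b p n = ℚₚ.≤-trans (/-mono-num (⌊lg⌋ a n) (c ℕ.* suc n ℕ.+ V) n (ℕₚ.≤-pred (2^-cancel-< (begin-strict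
    2 ℕ.^ ⌊lg⌋ a n                            ≤⟨ lower a n ⟩
    a ℕ.^ suc n                               ≤⟨ ℕₚ.^-monoˡ-≤ (suc n) p ⟩
    (2 ℕ.^ c ℕ.* b) ℕ.^ suc n                 ≡⟨ ^-distribʳ-* (suc n) (2 ℕ.^ c) b ⟩
    (2 ℕ.^ c) ℕ.^ suc n ℕ.* b ℕ.^ suc n       ≡⟨ cong (ℕ._* b ℕ.^ suc n) (ℕₚ.^-*-assoc 2 c (suc n)) ⟩
    2 ℕ.^ (c ℕ.* suc n) ℕ.* b ℕ.^ suc n       <⟨ ℕₚ.*-monoʳ-< (2 ℕ.^ (c ℕ.* suc n)) {{ℕₚ.m^n≢0 2 (c ℕ.* suc n)}} (upper b n) ⟩
    2 ℕ.^ (c ℕ.* suc n) ℕ.* 2 ℕ.^ suc V       ≡⟨ ℕₚ.^-distribˡ-+-* 2 (c ℕ.* suc n) (suc V) ⟨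
    2 ℕ.^ (c ℕ.* suc n ℕ.+ suc V)             ≡⟨ cong (2 ℕ.^_) (ℕₚ.+-suc (c ℕ.* suc n) V) ⟩
    2 ℕ.^ suc (c ℕ.* suc n ℕ.+ V)             ∎))))
  (ℚₚ.≤-reflexive (trans (/-+-num (c ℕ.* suc n) V n) (cong (λ x → x ℚ.+ ℓ b n) (/-cancel c n))))
  where
  open ℕₚ.≤-Reasoning
  V = ⌊lg⌋ b n

ℓ-2^ : ∀ c n → ℓ (2 ℕ.^ c) n ≡ ι c
ℓ-2^ c n = trans (cong (λ k → + k / suc n) (trans (cong ⌊log₂_⌋ (ℕₚ.^-*-assoc 2 c (suc n))) (⌊log₂[2^n]⌋≡n (c ℕ.* suc n))))
  (/-cancel c n)

-- The positivity proof is irrelevant, so all proofs give the same sequence.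
Log : ∀ y → .(0ℚ ℚ.< y) → ℕ → ℚ
Log y p = seq (log₂ y {{ℚ.positive p}})

-- y = a / b, not necessarily in lowest terms.
record Fraction (y : ℚ) (a b : ℕ) : Set where
  field
    {{a≢0}} : NonZero a
    {{b≢0}} : NonZero b
    y*b≡a   : y ℚ.* ι b ≡ ι a

open Fraction

ratio : ℕ → ℕ → ℕ → ℚ
ratio a b n = ℓ a n ℚ.- ℓ b n

fraction : ∀ y .(p : 0ℚ ℚ.< y) → ∃[ a ] ∃[ b ] Fraction y a b × (∀ n → Log y p n ≡ ratio a b n)
fraction y@(mkℚ +[1+ n′ ] d′ _) p = suc n′ , suc d′ , record { y*b≡a = eq } ,
  λ n → cong (ℓ (suc n′) n ℚ.+_) (sym (neg (ℓ (suc d′) n)))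
  where
  neg : ∀ x → ℚ.- x ≡ ℚ.- 1ℚ ℚ.* x
  neg x = solve 1 (λ x → :- x := con (ℚ.- 1ℚ) :* x) refl x
    where open +-*-Solver
  eq : y ℚ.* ι (suc d′) ≡ ι (suc n′)
  eq = trans (cong (ℚ._* ι (suc d′)) (sym (ℚₚ.fromℚᵘ-toℚᵘ y))) (trans (fromℚᵘ-* (mkℚᵘ (+ suc n′) d′) (mkℚᵘ (+ suc d′) 0))
    (ℚₚ.fromℚᵘ-cong {mkℚᵘ (+ suc n′) d′ ℚᵘ.* mkℚᵘ (+ suc d′) 0} {mkℚᵘ (+ suc n′) 0}
      (*≡* (trans (ℤₚ.*-identityʳ (+ suc n′ ℤ.* + suc d′)) (cong (λ z → + suc n′ ℤ.* + z) (sym (ℕₚ.*-identityʳ (suc d′))))))))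
fraction (mkℚ (+ 0) d′ c) p = ⊥-elim-irr (¬positive (ℚ.positive p))
  where
  ¬positive : Positive (mkℚ (+ 0) d′ c) → ⊥
  ¬positive ()
fraction (mkℚ ℤ.-[1+ n′ ] d′ c) p = ⊥-elim-irr (¬positive (ℚ.positive p))
  where
  ¬positive : Positive (mkℚ ℤ.-[1+ n′ ] d′ c) → ⊥
  ¬positive ()

fraction-* : ∀ {x y a b c d} → Fraction x a b → Fraction y c d → Fraction (x ℚ.* y) (a ℕ.* c) (b ℕ.* d)
fraction-* {x} {y} {a} {b} {c} {d} f g = record
  { a≢0 = ℕₚ.m*n≢0 a c {{a≢0 f}} {{a≢0 g}}
  ; b≢0 = ℕₚ.m*n≢0 b d {{b≢0 f}} {{b≢0 g}}
  ; y*b≡a = trans (cong (x ℚ.* y ℚ.*_) (ι-* b d)) (trans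
      (solve 4 (λ x y b d → x :* y :* (b :* d) := (x :* b) :* (y :* d)) refl x y (ι b) (ι d))
      (trans (cong₂ ℚ._*_ (y*b≡a f) (y*b≡a g)) (sym (ι-* a c)))) }
  where open +-*-Solver

recompute-nonZero : ∀ a → .{{NonZero a}} → NonZero a
recompute-nonZero (suc _) = _

fraction-ι : ∀ a .{{_ : NonZero a}} → Fraction (ι a) a 1
fraction-ι a = record { a≢0 = recompute-nonZero a ; y*b≡a = ℚₚ.*-identityʳ (ι a) }

fraction-cross : ∀ {y z a b c d} → Fraction y a b → Fraction z c d → y ℚ.≤ z → a ℕ.* d ℕ.≤ c ℕ.* b
fraction-cross {y} {z} {a} {b} {c} {d} f g y≤z = ι-cancel-≤ (subst₂ ℚ._≤_
  (trans (sym (ℚₚ.*-assoc y (ι b) (ι d))) (trans (cong (ℚ._* ι d) (y*b≡a f)) (sym (ι-* a d))))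
  (trans (solve 3 (λ z b d → z :* (b :* d) := z :* d :* b) refl z (ι b) (ι d)) (trans (cong (ℚ._* ι b) (y*b≡a g)) (sym (ι-* c b))))
  (ℚₚ.*-monoʳ-≤-nonNeg (ι b ℚ.* ι d) {{ℚ.nonNegative (ℚₚ.≤-trans (ι≥0 (b ℕ.* d)) (ℚₚ.≤-reflexive (ι-* b d)))}} y≤z))
  where open +-*-Solver

private
  transfer : ∀ {a b c d e} → a ℚ.+ d ℚ.≤ c ℚ.+ b ℚ.+ e → a ℚ.- b ℚ.≤ c ℚ.- d ℚ.+ e
  transfer {a} {b} {c} {d} {e} p = subst₂ ℚ._≤_
    (solve 3 (λ a b d → a :+ d :+ (:- b :+ :- d) := a :+ :- b) refl a b d)
    (solve 4 (λ b c d e → c :+ b :+ e :+ (:- b :+ :- d) := c :+ :- d :+ e) refl b c d e)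
    (ℚₚ.+-monoˡ-≤ (ℚ.- b ℚ.- d) p)
    where open +-*-Solver

-- Cross multiplication turns the inequality into one between products of naturals; splitting the
-- larger product costs one `ε n`.
ℓ-fraction-mono : ∀ {y z a b c d} → Fraction y a b → Fraction z c d → y ℚ.≤ z →
                  ∀ n → ℓ a n ℚ.- ℓ b n ℚ.≤ ℓ c n ℚ.- ℓ d n ℚ.+ ε n
ℓ-fraction-mono {a = a} {b} {c} {d} f g y≤z n = transfer {ℓ a n} {ℓ b n} {ℓ c n} {ℓ d n} (ℚₚ.≤-trans (ℓ-*-lower a d {{a≢0 f}} {{b≢0 g}} n)
  (ℚₚ.≤-trans (ℓ-mono n (fraction-cross f g y≤z)) (ℓ-*-upper c b {{a≢0 g}} {{b≢0 f}} n)))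

infix 4 _≃_

record _≃_ (u v : ℕ → ℚ) : Set where
  constructor _,_
  field
    ≃⇒≼ : u ≼ v
    ≃⇒≽ : v ≼ u

open _≃_

≃-refl : ∀ {u} → u ≃ u
≃-refl {u} = pointwise u u (λ n → ℚₚ.≤-refl) , pointwise u u (λ n → ℚₚ.≤-refl)

≃-sym : ∀ {u v} → u ≃ v → v ≃ u
≃-sym (p , q) = q , p

≃-trans : ∀ {u v w} → u ≃ v → v ≃ w → u ≃ w
≃-trans (p , q) (r , s) = ≼-trans p r , ≼-trans s q

≃-+ : ∀ {u v u′ v′} → u ≃ v → u′ ≃ v′ → (λ n → u n ℚ.+ u′ n) ≃ (λ n → v n ℚ.+ v′ n)
≃-+ (p , q) (r , s) = ≼-+ p r , ≼-+ q s

≃-neg : ∀ {u v} → u ≃ v → (λ n → ℚ.- u n) ≃ (λ n → ℚ.- v n)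
≃-neg (p , q) = ≼-neg q , ≼-neg p

≗⇒≃ : ∀ (u v : ℕ → ℚ) → (∀ n → u n ≡ v n) → u ≃ v
≗⇒≃ u v e = pointwise u v (λ n → ℚₚ.≤-reflexive (e n)) , pointwise v u (λ n → ℚₚ.≤-reflexive (sym (e n)))

ε-≼ : ∀ (u v : ℕ → ℚ) → (∀ n → u n ℚ.≤ v n ℚ.+ ε n) → u ≼ v
ε-≼ u v p = bound 1ℚ 0≤1 λ n → subst (λ e → u n ℚ.≤ v n ℚ.+ e) (sym (ℚₚ.*-identityˡ (ε n))) (p n)

ratio-mono : ∀ {y z a b c d} → Fraction y a b → Fraction z c d → y ℚ.≤ z → ratio a b ≼ ratio c d
ratio-mono {a = a} {b} {c} {d} f g y≤z = ε-≼ (ratio a b) (ratio c d) (ℓ-fraction-mono f g y≤z)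

-- Monotonicity is applied in both directions to two fractions for the same number. Products of
-- reduced fractions need not be reduced, hence the need for arbitrary ones.
Log-fraction : ∀ {y a b} .(p : 0ℚ ℚ.< y) → Fraction y a b → Log y p ≃ ratio a b
Log-fraction {y} {a} {b} p f =
  let (c , d , g , eq) = fraction y p in ≃-trans {Log y p} {ratio c d} {ratio a b} (≗⇒≃ (Log y p) (ratio c d) eq)
  (ratio-mono g f ℚₚ.≤-refl , ratio-mono f g ℚₚ.≤-refl)

ℓ-* : ∀ a b .{{_ : NonZero a}} .{{_ : NonZero b}} → ℓ (a ℕ.* b) ≃ (λ n → ℓ a n ℚ.+ ℓ b n)
ℓ-* a b = ε-≼ (ℓ (a ℕ.* b)) (λ n → ℓ a n ℚ.+ ℓ b n) (ℓ-*-upper a b) ,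
          pointwise (λ n → ℓ a n ℚ.+ ℓ b n) (ℓ (a ℕ.* b)) (ℓ-*-lower a b)

Log-mono : ∀ {y z} .(p : 0ℚ ℚ.< y) .(q : 0ℚ ℚ.< z) → y ℚ.≤ z → Log y p ≼ Log z q
Log-mono {y} {z} p q y≤z =
  let (a , b , f , e₁) = fraction y p
      (c , d , g , e₂) = fraction z q in ≼-trans {Log y p} {ratio a b} {Log z q} (≃⇒≼ (≗⇒≃ (Log y p) (ratio a b) e₁))
  (≼-trans {ratio a b} {ratio c d} {Log z q} (ratio-mono f g y≤z) (≃⇒≽ (≗⇒≃ (Log z q) (ratio c d) e₂)))

Log-* : ∀ {x y} .(p : 0ℚ ℚ.< x) .(q : 0ℚ ℚ.< y) .(r : 0ℚ ℚ.< x ℚ.* y) →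
        Log (x ℚ.* y) r ≃ (λ n → Log x p n ℚ.+ Log y q n)
Log-* {x} {y} p q r =
  let (a , b , f , e₁) = fraction x p
      (c , d , g , e₂) = fraction y q in
  ≃-trans {Log (x ℚ.* y) r} {ratio (a ℕ.* c) (b ℕ.* d)} {λ n → Log x p n ℚ.+ Log y q n} (Log-fraction r (fraction-* f g))
  (≃-trans {ratio (a ℕ.* c) (b ℕ.* d)} {λ n → ℓ a n ℚ.+ ℓ c n ℚ.- (ℓ b n ℚ.+ ℓ d n)} {λ n → Log x p n ℚ.+ Log y q n}
    (≃-+ {ℓ (a ℕ.* c)} {λ n → ℓ a n ℚ.+ ℓ c n} {λ n → ℚ.- ℓ (b ℕ.* d) n} {λ n → ℚ.- (ℓ b n ℚ.+ ℓ d n)}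
      (ℓ-* a c {{a≢0 f}} {{a≢0 g}})
      (≃-neg {ℓ (b ℕ.* d)} {λ n → ℓ b n ℚ.+ ℓ d n} (ℓ-* b d {{b≢0 f}} {{b≢0 g}})))
    (≗⇒≃ (λ n → ℓ a n ℚ.+ ℓ c n ℚ.- (ℓ b n ℚ.+ ℓ d n)) (λ n → Log x p n ℚ.+ Log y q n)
      λ n → trans (regroup (ℓ a n) (ℓ b n) (ℓ c n) (ℓ d n)) (sym (cong₂ ℚ._+_ (e₁ n) (e₂ n)))))
  where
  regroup : ∀ a b c d → a ℚ.+ c ℚ.- (b ℚ.+ d) ≡ (a ℚ.- b) ℚ.+ (c ℚ.- d)
  regroup = solve 4 (λ a b c d → a :+ c :+ :- (b :+ d) := (a :+ :- b) :+ (c :+ :- d)) refl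
    where open +-*-Solver

Log-ι : ∀ a .{{_ : NonZero a}} .(p : 0ℚ ℚ.< ι a) → Log (ι a) p ≃ ℓ a
Log-ι a p = ≃-trans {Log (ι a) p} {ratio a 1} {ℓ a} (Log-fraction p (fraction-ι a))
  (≗⇒≃ (ratio a 1) (ℓ a) λ n → trans (cong (λ x → ℓ a n ℚ.- x) (ℓ-2^ 0 n)) (ℚₚ.+-identityʳ (ℓ a n)))

-- This bound and `Log≤` hold at every index without an error term, which makes the tail estimates
-- of the series uniform in n.
Log≥0 : ∀ {y} .(p : 0ℚ ℚ.< y) → 1ℚ ℚ.≤ y → ∀ n → 0ℚ ℚ.≤ Log y p n
Log≥0 {y} p 1≤y n =
  let (a , b , f , e) = fraction y p in subst (0ℚ ℚ.≤_) (sym (e n)) (p≤q⇒0≤q-p {ℓ b n} {ℓ a n} (ℓ-mono {b} {a} n (subst₂ ℕ._≤_ (ℕₚ.*-identityˡ b) (ℕₚ.*-identityʳ a)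
  (fraction-cross (fraction-ι 1) f 1≤y))))

Log≤ : ∀ {y} .(p : 0ℚ ℚ.< y) c → y ℚ.≤ ι (2 ℕ.^ c) → ∀ n → Log y p n ℚ.≤ ι c
Log≤ {y} p c y≤ n =
  let (a , b , f , e) = fraction y p in subst (ℚ._≤ ι c) (sym (e n)) (ℚₚ.≤-trans
  (ℚₚ.+-monoˡ-≤ (ℚ.- ℓ b n) {ℓ a n} {ι c ℚ.+ ℓ b n} (ℓ-2^* {a} c b {{a≢0 f}}
    (subst (ℕ._≤ 2 ℕ.^ c ℕ.* b) (ℕₚ.*-identityʳ a) (fraction-cross f (fraction-ι (2 ℕ.^ c) {{ℕₚ.m^n≢0 2 c}}) y≤)) n))
  (ℚₚ.≤-reflexive (solve 2 (λ c b → c :+ b :+ :- b := c) refl (ι c) (ℓ b n))))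
  where open +-*-Solver

-- The series for α

-- `h 0` = 0 has no logarithm; the default value 0 keeps the function total and its bounds valid.
logh : ℕ → ℕ → ℚ
logh zero    n = 0ℚ
logh (suc j) n = Log (h (suc j)) (h>0 (suc j)) n

logh-log₂ : ∀ j .{{_ : NonZero j}} .{{_ : Positive (h j)}} n → seq (log₂ (h j)) n ≡ logh j n
logh-log₂ (suc j) n = refl

logh≥0 : ∀ j n → 0ℚ ℚ.≤ logh j n
logh≥0 zero    n = ℚₚ.≤-refl
logh≥0 (suc j) n = Log≥0 (h>0 (suc j)) (h-mono-≤ {1} {suc j} (s≤s z≤n)) n

h-block : ∀ n k → h (n ℕ.+ k) ℚ.≤ h n ℚ.+ ι k ℚ.* (+ 1 / suc n)
h-block n zero = ℚₚ.≤-reflexive (trans (cong h (ℕₚ.+-identityʳ n))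
  (sym (trans (cong (h n ℚ.+_) (ℚₚ.*-zeroˡ (+ 1 / suc n))) (ℚₚ.+-identityʳ (h n)))))
h-block n (suc k) = begin
  h (n ℕ.+ suc k)                                          ≡⟨ cong h (ℕₚ.+-suc n k) ⟩
  h (n ℕ.+ k) ℚ.+ + 1 / suc (n ℕ.+ k)                      ≤⟨ ℚₚ.+-mono-≤ (h-block n k) (1/suc-antimono (ℕₚ.m≤m+n n k)) ⟩
  h n ℚ.+ ι k ℚ.* r ℚ.+ r                                  ≡⟨ solve 3 (λ h k r → h :+ k :* r :+ r := h :+ (con 1ℚ :+ k) :* r) refl (h n) (ι k) r ⟩
  h n ℚ.+ (1ℚ ℚ.+ ι k) ℚ.* r                               ≡⟨ cong (λ x → h n ℚ.+ x ℚ.* r) (ι-+ 1 k) ⟨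
  h n ℚ.+ ι (suc k) ℚ.* r                                  ∎
  where
  open ℚₚ.≤-Reasoning
  open +-*-Solver
  r = + 1 / suc n

2^-suc : ∀ i → 2 ℕ.^ i ≡ suc (2 ℕ.^ i ∸ 1)
2^-suc i = sym (ℕₚ.m+[n∸m]≡n (2^>0 i))

-- The new block has 2^i terms, each at most 1/2^i.
h-double : ∀ i → h (2 ℕ.^ suc i ∸ 1) ℚ.≤ h (2 ℕ.^ i ∸ 1) ℚ.+ 1ℚ
h-double i = begin
  h (2 ℕ.^ suc i ∸ 1)                                      ≡⟨ cong h eq ⟩
  h (K ℕ.+ suc K)                                          ≤⟨ h-block K (suc K) ⟩
  h K ℚ.+ ι (suc K) ℚ.* (+ 1 / suc K)                      ≡⟨ cong (h K ℚ.+_) (trans (ℚₚ.*-comm (ι (suc K)) (+ 1 / suc K)) (1/*ι (suc K))) ⟩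
  h K ℚ.+ 1ℚ                                               ∎
  where
  open ℚₚ.≤-Reasoning
  K = 2 ℕ.^ i ∸ 1
  eq : 2 ℕ.^ suc i ∸ 1 ≡ K ℕ.+ suc K
  eq = trans (cong (_∸ 1) (2^suc i)) (cong (λ m → m ℕ.+ m ∸ 1) (2^-suc i))

h-2^ : ∀ i → h (2 ℕ.^ i ∸ 1) ℚ.≤ ι i
h-2^ zero    = ℚₚ.≤-refl
h-2^ (suc i) = ℚₚ.≤-trans (h-double i) (ℚₚ.≤-trans (ℚₚ.+-monoˡ-≤ 1ℚ (h-2^ i))
  (ℚₚ.≤-reflexive (trans (ℚₚ.+-comm (ι i) 1ℚ) (sym (ι-+ 1 i)))))

n<2^n : ∀ n → n ℕ.< 2 ℕ.^ n
n<2^n zero    = s≤s z≤n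
n<2^n (suc n) = subst (suc n ℕ.<_) (sym (2^suc n)) (ℕₚ.+-mono-≤-< (2^>0 n) (n<2^n n))

-- Here h_j ≤ i + 1 ≤ 2^i. This crude bound suffices for a summable tail.
logh≤ : ∀ i {j} → j ℕ.< 2 ℕ.^ suc i → ∀ n → logh j n ℚ.≤ ι i
logh≤ i {zero}  p n = ι≥0 i
logh≤ i {suc j} p n = Log≤ (h>0 (suc j)) i (ℚₚ.≤-trans (h-mono-≤ (ℕₚ.pred-mono-≤ p))
  (ℚₚ.≤-trans (h-2^ (suc i)) (ι-mono-≤ (n<2^n i)))) n

w : ℕ → ℚ
w d = (+ 1 / (2 ℕ.^ d)) {{ℕₚ.m^n≢0 2 d}}

w*2^ : ∀ d → w d ℚ.* ι (2 ℕ.^ d) ≡ 1ℚ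
w*2^ d = 1/*ι (2 ℕ.^ d) {{ℕₚ.m^n≢0 2 d}}

w>0 : ∀ d → 0ℚ ℚ.< w d
w>0 d = ℚₚ.positive⁻¹ (w d) {{ℚₚ.normalize-pos 1 (2 ℕ.^ d) {{ℕₚ.m^n≢0 2 d}}}}

ι-2^suc : ∀ d → ι (2 ℕ.^ suc d) ≡ ι (2 ℕ.^ d) ℚ.+ ι (2 ℕ.^ d)
ι-2^suc d = trans (cong ι (2^suc d)) (ι-+ (2 ℕ.^ d) (2 ℕ.^ d))

w-halve : ∀ d → w d ≡ w (suc d) ℚ.+ w (suc d)
w-halve d = begin
  w d                                            ≡⟨ ℚₚ.*-identityʳ (w d) ⟨
  w d ℚ.* 1ℚ                                     ≡⟨ cong (w d ℚ.*_) (w*2^ (suc d)) ⟨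
  w d ℚ.* (w (suc d) ℚ.* ι (2 ℕ.^ suc d))        ≡⟨ cong (λ x → w d ℚ.* (w (suc d) ℚ.* x)) (ι-2^suc d) ⟩
  w d ℚ.* (w (suc d) ℚ.* (D ℚ.+ D))              ≡⟨ solve 3 (λ a b D → a :* (b :* (D :+ D)) := b :* (a :* D) :+ b :* (a :* D)) refl (w d) (w (suc d)) D ⟩
  w (suc d) ℚ.* (w d ℚ.* D) ℚ.+ w (suc d) ℚ.* (w d ℚ.* D)
    ≡⟨ cong (λ x → w (suc d) ℚ.* x ℚ.+ w (suc d) ℚ.* x) (w*2^ d) ⟩
  w (suc d) ℚ.* 1ℚ ℚ.+ w (suc d) ℚ.* 1ℚ          ≡⟨ cong (λ x → x ℚ.+ x) (ℚₚ.*-identityʳ (w (suc d))) ⟩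
  w (suc d) ℚ.+ w (suc d)                        ∎
  where
  open ≡-Reasoning
  open +-*-Solver
  D = ι (2 ℕ.^ d)

S : ℕ → ℕ → ℚ
S d = seq (partialSum αTerm d)

loghᴾ : ℕ → ℕ → ℚ
loghᴾ i = logh (2 ℕ.^ i ∸ 1)

2^suc∸1≢0 : ∀ d → NonZero (2 ℕ.^ suc d ∸ 1)
2^suc∸1≢0 d = ℕ.>-nonZero (ℕₚ.m<n⇒0<n∸m (ℕₚ.^-monoʳ-< 2 (s≤s (s≤s z≤n)) {0} {suc d} (s≤s z≤n)))

S-suc : ∀ d n → S (suc d) n ≡ S d n ℚ.+ w (suc d) ℚ.* loghᴾ (suc d) n
S-suc d n = cong (λ x → S d n ℚ.+ w (suc d) ℚ.* x)
  (logh-log₂ (2 ℕ.^ suc d ∸ 1) {{2^suc∸1≢0 d}} {{h[2^i-1]-pos (suc d)}} n)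

2^∸1< : ∀ d → 2 ℕ.^ d ∸ 1 ℕ.< 2 ℕ.^ d
2^∸1< d = ℕₚ.≤-reflexive (sym (2^-suc d))

loghᴾ≤ : ∀ d n → loghᴾ (suc d) n ℚ.≤ ι d
loghᴾ≤ d = logh≤ d (2^∸1< (suc d))

S-mono-suc : ∀ d n → S d n ℚ.≤ S (suc d) n
S-mono-suc d n = ℚₚ.≤-trans (p≤p+q (S d n) {w (suc d) ℚ.* loghᴾ (suc d) n}
    (ℚₚ.nonNegative⁻¹ (w (suc d) ℚ.* loghᴾ (suc d) n)
      {{ℚₚ.nonNeg*nonNeg⇒nonNeg (w (suc d)) {{ℚ.nonNegative (ℚₚ.<⇒≤ (w>0 (suc d)))}}
        (loghᴾ (suc d) n) {{ℚ.nonNegative (logh≥0 (2 ℕ.^ suc d ∸ 1) n)}}}}))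
  (ℚₚ.≤-reflexive (sym (S-suc d n)))

tail : ℕ → ℚ
tail d = ι (suc d) ℚ.* w d

-- Σ_{i > d} (i-1)/2^i = (d+1)/2^d, and log₂ h_{2^i-1} ≤ log₂ i ≤ i-1.
S+tail-antimono-suc : ∀ d n → S (suc d) n ℚ.+ tail (suc d) ℚ.≤ S d n ℚ.+ tail d
S+tail-antimono-suc d n = begin
  S (suc d) n ℚ.+ tail (suc d)                             ≡⟨ cong₂ ℚ._+_ (S-suc d n) (cong (ℚ._* W) (trans (ι-+ 2 d) (ℚₚ.+-comm (ι 2) (ι d)))) ⟩
  S d n ℚ.+ W ℚ.* loghᴾ (suc d) n ℚ.+ (ι d ℚ.+ ι 2) ℚ.* W
    ≤⟨ ℚₚ.+-monoˡ-≤ ((ι d ℚ.+ ι 2) ℚ.* W) (ℚₚ.+-monoʳ-≤ (S d n) (ℚₚ.*-monoˡ-≤-nonNeg W {{ℚ.nonNegative (ℚₚ.<⇒≤ (w>0 (suc d)))}} (loghᴾ≤ d n))) ⟩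
  S d n ℚ.+ W ℚ.* ι d ℚ.+ (ι d ℚ.+ ι 2) ℚ.* W              ≡⟨ solve 3 (λ s W d → s :+ W :* d :+ (d :+ con (ι 2)) :* W := s :+ (d :+ con 1ℚ) :* (W :+ W)) refl (S d n) W (ι d) ⟩
  S d n ℚ.+ (ι d ℚ.+ 1ℚ) ℚ.* (W ℚ.+ W)                     ≡⟨ cong₂ (λ x y → S d n ℚ.+ x ℚ.* y) (trans (ℚₚ.+-comm (ι d) 1ℚ) (sym (ι-+ 1 d))) (sym (w-halve d)) ⟩
  S d n ℚ.+ tail d                                         ∎
  where
  open ℚₚ.≤-Reasoning
  open +-*-Solver
  W = w (suc d)

S-mono : ∀ {c d} → c ℕ.≤ d → ∀ n → S c n ℚ.≤ S d n
S-mono {c} p n = go (ℕₚ.≤⇒≤′ p)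
  where
  go : ∀ {d} → c ℕ.≤′ d → S c n ℚ.≤ S d n
  go ℕ.≤′-refl         = ℚₚ.≤-refl
  go (ℕ.≤′-step {d} q) = ℚₚ.≤-trans (go q) (S-mono-suc d n)

S+tail-antimono : ∀ {c d} → c ℕ.≤ d → ∀ n → S d n ℚ.+ tail d ℚ.≤ S c n ℚ.+ tail c
S+tail-antimono {c} p n = go (ℕₚ.≤⇒≤′ p)
  where
  go : ∀ {d} → c ℕ.≤′ d → S d n ℚ.+ tail d ℚ.≤ S c n ℚ.+ tail c
  go ℕ.≤′-refl         = ℚₚ.≤-refl
  go (ℕ.≤′-step {d} q) = ℚₚ.≤-trans (S+tail-antimono-suc d n) (go q)

tail≥0 : ∀ d → 0ℚ ℚ.≤ tail d
tail≥0 d = ℚₚ.<⇒≤ (*-pos (ι>0 (suc d)) (w>0 d))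

S≤S+tail : ∀ {c d} → c ℕ.≤ d → ∀ n → S d n ℚ.≤ S c n ℚ.+ tail c
S≤S+tail {c} {d} p n = ℚₚ.≤-trans (p≤p+q (S d n) (tail≥0 d)) (S+tail-antimono p n)

-- The numerator is the total budget at height d: d(d+1) for the deviation of `Φ (CBT k)` from k
-- S_d, 1 for the number of internal vertices, d+1 for log₂ k and d+1 for the tail of the series.
error : ℕ → ℚ
error d = ι (d ℕ.* d ℕ.+ 3 ℕ.* d ℕ.+ 3) ℚ.* w d

tail≤error : ∀ d → tail d ℚ.≤ error d
tail≤error d = ℚₚ.*-monoʳ-≤-nonNeg (w d) {{ℚ.nonNegative (ℚₚ.<⇒≤ (w>0 d))}} (ι-mono-≤ (begin
  suc d                                 ≤⟨ ℕₚ.m≤m+n (suc d) (d ℕ.* d ℕ.+ 2 ℕ.* d ℕ.+ 2) ⟩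
  suc d ℕ.+ (d ℕ.* d ℕ.+ 2 ℕ.* d ℕ.+ 2) ≡⟨ regroup d ⟩
  d ℕ.* d ℕ.+ 3 ℕ.* d ℕ.+ 3             ∎))
  where
  open ℕₚ.≤-Reasoning
  regroup : ∀ d → suc d ℕ.+ (d ℕ.* d ℕ.+ 2 ℕ.* d ℕ.+ 2) ≡ d ℕ.* d ℕ.+ 3 ℕ.* d ℕ.+ 3
  regroup = ℕ-Tactic.solve-∀

-- The shift by 4 gives equality at 0 and makes the induction work at once, as (5/4)³ < 2. A cubic
-- bound turns the quadratic numerator of `error` into a rate of 1/(d+1).
[d+4]³≤ : ∀ d → (d ℕ.+ 4) ℕ.* (d ℕ.+ 4) ℕ.* (d ℕ.+ 4) ℕ.≤ 64 ℕ.* 2 ℕ.^ d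
[d+4]³≤ zero    = ℕₚ.≤-refl
[d+4]³≤ (suc d) = begin
  (suc d ℕ.+ 4) ℕ.* (suc d ℕ.+ 4) ℕ.* (suc d ℕ.+ 4)   ≤⟨ ℕₚ.m≤m+n _ (d ℕ.* d ℕ.* d ℕ.+ 9 ℕ.* (d ℕ.* d) ℕ.+ 21 ℕ.* d ℕ.+ 3) ⟩
  (suc d ℕ.+ 4) ℕ.* (suc d ℕ.+ 4) ℕ.* (suc d ℕ.+ 4) ℕ.+ (d ℕ.* d ℕ.* d ℕ.+ 9 ℕ.* (d ℕ.* d) ℕ.+ 21 ℕ.* d ℕ.+ 3)
                                                      ≡⟨ expand d ⟩
  2 ℕ.* ((d ℕ.+ 4) ℕ.* (d ℕ.+ 4) ℕ.* (d ℕ.+ 4))       ≤⟨ ℕₚ.*-monoʳ-≤ 2 ([d+4]³≤ d) ⟩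
  2 ℕ.* (64 ℕ.* 2 ℕ.^ d)                              ≡⟨ shift (2 ℕ.^ d) ⟩
  64 ℕ.* 2 ℕ.^ suc d                                  ∎
  where
  open ℕₚ.≤-Reasoning
  expand : ∀ d → (suc d ℕ.+ 4) ℕ.* (suc d ℕ.+ 4) ℕ.* (suc d ℕ.+ 4) ℕ.+ (d ℕ.* d ℕ.* d ℕ.+ 9 ℕ.* (d ℕ.* d) ℕ.+ 21 ℕ.* d ℕ.+ 3)
               ≡ 2 ℕ.* ((d ℕ.+ 4) ℕ.* (d ℕ.+ 4) ℕ.* (d ℕ.+ 4))
  expand = ℕ-Tactic.solve-∀
  shift : ∀ x → 2 ℕ.* (64 ℕ.* x) ≡ 64 ℕ.* (2 ℕ.* x)
  shift = ℕ-Tactic.solve-∀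

error≤ : ∀ d → error d ℚ.≤ ι 64 ℚ.* ε d
error≤ d = begin
  ι A ℚ.* w d                                      ≡⟨ ℚₚ.*-identityʳ (ι A ℚ.* w d) ⟨
  ι A ℚ.* w d ℚ.* 1ℚ                               ≡⟨ cong (ι A ℚ.* w d ℚ.*_) (1/*ι (suc d)) ⟨
  ι A ℚ.* w d ℚ.* (ε d ℚ.* ι (suc d))              ≡⟨ solve 4 (λ a w e s → a :* w :* (e :* s) := w :* e :* (a :* s)) refl (ι A) (w d) (ε d) (ι (suc d)) ⟩
  w d ℚ.* ε d ℚ.* (ι A ℚ.* ι (suc d))              ≡⟨ cong (w d ℚ.* ε d ℚ.*_) (ι-* A (suc d)) ⟨
  w d ℚ.* ε d ℚ.* ι (A ℕ.* suc d)                  ≤⟨ ℚₚ.*-monoˡ-≤-nonNeg (w d ℚ.* ε d) {{ℚ.nonNegative (ℚₚ.<⇒≤ (*-pos (w>0 d) (ε>0 d)))}} (ι-mono-≤ A≤) ⟩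
  w d ℚ.* ε d ℚ.* ι (64 ℕ.* 2 ℕ.^ d)               ≡⟨ cong (w d ℚ.* ε d ℚ.*_) (ι-* 64 (2 ℕ.^ d)) ⟩
  w d ℚ.* ε d ℚ.* (ι 64 ℚ.* ι (2 ℕ.^ d))           ≡⟨ solve 4 (λ w e c D → w :* e :* (c :* D) := c :* e :* (w :* D)) refl (w d) (ε d) (ι 64) (ι (2 ℕ.^ d)) ⟩
  ι 64 ℚ.* ε d ℚ.* (w d ℚ.* ι (2 ℕ.^ d))           ≡⟨ cong (ι 64 ℚ.* ε d ℚ.*_) (w*2^ d) ⟩
  ι 64 ℚ.* ε d ℚ.* 1ℚ                              ≡⟨ ℚₚ.*-identityʳ (ι 64 ℚ.* ε d) ⟩
  ι 64 ℚ.* ε d                                     ∎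
  where
  open ℚₚ.≤-Reasoning
  open +-*-Solver
  A = d ℕ.* d ℕ.+ 3 ℕ.* d ℕ.+ 3
  A≤ : A ℕ.* suc d ℕ.≤ 64 ℕ.* 2 ℕ.^ d
  A≤ = ℕₚ.≤-trans (ℕₚ.m≤m+n _ (8 ℕ.* (d ℕ.* d) ℕ.+ 42 ℕ.* d ℕ.+ 61)) (ℕₚ.≤-trans (ℕₚ.≤-reflexive (expand d)) ([d+4]³≤ d))
    where
    expand : ∀ d → (d ℕ.* d ℕ.+ 3 ℕ.* d ℕ.+ 3) ℕ.* suc d ℕ.+ (8 ℕ.* (d ℕ.* d) ℕ.+ 42 ℕ.* d ℕ.+ 61) ≡ (d ℕ.+ 4) ℕ.* (d ℕ.+ 4) ℕ.* (d ℕ.+ 4)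
    expand = ℕ-Tactic.solve-∀

error-small : ∀ δ → 0ℚ ℚ.< δ → ∃[ M ] (∀ d → M ℕ.≤ d → error d ℚ.≤ δ)
error-small δ 0<δ = proj₁ small , λ d M≤d → begin
  error d                            ≤⟨ error≤ d ⟩
  ι 64 ℚ.* ε d                       ≤⟨ ℚₚ.*-monoˡ-≤-nonNeg (ι 64) (1/suc-antimono M≤d) ⟩
  ι 64 ℚ.* ε (proj₁ small)           ≤⟨ ℚₚ.*-monoˡ-≤-nonNeg (ι 64) (proj₂ small) ⟩
  ι 64 ℚ.* (+ 1 / 64 ℚ.* δ)          ≡⟨ ℚₚ.*-assoc (ι 64) (+ 1 / 64) δ ⟨
  1ℚ ℚ.* δ                           ≡⟨ ℚₚ.*-identityˡ δ ⟩
  δ                                  ∎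
  where
  open ℚₚ.≤-Reasoning
  small : ∃[ M ] (ε M ℚ.≤ + 1 / 64 ℚ.* δ)
  small = archimedean (+ 1 / 64 ℚ.* δ) (*-pos {+ 1 / 64} {δ} (ℚₚ.positive⁻¹ (+ 1 / 64)) 0<δ)

private
  ∣∣-bounds : ∀ {a b δ} → a ℚ.≤ b → b ℚ.≤ a ℚ.+ δ → ℚ.∣ a ℚ.- b ∣ ℚ.≤ δ
  ∣∣-bounds {a} {b} {δ} a≤b b≤ with ℚₚ.∣p∣≡p∨∣p∣≡-p (a ℚ.- b)
  ... | inj₁ e = subst (ℚ._≤ δ) (sym e) (ℚₚ.≤-trans {a ℚ.- b} {0ℚ} {δ}
    (subst (a ℚ.- b ℚ.≤_) (ℚₚ.+-inverseʳ b) (ℚₚ.+-monoˡ-≤ (ℚ.- b) a≤b))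
    (subst₂ ℚ._≤_ (ℚₚ.+-inverseʳ b) (solve 3 (λ a b d → a :+ d :+ :- a := d) refl a b δ) (ℚₚ.≤-trans {b ℚ.- b} {b ℚ.- a} {a ℚ.+ δ ℚ.- a}
       (ℚₚ.+-monoʳ-≤ b (ℚₚ.neg-antimono-≤ a≤b)) (ℚₚ.+-monoˡ-≤ (ℚ.- a) b≤))))
    where open +-*-Solver
  ... | inj₂ e = subst (ℚ._≤ δ) (sym (trans e (solve 2 (λ a b → :- (a :+ :- b) := b :+ :- a) refl a b)))
    (subst (b ℚ.- a ℚ.≤_) (solve 2 (λ a d → a :+ d :+ :- a := d) refl a δ) (ℚₚ.+-monoˡ-≤ (ℚ.- a) b≤))
    where open +-*-Solver

  ∣-∣-comm : ∀ a b → ℚ.∣ a ℚ.- b ∣ ≡ ℚ.∣ b ℚ.- a ∣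
  ∣-∣-comm a b = trans (sym (ℚₚ.∣-p∣≡∣p∣ (a ℚ.- b))) (cong ℚ.∣_∣ (solve 2 (λ a b → :- (a :+ :- b) := b :+ :- a) refl a b))
    where open +-*-Solver

  ∣-∣-triangle : ∀ a b c → ℚ.∣ a ℚ.- c ∣ ℚ.≤ ℚ.∣ a ℚ.- b ∣ ℚ.+ ℚ.∣ b ℚ.- c ∣
  ∣-∣-triangle a b c = subst (λ x → ℚ.∣ x ∣ ℚ.≤ ℚ.∣ a ℚ.- b ∣ ℚ.+ ℚ.∣ b ℚ.- c ∣)
    (solve 3 (λ a b c → (a :+ :- b) :+ (b :+ :- c) := a :+ :- c) refl a b c) (ℚₚ.∣p+q∣≤∣p∣+∣q∣ (a ℚ.- b) (b ℚ.- c))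
    where open +-*-Solver

S-close : ∀ {c d} → c ℕ.≤ d → ∀ n → ℚ.∣ S c n ℚ.- S d n ∣ ℚ.≤ tail c
S-close {c} {d} p n = ∣∣-bounds {S c n} {S d n} {tail c} (S-mono p n) (S≤S+tail p n)

-- The diagonal of the partial sums. The Cauchy bound passes through a fixed partial sum `S M`: two
-- tails of at most δ/4 and a variation of `S M` below δ/2.
s : ℝ
s .seq n        = S n n
s .cauchy δ 0<δ = N ℕ.⊔ M , λ m n m≥ n≥ → begin-strict
    ℚ.∣ S m m ℚ.- S n n ∣
      ≤⟨ ∣-∣-triangle (S m m) (S M m) (S n n) ⟩
    ℚ.∣ S m m ℚ.- S M m ∣ ℚ.+ ℚ.∣ S M m ℚ.- S n n ∣
      ≤⟨ ℚₚ.+-monoʳ-≤ ℚ.∣ S m m ℚ.- S M m ∣ (∣-∣-triangle (S M m) (S M n) (S n n)) ⟩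
    ℚ.∣ S m m ℚ.- S M m ∣ ℚ.+ (ℚ.∣ S M m ℚ.- S M n ∣ ℚ.+ ℚ.∣ S M n ℚ.- S n n ∣)
      <⟨ ℚₚ.+-mono-≤-< (ℚₚ.≤-trans (ℚₚ.≤-reflexive (∣-∣-comm (S m m) (S M m))) (close m (ℕₚ.m⊔n≤o⇒n≤o N M m≥)))
           (ℚₚ.+-mono-<-≤ (N-cauchy m n (ℕₚ.m⊔n≤o⇒m≤o N M m≥) (ℕₚ.m⊔n≤o⇒m≤o N M n≥)) (close n (ℕₚ.m⊔n≤o⇒n≤o N M n≥))) ⟩
    δ/4 ℚ.+ (ℚ.½ ℚ.* δ ℚ.+ δ/4)
      ≡⟨ solve 1 (λ d → con (+ 1 / 4) :* d :+ (con ℚ.½ :* d :+ con (+ 1 / 4) :* d) := d) refl δ ⟩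
    δ ∎
  where
  open ℚₚ.≤-Reasoning
  open +-*-Solver
  δ/4 : ℚ
  δ/4 = + 1 / 4 ℚ.* δ
  small : ∃[ M ] (∀ d → M ℕ.≤ d → error d ℚ.≤ δ/4)
  small = error-small δ/4 (*-pos {+ 1 / 4} {δ} (ℚₚ.positive⁻¹ (+ 1 / 4)) 0<δ)
  M N : ℕ
  M = proj₁ small
  N = proj₁ (cauchy (partialSum αTerm M) (ℚ.½ ℚ.* δ) (half 0<δ))
  N-cauchy : ∀ m n → N ℕ.≤ m → N ℕ.≤ n → ℚ.∣ S M m ℚ.- S M n ∣ ℚ.< ℚ.½ ℚ.* δ
  N-cauchy = proj₂ (cauchy (partialSum αTerm M) (ℚ.½ ℚ.* δ) (half 0<δ))
  close : ∀ n → M ℕ.≤ n → ℚ.∣ S M n ℚ.- S n n ∣ ℚ.≤ δ/4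
  close n M≤n = ℚₚ.≤-trans (S-close M≤n n) (ℚₚ.≤-trans (tail≤error M) (proj₂ small M ℕₚ.≤-refl))

-- For n < d the diagonal has too few terms, but the missing ones amount to at most (n+1)/2^n ≤ 1 ≤
-- d/(n+1), which explains the constant `d`.
S≼s : ∀ d → S d ≼ seq s
S≼s d = bound (ι d) (ι≥0 d) (λ n → case n (ℕₚ.≤-<-connex d n))
  where
  case : ∀ n → d ℕ.≤ n ⊎ n ℕ.< d → S d n ℚ.≤ S n n ℚ.+ ι d ℚ.* ε n
  case n (inj₁ d≤n) = ℚₚ.≤-trans (S-mono d≤n n) (p≤p+q (S n n) {ι d ℚ.* ε n}
    (ℚₚ.nonNegative⁻¹ (ι d ℚ.* ε n) {{ℚₚ.nonNeg*nonNeg⇒nonNeg (ι d) {{ℚ.nonNegative (ι≥0 d)}} (ε n) {{ℚ.nonNegative (ℚₚ.<⇒≤ (ε>0 n))}}}}))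
  case n (inj₂ n<d) = ℚₚ.≤-trans (S≤S+tail (ℕₚ.<⇒≤ n<d) n) (ℚₚ.+-monoʳ-≤ (S n n) (begin
    ι (suc n) ℚ.* w n                ≤⟨ ℚₚ.*-monoʳ-≤-nonNeg (w n) {{ℚ.nonNegative (ℚₚ.<⇒≤ (w>0 n))}} (ι-mono-≤ (n<2^n n)) ⟩
    ι (2 ℕ.^ n) ℚ.* w n              ≡⟨ trans (ℚₚ.*-comm (ι (2 ℕ.^ n)) (w n)) (w*2^ n) ⟩
    1ℚ                               ≡⟨ trans (ℚₚ.*-comm (ι (suc n)) (ε n)) (1/*ι (suc n)) ⟨
    ι (suc n) ℚ.* ε n                ≤⟨ ℚₚ.*-monoʳ-≤-nonNeg (ε n) {{ℚ.nonNegative (ℚₚ.<⇒≤ (ε>0 n))}} (ι-mono-≤ n<d) ⟩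
    ι d ℚ.* ε n                      ∎))
    where open ℚₚ.≤-Reasoning

s≼S+tail : ∀ d → seq s ≼ (λ n → S d n ℚ.+ tail d)
s≼S+tail d = pointwise (seq s) (λ n → S d n ℚ.+ tail d) (λ n → case n (ℕₚ.≤-total d n))
  where
  case : ∀ n → d ℕ.≤ n ⊎ n ℕ.≤ d → S n n ℚ.≤ S d n ℚ.+ tail d
  case n (inj₁ d≤n) = S≤S+tail d≤n n
  case n (inj₂ n≤d) = ℚₚ.≤-trans (S-mono n≤d n) (p≤p+q (S d n) (tail≥0 d))

-- The other half of δ is the positive gap that `<ᴿ` asks for.
<ᴿ-from-bounds : ∀ x δ N → 0ℚ ℚ.< δ → (∀ n → N ℕ.≤ n → ℚ.- (ℚ.½ ℚ.* δ) ℚ.≤ seq x n) →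
                 (∀ n → N ℕ.≤ n → seq x n ℚ.≤ ℚ.½ ℚ.* δ) →
                 (fromℚ (ℚ.- δ) <ᴿ x) × (x <ᴿ fromℚ δ)
<ᴿ-from-bounds x δ N 0<δ lo hi =
  (ℚ.½ ℚ.* δ , half 0<δ , N , λ n N≤n → ℚₚ.≤-trans (ℚₚ.≤-reflexive (solve 1 (λ d → :- d :+ con ℚ.½ :* d := :- (con ℚ.½ :* d)) refl δ)) (lo n N≤n)) ,
  (ℚ.½ ℚ.* δ , half 0<δ , N , λ n N≤n → ℚₚ.≤-trans (ℚₚ.+-monoˡ-≤ (ℚ.½ ℚ.* δ) (hi n N≤n)) (ℚₚ.≤-reflexive (half+half δ)))
  where open +-*-Solver

-- From index m on, the m-th partial sum and the diagonal differ by at most `tail m`, so m itself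
-- serves as the threshold.
αTerm-sumsTo-s : αTerm SumsTo s
αTerm-sumsTo-s δ 0<δ = M , λ m M≤m →
  <ᴿ-from-bounds (partialSum αTerm m -ᴿ s) δ m 0<δ
    (λ n m≤n → subst₂ ℚ._≤_ (solve 2 (λ a t → a :+ (:- a :+ :- t) := :- t) refl (S n n) (ℚ.½ ℚ.* δ))
       (solve 3 (λ a b t → b :+ t :+ (:- a :+ :- t) := b :+ con (ℚ.- 1ℚ) :* a) refl (S n n) (S m n) (ℚ.½ ℚ.* δ))
       (ℚₚ.+-monoˡ-≤ (ℚ.- S n n ℚ.- ℚ.½ ℚ.* δ) (ℚₚ.≤-trans (S≤S+tail m≤n n) (ℚₚ.+-monoʳ-≤ (S m n) (ℚₚ.≤-trans (tail≤error m) (proj₂ small m M≤m))))))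
    (λ n m≤n → ℚₚ.≤-trans {S m n ℚ.+ ℚ.- 1ℚ ℚ.* S n n} {0ℚ} {ℚ.½ ℚ.* δ}
       (subst₂ ℚ._≤_ (cong (S m n ℚ.+_) (solve 1 (λ a → :- a := con (ℚ.- 1ℚ) :* a) refl (S n n))) (ℚₚ.+-inverseʳ (S n n))
         (ℚₚ.+-monoˡ-≤ (ℚ.- S n n) (S-mono m≤n n)))
       (ℚₚ.<⇒≤ (half 0<δ)))
  where
  open +-*-Solver
  small : ∃[ M ] (∀ d → M ℕ.≤ d → error d ℚ.≤ ℚ.½ ℚ.* δ)
  small = error-small (ℚ.½ ℚ.* δ) (half 0<δ)
  M : ℕ
  M = proj₁ small

-- Asymptotics of the maximal probability

Φ : Tree → ℕ → ℚ
Φ leaf       n = 0ℚ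
Φ (node l r) n = logh (ℕ.pred (size l ℕ.+ size r)) n ℚ.+ (Φ l n ℚ.+ Φ r n)

Log-toll : ∀ m (p : 2 ℕ.≤ m) → Log (toll m) (toll>0 p) ≃ (λ n → 1ℚ ℚ.+ logh (ℕ.pred m) n)
Log-toll (suc zero)    (s≤s ())
Log-toll (suc (suc j)) p = ≃-trans {Log (toll (suc (suc j))) (toll>0 p)} {λ n → Log (ι 2) (ι>0 2) n ℚ.+ logh (suc j) n} {λ n → 1ℚ ℚ.+ logh (suc j) n}
  (Log-* {ι 2} {h (suc j)} (ι>0 2) (h>0 (suc j)) (toll>0 p))
  (≃-+ {Log (ι 2) (ι>0 2)} {λ _ → 1ℚ} {logh (suc j)} {logh (suc j)}
    (≃-trans {Log (ι 2) (ι>0 2)} {ℓ 2} {λ _ → 1ℚ} (Log-ι 2 (ι>0 2)) (≗⇒≃ (ℓ 2) (λ _ → 1ℚ) (ℓ-2^ 1))) ≃-refl)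

-- Each of the `size T - 1` internal vertices contributes log₂ 2 = 1 besides its share of `Φ`.
Log-X : ∀ T → Log (X T) (X>0 T) ≃ (λ n → ι (size T) ℚ.- 1ℚ ℚ.+ Φ T n)
Log-X leaf       = ≃-trans {Log (X leaf) (X>0 leaf)} {ℓ 1} {λ n → 0ℚ} (Log-ι 1 (X>0 leaf)) (≗⇒≃ (ℓ 1) (λ _ → 0ℚ) (ℓ-2^ 0))
Log-X (node l r) =
  ≃-trans {Log (X (node l r)) (X>0 (node l r))} {λ n → Log t t>0 n ℚ.+ Log (X l ℚ.* X r) lr>0 n} {target}
    (Log-* {t} {X l ℚ.* X r} t>0 lr>0 (X>0 (node l r)))
  (≃-trans {λ n → Log t t>0 n ℚ.+ Log (X l ℚ.* X r) lr>0 n} {λ n → 1ℚ ℚ.+ lh n ℚ.+ (L n ℚ.+ R n)} {target}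
    (≃-+ {Log t t>0} {λ n → 1ℚ ℚ.+ lh n} {Log (X l ℚ.* X r) lr>0} {λ n → L n ℚ.+ R n}
      (Log-toll (size l ℕ.+ size r) 2≤)
      (≃-trans {Log (X l ℚ.* X r) lr>0} {λ n → Log (X l) (X>0 l) n ℚ.+ Log (X r) (X>0 r) n} {λ n → L n ℚ.+ R n}
        (Log-* {X l} {X r} (X>0 l) (X>0 r) lr>0)
        (≃-+ {Log (X l) (X>0 l)} {L} {Log (X r) (X>0 r)} {R} (Log-X l) (Log-X r))))
    (≗⇒≃ (λ n → 1ℚ ℚ.+ lh n ℚ.+ (L n ℚ.+ R n)) target λ n → trans
      (regroup (lh n) (ι (size l)) (Φ l n) (ι (size r)) (Φ r n))
      (cong (λ m → m ℚ.- 1ℚ ℚ.+ (lh n ℚ.+ (Φ l n ℚ.+ Φ r n))) (sym (ι-+ (size l) (size r))))))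
  where
  2≤ : 2 ℕ.≤ size l ℕ.+ size r
  2≤ = ℕₚ.+-mono-≤ (size>0 l) (size>0 r)
  t : ℚ
  t = toll (size l ℕ.+ size r)
  t>0 : 0ℚ ℚ.< t
  t>0 = toll>0 2≤
  lr>0 : 0ℚ ℚ.< X l ℚ.* X r
  lr>0 = *-pos (X>0 l) (X>0 r)
  lh L R target : ℕ → ℚ
  lh = logh (ℕ.pred (size l ℕ.+ size r))
  L n = ι (size l) ℚ.- 1ℚ ℚ.+ Φ l n
  R n = ι (size r) ℚ.- 1ℚ ℚ.+ Φ r n
  target n = ι (size (node l r)) ℚ.- 1ℚ ℚ.+ Φ (node l r) n
  regroup : ∀ h a u b v → 1ℚ ℚ.+ h ℚ.+ ((a ℚ.- 1ℚ ℚ.+ u) ℚ.+ (b ℚ.- 1ℚ ℚ.+ v)) ≡ a ℚ.+ b ℚ.- 1ℚ ℚ.+ (h ℚ.+ (u ℚ.+ v))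
  regroup = solve 5 (λ h a u b v → con 1ℚ :+ h :+ ((a :+ :- con 1ℚ :+ u) :+ (b :+ :- con 1ℚ :+ v)) := a :+ b :+ :- con 1ℚ :+ (h :+ (u :+ v))) refl
    where open +-*-Solver

-- Φ (CBT k) = k S d + O(d²) for d = ⌊log₂ k⌋: each level but for one subtree consists of
-- perfect trees, and those account for k S d.
module _ (n : ℕ) where
  private
    G : ℕ → ℕ → ℚ
    G d r = Φ (filled d r) n
    σ : ℕ → ℚ
    σ d = S d n

  Φ-filled-suc : ∀ d {r} → r ℕ.≤ 2 ℕ.^ suc d →
    G (suc d) r ≡ logh (ℕ.pred (2 ℕ.^ suc d ℕ.+ r)) n ℚ.+ (G d (r ⊓ 2 ℕ.^ d) ℚ.+ G d (r ∸ 2 ℕ.^ d))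
  Φ-filled-suc d {r} p = cong (λ m → logh (ℕ.pred m) n ℚ.+ (G d (r ⊓ 2 ℕ.^ d) ℚ.+ G d (r ∸ 2 ℕ.^ d))) (size-filled (suc d) r p)

  2^*S-suc : ∀ d → ι (2 ℕ.^ suc d) ℚ.* σ (suc d) ≡ ι (2 ℕ.^ suc d) ℚ.* σ d ℚ.+ loghᴾ (suc d) n
  2^*S-suc d = begin
    K ℚ.* σ (suc d)                               ≡⟨ cong (K ℚ.*_) (S-suc d n) ⟩
    K ℚ.* (σ d ℚ.+ w (suc d) ℚ.* lam)             ≡⟨ solve 4 (λ K s w l → K :* (s :+ w :* l) := K :* s :+ (w :* K) :* l) refl K (σ d) (w (suc d)) lam ⟩
    K ℚ.* σ d ℚ.+ (w (suc d) ℚ.* K) ℚ.* lam       ≡⟨ cong (λ x → K ℚ.* σ d ℚ.+ x ℚ.* lam) (w*2^ (suc d)) ⟩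
    K ℚ.* σ d ℚ.+ 1ℚ ℚ.* lam                      ≡⟨ cong (K ℚ.* σ d ℚ.+_) (ℚₚ.*-identityˡ lam) ⟩
    K ℚ.* σ d ℚ.+ lam                             ∎
    where
    open ≡-Reasoning
    open +-*-Solver
    K lam : ℚ
    K = ι (2 ℕ.^ suc d)
    lam = loghᴾ (suc d) n

  -- A perfect tree of height d has 2^(d-i) subtrees with 2^i leaves, so the sum of their logarithms
  -- is 2^d S_d, exactly at each index n.
  Φ-perfect : ∀ d → G d 0 ≡ ι (2 ℕ.^ d) ℚ.* σ d
  Φ-perfect zero    = refl
  Φ-perfect (suc d) = begin
    G (suc d) 0                                   ≡⟨ Φ-filled-suc d {0} z≤n ⟩
    logh (ℕ.pred (2 ℕ.^ suc d ℕ.+ 0)) n ℚ.+ (G d (0 ⊓ 2 ℕ.^ d) ℚ.+ G d (0 ∸ 2 ℕ.^ d))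
      ≡⟨ cong₂ (λ a b → logh (ℕ.pred a) n ℚ.+ (G d 0 ℚ.+ G d b)) (ℕₚ.+-identityʳ (2 ℕ.^ suc d)) (ℕₚ.0∸n≡0 (2 ℕ.^ d)) ⟩
    lam ℚ.+ (G d 0 ℚ.+ G d 0)                     ≡⟨ cong (λ x → lam ℚ.+ (x ℚ.+ x)) (Φ-perfect d) ⟩
    lam ℚ.+ (D ℚ.* σ d ℚ.+ D ℚ.* σ d)             ≡⟨ solve 3 (λ l D s → l :+ (D :* s :+ D :* s) := (D :+ D) :* s :+ l) refl lam D (σ d) ⟩
    (D ℚ.+ D) ℚ.* σ d ℚ.+ lam                     ≡⟨ cong (λ x → x ℚ.* σ d ℚ.+ lam) (ι-2^suc d) ⟨
    ι (2 ℕ.^ suc d) ℚ.* σ d ℚ.+ lam               ≡⟨ 2^*S-suc d ⟨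
    ι (2 ℕ.^ suc d) ℚ.* σ (suc d)                 ∎
    where
    open ≡-Reasoning
    open +-*-Solver
    D lam : ℚ
    D = ι (2 ℕ.^ d)
    lam = loghᴾ (suc d) n

  -- The allowance grows by 2(d+1) from height d to d+1, twice a bound for any single logarithm at
  -- that level.
  Near : ℕ → ℕ → Set
  Near d r = G d r ℚ.≤ ι (2 ℕ.^ d ℕ.+ r) ℚ.* σ d ℚ.+ ι (d ℕ.* suc d)
           × ι (2 ℕ.^ d ℕ.+ r) ℚ.* σ d ℚ.≤ G d r ℚ.+ ι (d ℕ.* suc d)

  -- One induction step for both positions of the last row. `lam′` is the share of the root of the
  -- left subtree when that subtree is perfect of height `suc d`, and 0 otherwise; `x` is the
  -- remainder of the two subtrees, comparable with S_d.
  module _ (d r : ℕ) (r≤ : r ℕ.≤ 2 ℕ.^ suc d) (x e lam′ : ℚ) (0≤lam′ : 0ℚ ℚ.≤ lam′) (lam′≤ : lam′ ℚ.≤ loghᴾ (suc d) n)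
           (G≡ : G (suc d) r ≡ logh (ℕ.pred (2 ℕ.^ suc d ℕ.+ r)) n ℚ.+ (lam′ ℚ.+ x))
           (x≤ : x ℚ.≤ ι (2 ℕ.^ suc d ℕ.+ r) ℚ.* σ d ℚ.+ e) (≤x : ι (2 ℕ.^ suc d ℕ.+ r) ℚ.* σ d ℚ.≤ x ℚ.+ e) where
    private
      K ρ W lam mu base target : ℚ
      K = ι (2 ℕ.^ suc d)
      ρ = ι r
      W = w (suc d)
      lam = loghᴾ (suc d) n
      mu = logh (ℕ.pred (2 ℕ.^ suc d ℕ.+ r)) n
      base = ι (2 ℕ.^ suc d ℕ.+ r) ℚ.* σ d
      target = ι (2 ℕ.^ suc d ℕ.+ r) ℚ.* σ (suc d)
      lam≥0 : 0ℚ ℚ.≤ lam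
      lam≥0 = logh≥0 (2 ℕ.^ suc d ∸ 1) n
      lam≤ : lam ℚ.≤ ι (suc d)
      lam≤ = ℚₚ.≤-trans (loghᴾ≤ d n) (ι-mono-≤ (ℕₚ.n≤1+n d))
      mu≥0 : 0ℚ ℚ.≤ mu
      mu≥0 = logh≥0 (ℕ.pred (2 ℕ.^ suc d ℕ.+ r)) n
      mu≤ : mu ℚ.≤ ι (suc d)
      mu≤ = logh≤ (suc d) (ℕₚ.<-≤-trans (pred< (ℕₚ.≤-trans (2^>0 (suc d)) (ℕₚ.m≤m+n (2 ℕ.^ suc d) r)))
        (subst (2 ℕ.^ suc d ℕ.+ r ℕ.≤_) (sym (2^suc (suc d))) (ℕₚ.+-monoʳ-≤ (2 ℕ.^ suc d) r≤))) n
        where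
        pred< : ∀ {m} → 1 ℕ.≤ m → ℕ.pred m ℕ.< m
        pred< (s≤s _) = ℕₚ.≤-refl
      ρW≤1 : W ℚ.* ρ ℚ.≤ 1ℚ
      ρW≤1 = ℚₚ.≤-trans (ℚₚ.*-monoˡ-≤-nonNeg W {{ℚ.nonNegative (ℚₚ.<⇒≤ (w>0 (suc d)))}} (ι-mono-≤ r≤)) (ℚₚ.≤-reflexive (w*2^ (suc d)))
      ρWlam≥0 : 0ℚ ℚ.≤ W ℚ.* ρ ℚ.* lam
      ρWlam≥0 = ℚₚ.nonNegative⁻¹ (W ℚ.* ρ ℚ.* lam) {{ℚₚ.nonNeg*nonNeg⇒nonNeg (W ℚ.* ρ)
        {{ℚₚ.nonNeg*nonNeg⇒nonNeg W {{ℚ.nonNegative (ℚₚ.<⇒≤ (w>0 (suc d)))}} ρ {{ℚ.nonNegative (ι≥0 r)}}}} lam {{ℚ.nonNegative lam≥0}}}}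
      ρWlam≤ : W ℚ.* ρ ℚ.* lam ℚ.≤ lam
      ρWlam≤ = ℚₚ.≤-trans (ℚₚ.*-monoʳ-≤-nonNeg lam {{ℚ.nonNegative lam≥0}} ρW≤1) (ℚₚ.≤-reflexive (ℚₚ.*-identityˡ lam))
      target≡ : target ≡ base ℚ.+ (lam ℚ.+ W ℚ.* ρ ℚ.* lam)
      target≡ = begin
        ι (2 ℕ.^ suc d ℕ.+ r) ℚ.* σ (suc d)           ≡⟨ cong (ℚ._* σ (suc d)) (ι-+ (2 ℕ.^ suc d) r) ⟩
        (K ℚ.+ ρ) ℚ.* σ (suc d)                       ≡⟨ ℚₚ.*-distribʳ-+ (σ (suc d)) K ρ ⟩
        K ℚ.* σ (suc d) ℚ.+ ρ ℚ.* σ (suc d)           ≡⟨ cong₂ (λ a b → a ℚ.+ ρ ℚ.* b) (2^*S-suc d) (S-suc d n) ⟩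
        K ℚ.* σ d ℚ.+ lam ℚ.+ ρ ℚ.* (σ d ℚ.+ W ℚ.* lam)
          ≡⟨ solve 5 (λ K s l p W → K :* s :+ l :+ p :* (s :+ W :* l) := (K :+ p) :* s :+ (l :+ W :* p :* l)) refl K (σ d) lam ρ W ⟩
        (K ℚ.+ ρ) ℚ.* σ d ℚ.+ (lam ℚ.+ W ℚ.* ρ ℚ.* lam) ≡⟨ cong (λ a → a ℚ.* σ d ℚ.+ (lam ℚ.+ W ℚ.* ρ ℚ.* lam)) (ι-+ (2 ℕ.^ suc d) r) ⟨
        base ℚ.+ (lam ℚ.+ W ℚ.* ρ ℚ.* lam)            ∎
        where
        open ≡-Reasoning
        open +-*-Solver

    near-upper : G (suc d) r ℚ.≤ target ℚ.+ (e ℚ.+ (ι (suc d) ℚ.+ ι (suc d)))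
    near-upper = begin
      G (suc d) r                                           ≡⟨ G≡ ⟩
      mu ℚ.+ (lam′ ℚ.+ x)                                   ≤⟨ ℚₚ.+-mono-≤ mu≤ (ℚₚ.+-mono-≤ lam′≤ x≤) ⟩
      D ℚ.+ (lam ℚ.+ (base ℚ.+ e))                          ≤⟨ p≤p+q (D ℚ.+ (lam ℚ.+ (base ℚ.+ e))) {W ℚ.* ρ ℚ.* lam ℚ.+ D} (ℚₚ.+-mono-≤ ρWlam≥0 (ι≥0 (suc d))) ⟩
      D ℚ.+ (lam ℚ.+ (base ℚ.+ e)) ℚ.+ (W ℚ.* ρ ℚ.* lam ℚ.+ D)
        ≡⟨ solve 5 (λ D l b e y → D :+ (l :+ (b :+ e)) :+ (y :+ D) := b :+ (l :+ y) :+ (e :+ (D :+ D))) refl D lam base e (W ℚ.* ρ ℚ.* lam) ⟩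
      base ℚ.+ (lam ℚ.+ W ℚ.* ρ ℚ.* lam) ℚ.+ (e ℚ.+ (D ℚ.+ D)) ≡⟨ cong (ℚ._+ (e ℚ.+ (D ℚ.+ D))) target≡ ⟨
      target ℚ.+ (e ℚ.+ (D ℚ.+ D))                          ∎
      where
      open ℚₚ.≤-Reasoning
      open +-*-Solver
      D : ℚ
      D = ι (suc d)

    near-lower : target ℚ.≤ G (suc d) r ℚ.+ (e ℚ.+ (ι (suc d) ℚ.+ ι (suc d)))
    near-lower = begin
      target                                                ≡⟨ target≡ ⟩
      base ℚ.+ (lam ℚ.+ W ℚ.* ρ ℚ.* lam)                    ≤⟨ ℚₚ.+-mono-≤ ≤x (ℚₚ.+-mono-≤ lam≤ (ℚₚ.≤-trans ρWlam≤ lam≤)) ⟩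
      x ℚ.+ e ℚ.+ (D ℚ.+ D)                                 ≤⟨ p≤p+q (x ℚ.+ e ℚ.+ (D ℚ.+ D)) {mu ℚ.+ lam′} (ℚₚ.+-mono-≤ mu≥0 0≤lam′) ⟩
      x ℚ.+ e ℚ.+ (D ℚ.+ D) ℚ.+ (mu ℚ.+ lam′)
        ≡⟨ solve 5 (λ x e D m l → x :+ e :+ (D :+ D) :+ (m :+ l) := m :+ (l :+ x) :+ (e :+ (D :+ D))) refl x e D mu lam′ ⟩
      mu ℚ.+ (lam′ ℚ.+ x) ℚ.+ (e ℚ.+ (D ℚ.+ D))             ≡⟨ cong (ℚ._+ (e ℚ.+ (D ℚ.+ D))) G≡ ⟨
      G (suc d) r ℚ.+ (e ℚ.+ (D ℚ.+ D))                     ∎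
      where
      open ℚₚ.≤-Reasoning
      open +-*-Solver
      D : ℚ
      D = ι (suc d)

    near-suc : e ≡ ι (d ℕ.* suc d) → Near (suc d) r
    near-suc e≡ = subst (λ b → G (suc d) r ℚ.≤ target ℚ.+ b) eq near-upper , subst (λ b → target ℚ.≤ G (suc d) r ℚ.+ b) eq near-lower
      where
      expand : ∀ d → d ℕ.* suc d ℕ.+ (suc d ℕ.+ suc d) ≡ suc d ℕ.* suc (suc d)
      expand = ℕ-Tactic.solve-∀
      eq : e ℚ.+ (ι (suc d) ℚ.+ ι (suc d)) ≡ ι (suc d ℕ.* suc (suc d))
      eq = trans (cong₂ ℚ._+_ e≡ (sym (ι-+ (suc d) (suc d)))) (trans (sym (ι-+ (d ℕ.* suc d) (suc d ℕ.+ suc d))) (cong ι (expand d)))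

  Φ-filled-near : ∀ d r → r ℕ.≤ 2 ℕ.^ d → Near d r
  Φ-filled-near zero r r≤ = subst (λ g → g ℚ.≤ ι (1 ℕ.+ r) ℚ.* 0ℚ ℚ.+ 0ℚ × ι (1 ℕ.+ r) ℚ.* 0ℚ ℚ.≤ g ℚ.+ 0ℚ) (sym (G0 r r≤))
    (ℚₚ.≤-reflexive (sym eq) , ℚₚ.≤-reflexive (trans (sym (ℚₚ.+-identityʳ (ι (1 ℕ.+ r) ℚ.* 0ℚ))) eq))
    where
    eq : ι (1 ℕ.+ r) ℚ.* 0ℚ ℚ.+ 0ℚ ≡ 0ℚ
    eq = trans (ℚₚ.+-identityʳ (ι (1 ℕ.+ r) ℚ.* 0ℚ)) (ℚₚ.*-zeroʳ (ι (1 ℕ.+ r)))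
    G0 : ∀ r → r ℕ.≤ 1 → G 0 r ≡ 0ℚ
    G0 zero          _         = refl
    G0 (suc zero)    _         = trans (ℚₚ.+-identityʳ (logh 1 n)) (ℚₚ.≤-antisym (logh≤ 0 (s≤s (s≤s z≤n)) n) (logh≥0 1 n))
    G0 (suc (suc r)) (s≤s ())
  Φ-filled-near (suc d) r r≤ = case (ℕₚ.≤-total r (2 ℕ.^ d))
    where
    D K e : ℚ
    D = ι (2 ℕ.^ d)
    K = ι (2 ℕ.^ suc d)
    e = ι (d ℕ.* suc d)
    lam = loghᴾ (suc d) n
    mu = logh (ℕ.pred (2 ℕ.^ suc d ℕ.+ r)) n
    case : r ℕ.≤ 2 ℕ.^ d ⊎ 2 ℕ.^ d ℕ.≤ r → Near (suc d) r
    case (inj₁ r≤D) = near-suc d r r≤ (G d r ℚ.+ D ℚ.* σ d) e 0ℚ ℚₚ.≤-refl (logh≥0 (2 ℕ.^ suc d ∸ 1) n)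
      (trans (Φ-filled-suc d r≤) (cong (mu ℚ.+_) (trans (cong₂ (λ a b → G d a ℚ.+ G d b) (ℕₚ.m≤n⇒m⊓n≡m r≤D) (ℕₚ.m≤n⇒m∸n≡0 r≤D))
        (trans (cong (G d r ℚ.+_) (Φ-perfect d)) (sym (ℚₚ.+-identityˡ (G d r ℚ.+ D ℚ.* σ d)))))))
      (ℚₚ.≤-trans (ℚₚ.+-monoˡ-≤ (D ℚ.* σ d) (proj₁ ih)) (ℚₚ.≤-reflexive (trans (swap-last y e (D ℚ.* σ d)) (cong (ℚ._+ e) split-base))))
      (ℚₚ.≤-trans (ℚₚ.≤-reflexive (sym split-base)) (ℚₚ.≤-trans (ℚₚ.+-monoˡ-≤ (D ℚ.* σ d) (proj₂ ih)) (ℚₚ.≤-reflexive (swap-last (G d r) e (D ℚ.* σ d)))))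
      refl
      where
      ih : Near d r
      ih = Φ-filled-near d r r≤D
      y : ℚ
      y = ι (2 ℕ.^ d ℕ.+ r) ℚ.* σ d
      swap-last : ∀ a b c → a ℚ.+ b ℚ.+ c ≡ a ℚ.+ c ℚ.+ b
      swap-last = solve 3 (λ a b c → a :+ b :+ c := a :+ c :+ b) refl
        where open +-*-Solver
      split-base : y ℚ.+ D ℚ.* σ d ≡ ι (2 ℕ.^ suc d ℕ.+ r) ℚ.* σ d
      split-base = trans (sym (ℚₚ.*-distribʳ-+ (σ d) (ι (2 ℕ.^ d ℕ.+ r)) D)) (cong (ℚ._* σ d)
        (trans (sym (ι-+ (2 ℕ.^ d ℕ.+ r) (2 ℕ.^ d))) (cong ι (trans (regroup (2 ℕ.^ d) r) (cong (ℕ._+ r) (sym (2^suc d)))))))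
        where
        regroup : ∀ a b → a ℕ.+ b ℕ.+ a ≡ a ℕ.+ a ℕ.+ b
        regroup = ℕ-Tactic.solve-∀
    case (inj₂ D≤r) = near-suc d r r≤ (K ℚ.* σ d ℚ.+ G d u) e lam (logh≥0 (2 ℕ.^ suc d ∸ 1) n) ℚₚ.≤-refl
      (trans (Φ-filled-suc d r≤) (cong (mu ℚ.+_) (trans (cong (λ a → G d a ℚ.+ G d u) (ℕₚ.m≥n⇒m⊓n≡n D≤r))
        (trans (cong (ℚ._+ G d u) (trans (cong (λ T → Φ T n) (filled-full d)) (trans (Φ-perfect (suc d)) (2^*S-suc d))))
          (regroup₃ (K ℚ.* σ d) lam (G d u))))))
      (ℚₚ.≤-trans (ℚₚ.+-monoʳ-≤ (K ℚ.* σ d) (proj₁ ih)) (ℚₚ.≤-reflexive (trans (sym (ℚₚ.+-assoc (K ℚ.* σ d) y e)) (cong (ℚ._+ e) split-base))))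
      (ℚₚ.≤-trans (ℚₚ.≤-reflexive (sym split-base)) (ℚₚ.≤-trans (ℚₚ.+-monoʳ-≤ (K ℚ.* σ d) (proj₂ ih)) (ℚₚ.≤-reflexive (sym (ℚₚ.+-assoc (K ℚ.* σ d) (G d u) e)))))
      refl
      where
      u : ℕ
      u = r ∸ 2 ℕ.^ d
      ih : Near d u
      ih = Φ-filled-near d u (∸≤ d r≤)
      y : ℚ
      y = ι (2 ℕ.^ d ℕ.+ u) ℚ.* σ d
      regroup₃ : ∀ a b c → a ℚ.+ b ℚ.+ c ≡ b ℚ.+ (a ℚ.+ c)
      regroup₃ = solve 3 (λ a b c → a :+ b :+ c := b :+ (a :+ c)) refl
        where open +-*-Solver
      split-base : K ℚ.* σ d ℚ.+ y ≡ ι (2 ℕ.^ suc d ℕ.+ r) ℚ.* σ d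
      split-base = trans (sym (ℚₚ.*-distribʳ-+ (σ d) K (ι (2 ℕ.^ d ℕ.+ u)))) (cong (ℚ._* σ d)
        (trans (sym (ι-+ (2 ℕ.^ suc d) (2 ℕ.^ d ℕ.+ u))) (cong (λ m → ι (2 ℕ.^ suc d ℕ.+ m)) (ℕₚ.m+[n∸m]≡n D≤r))))

-- The remainder term in the exponent and its limit

α : ℝ
α = fromℚ 1ℚ +ᴿ s

ℙ-CBT : ∀ k .{{_ : NonZero k}} → ℚ
ℙ-CBT k = ℙ[ DTCS k ≡ CBT k ]

ℙ-CBT>0 : ∀ k .{{_ : NonZero k}} → 0ℚ ℚ.< ℙ-CBT k
ℙ-CBT>0 k = ℙ-DTCS>0 (CBT k) k (CBT-size k)

-- The value at 0 is junk.
o : ℕ → ℝ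
o zero      = fromℚ 0ℚ
o k@(suc _) = (ℚ.- (+ 1 / k)) ⋆ log₂ (ℙ-CBT k) {{ℚ.positive (ℙ-CBT>0 k)}} -ᴿ α

2^≐-cong : ∀ {x y} p → (∀ n → seq x n ≡ seq y n) → 2^ x ≐ p → 2^ y ≐ p
2^≐-cong {x} {y} p e (0<p , f) = 0<p , λ a d →
  (λ { (δ , 0<δ , N , g) → proj₁ (f a d) (δ , 0<δ , N , λ n N≤n → subst (a / d ℚ.+ δ ℚ.≤_) (sym (e n)) (g n N≤n)) }) ,
  (λ { (δ , 0<δ , N , g) → proj₂ (f a d) (δ , 0<δ , N , λ n N≤n → subst (λ z → z ℚ.+ δ ℚ.≤ a / d) (sym (e n)) (g n N≤n)) })

-- By the choice of `o` the exponent agrees with `log₂` of the probability at every index, so only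
-- the correctness of `log₂` remains. All asymptotic content lies in `o⟶0`.
2^-k[α+o]≐ℙ : ∀ k .{{_ : NonZero k}} → 2^ (- (+ k / 1)) ⋆ (α +ᴿ o k) ≐ ℙ[ DTCS k ≡ CBT k ]
2^-k[α+o]≐ℙ k@(suc k′) = 2^≐-cong {log₂ (ℙ-CBT k) {{ℚ.positive (ℙ-CBT>0 k)}}} {(- (+ k / 1)) ⋆ (α +ᴿ o k)} (ℙ-CBT k)
  (λ n → eq (S n n) (Log (ℙ-CBT k) (ℙ-CBT>0 k) n)) (log₂-correct (ℙ-CBT k) {{ℚ.positive (ℙ-CBT>0 k)}})
  where
  c : ℚ
  c = + 1 / k
  eq : ∀ t L → L ≡ ℚ.- ι k ℚ.* ((1ℚ ℚ.+ t) ℚ.+ (ℚ.- c ℚ.* L ℚ.+ ℚ.- 1ℚ ℚ.* (1ℚ ℚ.+ t)))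
  eq t L = sym (trans (solve 4 (λ K t c L → :- K :* ((con 1ℚ :+ t) :+ (:- c :* L :+ con (ℚ.- 1ℚ) :* (con 1ℚ :+ t))) := (c :* K) :* L) refl (ι k) t c L)
    (trans (cong (ℚ._* L) (1/*ι k)) (ℚₚ.*-identityˡ L)))
    where open +-*-Solver

module _ (k′ : ℕ) where
  private
    k d r : ℕ
    k = suc k′
    d = ⌊log₂ k ⌋
    r = k ∸ 2 ℕ.^ d
    k≡ : 2 ℕ.^ d ℕ.+ r ≡ k
    k≡ = ℕₚ.m+[n∸m]≡n (2^⌊log₂⌋≤ k)
    c K e f : ℚ
    c = + 1 / k
    K = ι k
    e = ι (d ℕ.* suc d)
    f = ι (suc d)
    L ϕ V : ℕ → ℚ
    L = Log (ℙ-CBT k) (ℙ-CBT>0 k)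
    ϕ = Φ (CBT k)
    V n = (K ℚ.- 1ℚ ℚ.+ ϕ n) ℚ.- ℓ k n

    c≥0 : 0ℚ ℚ.≤ c
    c≥0 = ℚₚ.<⇒≤ (1/suc>0 k′)

    ϕ≤ : ∀ n → ϕ n ℚ.≤ K ℚ.* S d n ℚ.+ e
    ϕ≤ n = subst (λ m → ϕ n ℚ.≤ ι m ℚ.* S d n ℚ.+ e) k≡ (proj₁ (Φ-filled-near n d r (r≤ k)))

    ≤ϕ : ∀ n → K ℚ.* S d n ℚ.≤ ϕ n ℚ.+ e
    ≤ϕ n = subst (λ m → ι m ℚ.* S d n ℚ.≤ ϕ n ℚ.+ e) k≡ (proj₂ (Φ-filled-near n d r (r≤ k)))

    ℓ≥0 : ∀ n → 0ℚ ℚ.≤ ℓ k n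
    ℓ≥0 n = subst (ℚ._≤ ℓ k n) (ℓ-2^ 0 n) (ℓ-mono {1} {k} n (s≤s z≤n))

    ℓ≤ : ∀ n → ℓ k n ℚ.≤ f
    ℓ≤ n = subst (ℓ k n ℚ.≤_) (ℓ-2^ (suc d) n) (ℓ-mono {k} {2 ℕ.^ suc d} n (ℕₚ.<⇒≤ (<2^suc⌊log₂⌋ k)))

    c≤w : c ℚ.≤ w d
    c≤w = begin
      c                                ≡⟨ ℚₚ.*-identityʳ c ⟨
      c ℚ.* 1ℚ                         ≡⟨ cong (c ℚ.*_) (w*2^ d) ⟨
      c ℚ.* (w d ℚ.* ι (2 ℕ.^ d))      ≤⟨ ℚₚ.*-monoˡ-≤-nonNeg c {{ℚ.nonNegative c≥0}} (ℚₚ.*-monoˡ-≤-nonNeg (w d) {{ℚ.nonNegative (ℚₚ.<⇒≤ (w>0 d))}} (ι-mono-≤ (2^⌊log₂⌋≤ k))) ⟩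
      c ℚ.* (w d ℚ.* K)                ≡⟨ solve 3 (λ c w K → c :* (w :* K) := w :* (c :* K)) refl c (w d) K ⟩
      w d ℚ.* (c ℚ.* K)                ≡⟨ cong (w d ℚ.*_) (1/*ι k) ⟩
      w d ℚ.* 1ℚ                       ≡⟨ ℚₚ.*-identityʳ (w d) ⟩
      w d                              ∎
      where
      open ℚₚ.≤-Reasoning
      open +-*-Solver

    -- The identity ℙ · X = k, read as -log₂ ℙ = log₂ X - log₂ k.
    -L≃V : (λ n → ℚ.- L n) ≃ V
    -L≃V = ≃-trans {λ n → ℚ.- L n} {λ n → ℚ.- (L n ℚ.+ LX n) ℚ.+ LX n} {V}
      (≗⇒≃ (λ n → ℚ.- L n) (λ n → ℚ.- (L n ℚ.+ LX n) ℚ.+ LX n) (λ n → solve 2 (λ l y → :- l := :- (l :+ y) :+ y) refl (L n) (LX n)))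
      (≃-trans {λ n → ℚ.- (L n ℚ.+ LX n) ℚ.+ LX n} {λ n → ℚ.- ℓ k n ℚ.+ (K ℚ.- 1ℚ ℚ.+ ϕ n)} {V}
        (≃-+ {λ n → ℚ.- (L n ℚ.+ LX n)} {λ n → ℚ.- ℓ k n} {LX} {λ n → K ℚ.- 1ℚ ℚ.+ ϕ n}
          (≃-neg {λ n → L n ℚ.+ LX n} {ℓ k} L+LX≃ℓ)
          (subst (λ m → LX ≃ (λ n → ι m ℚ.- 1ℚ ℚ.+ ϕ n)) (CBT-size k) (Log-X (CBT k))))
        (≗⇒≃ (λ n → ℚ.- ℓ k n ℚ.+ (K ℚ.- 1ℚ ℚ.+ ϕ n)) V (λ n → ℚₚ.+-comm (ℚ.- ℓ k n) (K ℚ.- 1ℚ ℚ.+ ϕ n))))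
      where
      open +-*-Solver
      LX : ℕ → ℚ
      LX = Log (X (CBT k)) (X>0 (CBT k))
      ℙX>0 : 0ℚ ℚ.< ℙ-CBT k ℚ.* X (CBT k)
      ℙX>0 = *-pos (ℙ-CBT>0 k) (X>0 (CBT k))
      L+LX≃ℓ : (λ n → L n ℚ.+ LX n) ≃ ℓ k
      L+LX≃ℓ = ≃-trans {λ n → L n ℚ.+ LX n} {Log (ℙ-CBT k ℚ.* X (CBT k)) ℙX>0} {ℓ k}
        (≃-sym {Log (ℙ-CBT k ℚ.* X (CBT k)) ℙX>0} {λ n → L n ℚ.+ LX n} (Log-* {ℙ-CBT k} {X (CBT k)} (ℙ-CBT>0 k) (X>0 (CBT k)) ℙX>0))
        (subst (λ y → (p : 0ℚ ℚ.< y) → Log y p ≃ ℓ k) (sym (ℙ-DTCS*X (CBT k) k (CBT-size k))) (λ p → Log-ι k p) ℙX>0)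

    o≃ : seq (o k) ≃ (λ n → c ℚ.* (ℚ.- L n) ℚ.+ ℚ.- (1ℚ ℚ.+ S n n))
    o≃ = ≗⇒≃ (seq (o k)) (λ n → c ℚ.* (ℚ.- L n) ℚ.+ ℚ.- (1ℚ ℚ.+ S n n)) (λ n →
      solve 3 (λ c l t → :- c :* l :+ con (ℚ.- 1ℚ) :* t := c :* (:- l) :+ :- t) refl c (L n) (1ℚ ℚ.+ S n n))
      where open +-*-Solver

    cK : ∀ t → c ℚ.* (K ℚ.* t) ≡ t
    cK t = trans (sym (ℚₚ.*-assoc c K t)) (trans (cong (ℚ._* t) (1/*ι k)) (ℚₚ.*-identityˡ t))

    *-w : ∀ {m} → c ℚ.* ι m ℚ.≤ ι m ℚ.* w d
    *-w {m} = ℚₚ.≤-trans (ℚₚ.*-monoʳ-≤-nonNeg (ι m) {{ℚ.nonNegative (ι≥0 m)}} c≤w) (ℚₚ.≤-reflexive (ℚₚ.*-comm (w d) (ι m)))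

    -- On this side -1 and -log₂ k only help, so the deviation `e` is all that counts.
    upper-bound : ∀ n → c ℚ.* V n ℚ.+ ℚ.- (1ℚ ℚ.+ S d n) ℚ.≤ error d
    upper-bound n = begin
      c ℚ.* V n ℚ.+ ℚ.- (1ℚ ℚ.+ S d n)
        ≤⟨ ℚₚ.+-monoˡ-≤ (ℚ.- (1ℚ ℚ.+ S d n)) (ℚₚ.*-monoˡ-≤-nonNeg c {{ℚ.nonNegative c≥0}} V≤) ⟩
      c ℚ.* (K ℚ.* (1ℚ ℚ.+ S d n) ℚ.+ e) ℚ.+ ℚ.- (1ℚ ℚ.+ S d n)
        ≡⟨ cong (ℚ._+ ℚ.- (1ℚ ℚ.+ S d n)) (trans (ℚₚ.*-distribˡ-+ c (K ℚ.* (1ℚ ℚ.+ S d n)) e) (cong (ℚ._+ c ℚ.* e) (cK (1ℚ ℚ.+ S d n)))) ⟩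
      1ℚ ℚ.+ S d n ℚ.+ c ℚ.* e ℚ.+ ℚ.- (1ℚ ℚ.+ S d n)
        ≡⟨ solve 2 (λ t x → t :+ x :+ :- t := x) refl (1ℚ ℚ.+ S d n) (c ℚ.* e) ⟩
      c ℚ.* e
        ≤⟨ *-w {d ℕ.* suc d} ⟩
      e ℚ.* w d
        ≤⟨ ℚₚ.*-monoʳ-≤-nonNeg (w d) {{ℚ.nonNegative (ℚₚ.<⇒≤ (w>0 d))}} (ι-mono-≤ {d ℕ.* suc d} (subst (d ℕ.* suc d ℕ.≤_) (expand d) (ℕₚ.m≤m+n (d ℕ.* suc d) (2 ℕ.* d ℕ.+ 3)))) ⟩
      error d ∎
      where
      open ℚₚ.≤-Reasoning
      open +-*-Solver
      expand : ∀ d → d ℕ.* suc d ℕ.+ (2 ℕ.* d ℕ.+ 3) ≡ d ℕ.* d ℕ.+ 3 ℕ.* d ℕ.+ 3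
      expand = ℕ-Tactic.solve-∀
      V≤ : V n ℚ.≤ K ℚ.* (1ℚ ℚ.+ S d n) ℚ.+ e
      V≤ = ℚₚ.≤-trans (p≤p+q (V n) {1ℚ ℚ.+ ℓ k n} (ℚₚ.+-mono-≤ 0≤1 (ℓ≥0 n)))
        (ℚₚ.≤-trans (ℚₚ.≤-reflexive (solve 3 (λ K p l → K :+ :- con 1ℚ :+ p :+ :- l :+ (con 1ℚ :+ l) := K :+ p) refl K (ϕ n) (ℓ k n)))
        (ℚₚ.≤-trans (ℚₚ.+-monoʳ-≤ K (ϕ≤ n)) (ℚₚ.≤-reflexive (solve 3 (λ K s e → K :+ (K :* s :+ e) := K :* (con 1ℚ :+ s) :+ e) refl K (S d n) e))))

    -- This side spends the whole budget: `m` collects the three losses that are divided by k, and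
    -- the tail enters because the limit may exceed S_d by that much.
    lower-bound : ∀ n → ℚ.- error d ℚ.≤ c ℚ.* V n ℚ.+ ℚ.- (1ℚ ℚ.+ (S d n ℚ.+ tail d))
    lower-bound n = begin
      ℚ.- error d
        ≡⟨ cong ℚ.-_ (trans (cong (λ m → ι m ℚ.* w d) (sym (expand d))) (trans (cong (ℚ._* w d) (ι-+ m (suc d))) (ℚₚ.*-distribʳ-+ (w d) (ι m) f))) ⟩
      ℚ.- (ι m ℚ.* w d ℚ.+ tail d)
        ≤⟨ ℚₚ.neg-antimono-≤ (ℚₚ.+-monoˡ-≤ (tail d) (*-w {m})) ⟩
      ℚ.- (c ℚ.* ι m ℚ.+ tail d)
        ≡⟨ solve 3 (λ t x y → :- (x :+ y) := t :+ :- x :+ :- (t :+ y)) refl (1ℚ ℚ.+ S d n) (c ℚ.* ι m) (tail d) ⟩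
      1ℚ ℚ.+ S d n ℚ.+ ℚ.- (c ℚ.* ι m) ℚ.+ ℚ.- (1ℚ ℚ.+ S d n ℚ.+ tail d)
        ≡⟨ cong₂ (λ x y → x ℚ.+ ℚ.- y) (trans (cong (ℚ._+ ℚ.- (c ℚ.* ι m)) (sym (cK (1ℚ ℚ.+ S d n))))
             (solve 3 (λ c x m → c :* x :+ :- (c :* m) := c :* (x :+ :- m)) refl c (K ℚ.* (1ℚ ℚ.+ S d n)) (ι m)))
             (ℚₚ.+-assoc 1ℚ (S d n) (tail d)) ⟩
      c ℚ.* (K ℚ.* (1ℚ ℚ.+ S d n) ℚ.- ι m) ℚ.+ ℚ.- (1ℚ ℚ.+ (S d n ℚ.+ tail d))
        ≤⟨ ℚₚ.+-monoˡ-≤ (ℚ.- (1ℚ ℚ.+ (S d n ℚ.+ tail d))) (ℚₚ.*-monoˡ-≤-nonNeg c {{ℚ.nonNegative c≥0}} ≤V) ⟩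
      c ℚ.* V n ℚ.+ ℚ.- (1ℚ ℚ.+ (S d n ℚ.+ tail d)) ∎
      where
      open ℚₚ.≤-Reasoning
      open +-*-Solver
      m : ℕ
      m = 1 ℕ.+ d ℕ.* suc d ℕ.+ suc d
      expand : ∀ d → 1 ℕ.+ d ℕ.* suc d ℕ.+ suc d ℕ.+ suc d ≡ d ℕ.* d ℕ.+ 3 ℕ.* d ℕ.+ 3
      expand = ℕ-Tactic.solve-∀
      ιm : ι m ≡ 1ℚ ℚ.+ e ℚ.+ f
      ιm = trans (ι-+ (1 ℕ.+ d ℕ.* suc d) (suc d)) (cong (ℚ._+ f) (ι-+ 1 (d ℕ.* suc d)))
      ≤V : K ℚ.* (1ℚ ℚ.+ S d n) ℚ.- ι m ℚ.≤ V n
      ≤V = subst (λ x → K ℚ.* (1ℚ ℚ.+ S d n) ℚ.- x ℚ.≤ V n) (sym ιm) (ℚₚ.≤-trans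
        (ℚₚ.≤-reflexive (solve 4 (λ K s e f → K :* (con 1ℚ :+ s) :+ :- (con 1ℚ :+ e :+ f) := K :+ :- con 1ℚ :+ (K :* s :+ :- e) :+ :- f) refl K (S d n) e f))
        (ℚₚ.+-mono-≤ (ℚₚ.+-monoʳ-≤ (K ℚ.- 1ℚ) (ℚₚ.≤-trans (ℚₚ.+-monoˡ-≤ (ℚ.- e) (≤ϕ n)) (ℚₚ.≤-reflexive (solve 2 (λ p e → p :+ e :+ :- e := p) refl (ϕ n) e))))
          (ℚₚ.neg-antimono-≤ (ℓ≤ n))))

  o≼error : seq (o k) ≼ (λ _ → error d)
  o≼error = ≼-trans {seq (o k)} {λ n → c ℚ.* (ℚ.- L n) ℚ.+ ℚ.- (1ℚ ℚ.+ S n n)} {λ _ → error d} (≃⇒≼ o≃)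
    (≼-trans {λ n → c ℚ.* (ℚ.- L n) ℚ.+ ℚ.- (1ℚ ℚ.+ S n n)} {λ n → c ℚ.* V n ℚ.+ ℚ.- (1ℚ ℚ.+ S d n)} {λ _ → error d}
      (≼-+ {λ n → c ℚ.* (ℚ.- L n)} {λ n → c ℚ.* V n} {λ n → ℚ.- (1ℚ ℚ.+ S n n)} {λ n → ℚ.- (1ℚ ℚ.+ S d n)}
        (≼-* {λ n → ℚ.- L n} {V} c c≥0 (≃⇒≼ -L≃V))
        (≼-neg {λ n → 1ℚ ℚ.+ S d n} {λ n → 1ℚ ℚ.+ S n n} (≼-+ {λ _ → 1ℚ} {λ _ → 1ℚ} {S d} {seq s} (≃⇒≼ ≃-refl) (S≼s d))))
      (pointwise (λ n → c ℚ.* V n ℚ.+ ℚ.- (1ℚ ℚ.+ S d n)) (λ _ → error d) upper-bound))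

  -error≼o : (λ _ → ℚ.- error d) ≼ seq (o k)
  -error≼o = ≼-trans {λ _ → ℚ.- error d} {λ n → c ℚ.* (ℚ.- L n) ℚ.+ ℚ.- (1ℚ ℚ.+ S n n)} {seq (o k)}
    (≼-trans {λ _ → ℚ.- error d} {λ n → c ℚ.* V n ℚ.+ ℚ.- (1ℚ ℚ.+ (S d n ℚ.+ tail d))} {λ n → c ℚ.* (ℚ.- L n) ℚ.+ ℚ.- (1ℚ ℚ.+ S n n)}
      (pointwise (λ _ → ℚ.- error d) (λ n → c ℚ.* V n ℚ.+ ℚ.- (1ℚ ℚ.+ (S d n ℚ.+ tail d))) lower-bound)
      (≼-+ {λ n → c ℚ.* V n} {λ n → c ℚ.* (ℚ.- L n)} {λ n → ℚ.- (1ℚ ℚ.+ (S d n ℚ.+ tail d))} {λ n → ℚ.- (1ℚ ℚ.+ S n n)}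
        (≼-* {V} {λ n → ℚ.- L n} c c≥0 (≃⇒≽ -L≃V))
        (≼-neg {λ n → 1ℚ ℚ.+ S n n} {λ n → 1ℚ ℚ.+ (S d n ℚ.+ tail d)}
          (≼-+ {λ _ → 1ℚ} {λ _ → 1ℚ} {seq s} {λ n → S d n ℚ.+ tail d} (≃⇒≼ ≃-refl) (s≼S+tail d)))))
    (≃⇒≽ o≃)

o⟶0 : o ⟶ fromℚ 0ℚ
-- From k ≥ 2^M on, ⌊log₂ k⌋ is at least M. A quarter of δ is for `error`, a quarter for rounding,
-- and half for the strict inequality.
o⟶0 δ 0<δ = 2 ℕ.^ M , λ { zero M≤ → ⊥-elim (ℕₚ.<⇒≱ (2^>0 M) M≤) ; (suc k′) M≤ → close k′ M≤ }
  where
  open +-*-Solver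
  δ/4 : ℚ
  δ/4 = + 1 / 4 ℚ.* δ
  0<δ/4 : 0ℚ ℚ.< δ/4
  0<δ/4 = *-pos {+ 1 / 4} {δ} (ℚₚ.positive⁻¹ (+ 1 / 4)) 0<δ
  small : ∃[ M ] (∀ d → M ℕ.≤ d → error d ℚ.≤ δ/4)
  small = error-small δ/4 0<δ/4
  M : ℕ
  M = proj₁ small
  δ/4+δ/4 : δ/4 ℚ.+ δ/4 ≡ ℚ.½ ℚ.* δ
  δ/4+δ/4 = solve 1 (λ d → con (+ 1 / 4) :* d :+ con (+ 1 / 4) :* d := con ℚ.½ :* d) refl δ
  x-0 : ∀ x → x ℚ.+ ℚ.- 1ℚ ℚ.* 0ℚ ≡ x
  x-0 x = ℚₚ.+-identityʳ x
  close : ∀ k′ → 2 ℕ.^ M ℕ.≤ suc k′ → (fromℚ (ℚ.- δ) <ᴿ o (suc k′) -ᴿ fromℚ 0ℚ) × (o (suc k′) -ᴿ fromℚ 0ℚ <ᴿ fromℚ δ)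
  close k′ M≤ = <ᴿ-from-bounds (o k -ᴿ fromℚ 0ℚ) δ (N₁ ℕ.⊔ N₂) 0<δ
    (λ n N≤n → begin
      ℚ.- (ℚ.½ ℚ.* δ)                        ≡⟨ cong ℚ.-_ δ/4+δ/4 ⟨
      ℚ.- (δ/4 ℚ.+ δ/4)                      ≡⟨ solve 1 (λ x → :- (x :+ x) := :- x :+ :- x) refl δ/4 ⟩
      ℚ.- δ/4 ℚ.- δ/4                        ≤⟨ ℚₚ.+-monoˡ-≤ (ℚ.- δ/4) (ℚₚ.neg-antimono-≤ error≤δ/4) ⟩
      ℚ.- error d ℚ.- δ/4                    ≤⟨ ℚₚ.+-monoˡ-≤ (ℚ.- δ/4) (proj₂ below n (ℕₚ.m⊔n≤o⇒m≤o N₁ N₂ N≤n)) ⟩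
      seq (o k) n ℚ.+ δ/4 ℚ.- δ/4            ≡⟨ solve 2 (λ x y → x :+ y :+ :- y := x) refl (seq (o k) n) δ/4 ⟩
      seq (o k) n                            ≡⟨ x-0 (seq (o k) n) ⟨
      seq (o k) n ℚ.+ ℚ.- 1ℚ ℚ.* 0ℚ          ∎)
    (λ n N≤n → begin
      seq (o k) n ℚ.+ ℚ.- 1ℚ ℚ.* 0ℚ          ≡⟨ x-0 (seq (o k) n) ⟩
      seq (o k) n                            ≤⟨ proj₂ above n (ℕₚ.m⊔n≤o⇒n≤o N₁ N₂ N≤n) ⟩
      error d ℚ.+ δ/4                        ≤⟨ ℚₚ.+-monoˡ-≤ δ/4 error≤δ/4 ⟩
      δ/4 ℚ.+ δ/4                            ≡⟨ δ/4+δ/4 ⟩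
      ℚ.½ ℚ.* δ                              ∎)
    where
    open ℚₚ.≤-Reasoning
    k d : ℕ
    k = suc k′
    d = ⌊log₂ k ⌋
    error≤δ/4 : error d ℚ.≤ δ/4
    error≤δ/4 = proj₂ small d (subst (ℕ._≤ d) (⌊log₂[2^n]⌋≡n M) (⌊log₂⌋-mono-≤ M≤))
    below : ∃[ N ] (∀ n → N ℕ.≤ n → ℚ.- error d ℚ.≤ seq (o k) n ℚ.+ δ/4)
    below = eventually (-error≼o k′) δ/4 0<δ/4
    above : ∃[ N ] (∀ n → N ℕ.≤ n → seq (o k) n ℚ.≤ error d ℚ.+ δ/4)
    above = eventually (o≼error k′) δ/4 0<δ/4
    N₁ N₂ : ℕ
    N₁ = proj₁ below
    N₂ = proj₁ above

-- Numerical bounds for α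

c*1/c : ∀ c .{{_ : NonZero c}} x → ι c ℚ.* (+ 1 / c ℚ.* x) ≡ x
c*1/c c x = trans (sym (ℚₚ.*-assoc (ι c) (+ 1 / c) x)) (trans (cong (ℚ._* x) (trans (ℚₚ.*-comm (ι c) (+ 1 / c)) (1/*ι c))) (ℚₚ.*-identityˡ x))

1/c*c : ∀ c .{{_ : NonZero c}} x → + 1 / c ℚ.* (ι c ℚ.* x) ≡ x
1/c*c c x = trans (sym (ℚₚ.*-assoc (+ 1 / c) (ι c) x)) (trans (cong (ℚ._* x) (1/*ι c)) (ℚₚ.*-identityˡ x))

1/≥0 : ∀ c .{{_ : NonZero c}} → 0ℚ ℚ.≤ + 1 / c
1/≥0 c@(suc c′) = ℚₚ.<⇒≤ (1/suc>0 c′)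

1/-mono-ι : ∀ c .{{_ : NonZero c}} {a b} → a ℕ.≤ b → + 1 / c ℚ.* ι a ℚ.≤ + 1 / c ℚ.* ι b
1/-mono-ι c p = ℚₚ.*-monoˡ-≤-nonNeg (+ 1 / c) {{ℚ.nonNegative (1/≥0 c)}} (ι-mono-≤ p)

ι-/-lower : ∀ a c .{{_ : NonZero c}} → ι (a ℕ./ c) ℚ.≤ + 1 / c ℚ.* ι a
ι-/-lower a c = begin
  ι (a ℕ./ c)                                ≡⟨ 1/c*c c (ι (a ℕ./ c)) ⟨
  + 1 / c ℚ.* (ι c ℚ.* ι (a ℕ./ c))          ≡⟨ cong (+ 1 / c ℚ.*_) (trans (sym (ι-* c (a ℕ./ c))) (cong ι (ℕₚ.*-comm c (a ℕ./ c)))) ⟩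
  + 1 / c ℚ.* ι ((a ℕ./ c) ℕ.* c)            ≤⟨ 1/-mono-ι c (m/n*n≤m a c) ⟩
  + 1 / c ℚ.* ι a                            ∎
  where open ℚₚ.≤-Reasoning

_/⌈_⌉ : ∀ (a c : ℕ) .{{_ : NonZero c}} → ℕ
a /⌈ c ⌉ = (a ℕ.+ ℕ.pred c) ℕ./ c

ι-/-upper : ∀ a c .{{_ : NonZero c}} → + 1 / c ℚ.* ι a ℚ.≤ ι (a /⌈ c ⌉)
ι-/-upper a c@(suc c′) = begin
  + 1 / c ℚ.* ι a                            ≤⟨ 1/-mono-ι c (ℕₚ.+-cancelʳ-≤ c′ a (Q ℕ.* c) bound-a) ⟩
  + 1 / c ℚ.* ι (Q ℕ.* c)                    ≡⟨ cong (+ 1 / c ℚ.*_) (trans (cong ι (ℕₚ.*-comm Q c)) (ι-* c Q)) ⟩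
  + 1 / c ℚ.* (ι c ℚ.* ι Q)                  ≡⟨ 1/c*c c (ι Q) ⟩
  ι Q                                        ∎
  where
  open ℚₚ.≤-Reasoning
  Q : ℕ
  Q = a /⌈ c ⌉
  bound-a : a ℕ.+ c′ ℕ.≤ Q ℕ.* c ℕ.+ c′
  bound-a = ℕₚ.≤-trans (ℕₚ.≤-reflexive (m≡m%n+[m/n]*n (a ℕ.+ c′) c))
    (ℕₚ.≤-trans (ℕₚ.+-monoˡ-≤ (Q ℕ.* c) (ℕₚ.≤-pred (m%n<n (a ℕ.+ c′) c))) (ℕₚ.≤-reflexive (ℕₚ.+-comm c′ (Q ℕ.* c))))

ℓ-^ : ∀ a .{{_ : NonZero a}} q → ℓ (a ℕ.^ q) ≃ (λ n → ι q ℚ.* ℓ a n)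
ℓ-^ a zero    = ≗⇒≃ (ℓ 1) (λ n → 0ℚ ℚ.* ℓ a n) (λ n → trans (ℓ-2^ 0 n) (sym (ℚₚ.*-zeroˡ (ℓ a n))))
ℓ-^ a (suc q) = ≃-trans {ℓ (a ℕ.* a ℕ.^ q)} {λ n → ℓ a n ℚ.+ ℓ (a ℕ.^ q) n} {λ n → ι (suc q) ℚ.* ℓ a n} (ℓ-* a (a ℕ.^ q) {{recompute-nonZero a}} {{ℕₚ.m^n≢0 a q}})
  (≃-trans {λ n → ℓ a n ℚ.+ ℓ (a ℕ.^ q) n} {λ n → ℓ a n ℚ.+ ι q ℚ.* ℓ a n} {λ n → ι (suc q) ℚ.* ℓ a n}
    (≃-+ {ℓ a} {ℓ a} {ℓ (a ℕ.^ q)} {λ n → ι q ℚ.* ℓ a n} ≃-refl (ℓ-^ a q))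
    (≗⇒≃ (λ n → ℓ a n ℚ.+ ι q ℚ.* ℓ a n) (λ n → ι (suc q) ℚ.* ℓ a n)
      (λ n → trans (solve 2 (λ q l → l :+ q :* l := (con 1ℚ :+ q) :* l) refl (ι q) (ℓ a n)) (cong (ℚ._* ℓ a n) (sym (ι-+ 1 q))))))
  where open +-*-Solver

-- A rational bound p/q for a binary logarithm is certified by comparing q-th powers.
module _ (A H p q : ℕ) .{{_ : NonZero A}} .{{_ : NonZero H}} where
  private
    2^p*H^q : ℓ (2 ℕ.^ p ℕ.* H ℕ.^ q) ≃ (λ n → ι p ℚ.+ ι q ℚ.* ℓ H n)
    2^p*H^q = ≃-trans {ℓ (2 ℕ.^ p ℕ.* H ℕ.^ q)} {λ n → ℓ (2 ℕ.^ p) n ℚ.+ ℓ (H ℕ.^ q) n} {λ n → ι p ℚ.+ ι q ℚ.* ℓ H n}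
      (ℓ-* (2 ℕ.^ p) (H ℕ.^ q) {{ℕₚ.m^n≢0 2 p}} {{ℕₚ.m^n≢0 H q}})
      (≃-+ {ℓ (2 ℕ.^ p)} {λ _ → ι p} {ℓ (H ℕ.^ q)} {λ n → ι q ℚ.* ℓ H n} (≗⇒≃ (ℓ (2 ℕ.^ p)) (λ _ → ι p) (ℓ-2^ p)) (ℓ-^ H q))
    ratio-eq : ∀ n → ι q ℚ.* ℓ A n ℚ.+ ℚ.- (ι q ℚ.* ℓ H n) ≡ ι q ℚ.* ratio A H n
    ratio-eq n = solve 3 (λ q a h → q :* a :+ :- (q :* h) := q :* (a :+ :- h)) refl (ι q) (ℓ A n) (ℓ H n)
      where open +-*-Solver
    cancel : ∀ n → ι p ≡ ι p ℚ.+ ι q ℚ.* ℓ H n ℚ.+ ℚ.- (ι q ℚ.* ℓ H n)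
    cancel n = solve 2 (λ p x → p := p :+ x :+ :- x) refl (ι p) (ι q ℚ.* ℓ H n)
      where open +-*-Solver
    A^ = λ n → ι q ℚ.* ℓ A n
    H^ = λ n → ι q ℚ.* ℓ H n

  ratio-lower : 2 ℕ.^ p ℕ.* H ℕ.^ q ℕ.≤ A ℕ.^ q → (λ _ → ι p) ≼ (λ n → ι q ℚ.* ratio A H n)
  ratio-lower le = ≼-trans {λ _ → ι p} {λ n → ι p ℚ.+ H^ n ℚ.+ ℚ.- H^ n} {λ n → ι q ℚ.* ratio A H n}
    (pointwise (λ _ → ι p) (λ n → ι p ℚ.+ H^ n ℚ.+ ℚ.- H^ n) (λ n → ℚₚ.≤-reflexive (cancel n)))
    (≼-trans {λ n → ι p ℚ.+ H^ n ℚ.+ ℚ.- H^ n} {λ n → A^ n ℚ.+ ℚ.- H^ n} {λ n → ι q ℚ.* ratio A H n}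
      (≼-+ {λ n → ι p ℚ.+ H^ n} {A^} {λ n → ℚ.- H^ n} {λ n → ℚ.- H^ n}
        (≼-trans {λ n → ι p ℚ.+ H^ n} {ℓ (2 ℕ.^ p ℕ.* H ℕ.^ q)} {A^} (≃⇒≽ 2^p*H^q)
          (≼-trans {ℓ (2 ℕ.^ p ℕ.* H ℕ.^ q)} {ℓ (A ℕ.^ q)} {A^}
            (pointwise (ℓ (2 ℕ.^ p ℕ.* H ℕ.^ q)) (ℓ (A ℕ.^ q)) (λ n → ℓ-mono n le)) (≃⇒≼ (ℓ-^ A q))))
        (≃⇒≼ ≃-refl))
      (pointwise (λ n → A^ n ℚ.+ ℚ.- H^ n) (λ n → ι q ℚ.* ratio A H n) (λ n → ℚₚ.≤-reflexive (ratio-eq n))))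

  ratio-upper : A ℕ.^ q ℕ.≤ 2 ℕ.^ p ℕ.* H ℕ.^ q → (λ n → ι q ℚ.* ratio A H n) ≼ (λ _ → ι p)
  ratio-upper le = ≼-trans {λ n → ι q ℚ.* ratio A H n} {λ n → A^ n ℚ.+ ℚ.- H^ n} {λ _ → ι p}
    (pointwise (λ n → ι q ℚ.* ratio A H n) (λ n → A^ n ℚ.+ ℚ.- H^ n) (λ n → ℚₚ.≤-reflexive (sym (ratio-eq n))))
    (≼-trans {λ n → A^ n ℚ.+ ℚ.- H^ n} {λ n → ι p ℚ.+ H^ n ℚ.+ ℚ.- H^ n} {λ _ → ι p}
      (≼-+ {A^} {λ n → ι p ℚ.+ H^ n} {λ n → ℚ.- H^ n} {λ n → ℚ.- H^ n}
        (≼-trans {A^} {ℓ (2 ℕ.^ p ℕ.* H ℕ.^ q)} {λ n → ι p ℚ.+ H^ n}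
          (≼-trans {A^} {ℓ (A ℕ.^ q)} {ℓ (2 ℕ.^ p ℕ.* H ℕ.^ q)} (≃⇒≽ (ℓ-^ A q))
            (pointwise (ℓ (A ℕ.^ q)) (ℓ (2 ℕ.^ p ℕ.* H ℕ.^ q)) (λ n → ℓ-mono n le)))
          (≃⇒≼ 2^p*H^q))
        (≃⇒≼ ≃-refl))
      (pointwise (λ n → ι p ℚ.+ H^ n ℚ.+ ℚ.- H^ n) (λ _ → ι p) (λ n → ℚₚ.≤-reflexive (sym (cancel n)))))

fraction-/ : ∀ A H .{{_ : NonZero A}} .{{_ : NonZero H}} → Fraction (+ 1 / H ℚ.* ι A) A H
fraction-/ A H = record { a≢0 = recompute-nonZero A ; b≢0 = recompute-nonZero H
  ; y*b≡a = trans (ℚₚ.*-comm (+ 1 / H ℚ.* ι A) (ι H)) (c*1/c H (ι A)) }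

1/*ι>0 : ∀ H A .{{_ : NonZero H}} .{{_ : NonZero A}} → 0ℚ ℚ.< + 1 / H ℚ.* ι A
1/*ι>0 H@(suc H′) A = *-pos (1/suc>0 H′) (ι>0 A)

module _ (A H p q j : ℕ) .{{_ : NonZero H}} .{{_ : NonZero q}} .{{nonZero-j : NonZero j}} where

  -- The power inequality says (A/H)^q ≥ 2^p, and A/H is at most h_j. `go` takes `A` as an argument
  -- in order to separate A = 0, which contradicts the power inequality.
  logh-lower : ι A ℚ.≤ h j ℚ.* ι H → 2 ℕ.^ p ℕ.* H ℕ.^ q ℕ.≤ A ℕ.^ q → (λ _ → ι p) ≼ (λ n → ι q ℚ.* logh j n)
  logh-lower = go A j
    where
    go : ∀ A j → .{{NonZero j}} → ι A ℚ.≤ h j ℚ.* ι H → 2 ℕ.^ p ℕ.* H ℕ.^ q ℕ.≤ A ℕ.^ q → (λ _ → ι p) ≼ (λ n → ι q ℚ.* logh j n)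
    go zero j A≤ le = ⊥-elim (ℕₚ.<⇒≱ (ℕₚ.*-mono-≤ (2^>0 p) (ℕₚ.m^n>0 H q)) (subst (2 ℕ.^ p ℕ.* H ℕ.^ q ℕ.≤_) (0^q q) le))
      where
      0^q : ∀ q .{{_ : NonZero q}} → 0 ℕ.^ q ≡ 0
      0^q (suc q) = refl
    go A@(suc _) (suc j) A≤ le = ≼-trans {λ _ → ι p} {λ n → ι q ℚ.* ratio A H n} {λ n → ι q ℚ.* logh (suc j) n}
      (ratio-lower A H p q le)
      (≼-* {ratio A H} {logh (suc j)} (ι q) (ι≥0 q)
        (≼-trans {ratio A H} {Log (+ 1 / H ℚ.* ι A) (1/*ι>0 H A)} {logh (suc j)}
          (≃⇒≽ (Log-fraction (1/*ι>0 H A) (fraction-/ A H)))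
          (Log-mono (1/*ι>0 H A) (h>0 (suc j)) (ℚₚ.≤-trans (ℚₚ.*-monoˡ-≤-nonNeg (+ 1 / H) {{ℚ.nonNegative (1/≥0 H)}} A≤)
            (ℚₚ.≤-reflexive (trans (cong (+ 1 / H ℚ.*_) (ℚₚ.*-comm (h (suc j)) (ι H))) (1/c*c H (h (suc j)))))))))

  logh-upper : h j ℚ.* ι H ℚ.≤ ι A → A ℕ.^ q ℕ.≤ 2 ℕ.^ p ℕ.* H ℕ.^ q → (λ n → ι q ℚ.* logh j n) ≼ (λ _ → ι p)
  logh-upper = go A j
    where
    go : ∀ A j → .{{NonZero j}} → h j ℚ.* ι H ℚ.≤ ι A → A ℕ.^ q ℕ.≤ 2 ℕ.^ p ℕ.* H ℕ.^ q → (λ n → ι q ℚ.* logh j n) ≼ (λ _ → ι p)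
    go zero (suc j) ≤A le = ⊥-elim (ℚₚ.<-irrefl refl (ℚₚ.<-≤-trans (*-pos (h>0 (suc j)) (ι>0 H)) ≤A))
    go A@(suc _) (suc j) ≤A le = ≼-trans {λ n → ι q ℚ.* logh (suc j) n} {λ n → ι q ℚ.* ratio A H n} {λ _ → ι p}
      (≼-* {logh (suc j)} {ratio A H} (ι q) (ι≥0 q)
        (≼-trans {logh (suc j)} {Log (+ 1 / H ℚ.* ι A) (1/*ι>0 H A)} {ratio A H}
          (Log-mono (h>0 (suc j)) (1/*ι>0 H A) (ℚₚ.≤-trans
            (ℚₚ.≤-reflexive (sym (trans (cong (+ 1 / H ℚ.*_) (ℚₚ.*-comm (h (suc j)) (ι H))) (1/c*c H (h (suc j))))))
            (ℚₚ.*-monoˡ-≤-nonNeg (+ 1 / H) {{ℚ.nonNegative (1/≥0 H)}} ≤A)))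
          (≃⇒≼ (Log-fraction (1/*ι>0 H A) (fraction-/ A H)))))
      (ratio-upper A H p q le)

-- Fixed-point values in units of 1/H.
module _ (H : ℕ) .{{_ : NonZero H}} where
  hfloor hceil : ℕ → ℕ
  hfloor zero    = 0
  hfloor (suc n) = hfloor n ℕ.+ H ℕ./ suc n
  hceil zero    = 0
  hceil (suc n) = hceil n ℕ.+ H /⌈ suc n ⌉

  hfloor-lower : ∀ n → ι (hfloor n) ℚ.≤ h n ℚ.* ι H
  hfloor-lower zero    = ℚₚ.≤-reflexive (sym (ℚₚ.*-zeroˡ (ι H)))
  hfloor-lower (suc n) = begin
    ι (hfloor n ℕ.+ H ℕ./ suc n)             ≡⟨ ι-+ (hfloor n) (H ℕ./ suc n) ⟩
    ι (hfloor n) ℚ.+ ι (H ℕ./ suc n)         ≤⟨ ℚₚ.+-mono-≤ (hfloor-lower n) (ι-/-lower H (suc n)) ⟩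
    h n ℚ.* ι H ℚ.+ ε n ℚ.* ι H              ≡⟨ ℚₚ.*-distribʳ-+ (ι H) (h n) (ε n) ⟨
    h (suc n) ℚ.* ι H                        ∎
    where open ℚₚ.≤-Reasoning

  hceil-upper : ∀ n → h n ℚ.* ι H ℚ.≤ ι (hceil n)
  hceil-upper zero    = ℚₚ.≤-reflexive (ℚₚ.*-zeroˡ (ι H))
  hceil-upper (suc n) = begin
    h (suc n) ℚ.* ι H                        ≡⟨ ℚₚ.*-distribʳ-+ (ι H) (h n) (ε n) ⟩
    h n ℚ.* ι H ℚ.+ ε n ℚ.* ι H              ≤⟨ ℚₚ.+-mono-≤ (hceil-upper n) (ι-/-upper H (suc n)) ⟩
    ι (hceil n) ℚ.+ ι (H /⌈ suc n ⌉)         ≡⟨ ι-+ (hceil n) (H /⌈ suc n ⌉) ⟨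
    ι (hceil n ℕ.+ H /⌈ suc n ⌉)             ∎
    where open ℚₚ.≤-Reasoning

ε-halve : ∀ n → ε n ≡ ε (suc n ℕ.+ n) ℚ.+ ε (suc n ℕ.+ n)
ε-halve n = begin
  ε n                                        ≡⟨ ℚₚ.*-identityʳ (ε n) ⟨
  ε n ℚ.* 1ℚ                                 ≡⟨ cong (ε n ℚ.*_) (1/*ι (suc (suc n ℕ.+ n))) ⟨
  ε n ℚ.* (e ℚ.* ι (suc (suc n ℕ.+ n)))      ≡⟨ cong (λ x → ε n ℚ.* (e ℚ.* x)) (trans (cong ι (sym (ℕₚ.+-suc (suc n) n))) (ι-+ (suc n) (suc n))) ⟩
  ε n ℚ.* (e ℚ.* (N ℚ.+ N))                  ≡⟨ solve 3 (λ a e N → a :* (e :* (N :+ N)) := (a :* N) :* e :+ (a :* N) :* e) refl (ε n) e N ⟩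
  (ε n ℚ.* N) ℚ.* e ℚ.+ (ε n ℚ.* N) ℚ.* e    ≡⟨ cong (λ x → x ℚ.* e ℚ.+ x ℚ.* e) (1/*ι (suc n)) ⟩
  1ℚ ℚ.* e ℚ.+ 1ℚ ℚ.* e                      ≡⟨ cong (λ x → x ℚ.+ x) (ℚₚ.*-identityˡ e) ⟩
  e ℚ.+ e                                    ∎
  where
  open ≡-Reasoning
  open +-*-Solver
  e N : ℚ
  e = ε (suc n ℕ.+ n)
  N = ι (suc n)

-- A lower bound for one dyadic block of the harmonic series hence serves for all later ones.
h[2n]-h[n]-mono : ∀ {m n} → m ℕ.≤ n → h (m ℕ.+ m) ℚ.- h m ℚ.≤ h (n ℕ.+ n) ℚ.- h n
h[2n]-h[n]-mono {m} p = go (ℕₚ.≤⇒≤′ p)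
  where
  step : ∀ n → h (n ℕ.+ n) ℚ.- h n ℚ.≤ h (suc n ℕ.+ suc n) ℚ.- h (suc n)
  step n = begin
    h (n ℕ.+ n) ℚ.- h n                                        ≡⟨ solve 3 (λ a b e → a :+ :- b := a :+ e :+ e :+ :- (b :+ (e :+ e))) refl (h (n ℕ.+ n)) (h n) (ε (suc n ℕ.+ n)) ⟩
    h (n ℕ.+ n) ℚ.+ e ℚ.+ e ℚ.- (h n ℚ.+ (e ℚ.+ e))            ≡⟨ cong (λ x → h (n ℕ.+ n) ℚ.+ e ℚ.+ e ℚ.- (h n ℚ.+ x)) (ε-halve n) ⟨
    h (n ℕ.+ n) ℚ.+ e ℚ.+ e ℚ.- h (suc n)                      ≤⟨ ℚₚ.+-monoˡ-≤ (ℚ.- h (suc n)) (ℚₚ.+-monoˡ-≤ e (ℚₚ.+-monoʳ-≤ (h (n ℕ.+ n)) (1/suc-antimono (ℕₚ.n≤1+n (n ℕ.+ n))))) ⟩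
    h (suc (suc n ℕ.+ n)) ℚ.- h (suc n)                        ≡⟨ cong (λ k → h k ℚ.- h (suc n)) (ℕₚ.+-suc (suc n) n) ⟨
    h (suc n ℕ.+ suc n) ℚ.- h (suc n)                          ∎
    where
    open ℚₚ.≤-Reasoning
    open +-*-Solver
    e : ℚ
    e = ε (suc n ℕ.+ n)
  go : ∀ {n} → m ℕ.≤′ n → h (m ℕ.+ m) ℚ.- h m ℚ.≤ h (n ℕ.+ n) ℚ.- h n
  go ℕ.≤′-refl         = ℚₚ.≤-refl
  go (ℕ.≤′-step {n} q) = ℚₚ.≤-trans (go q) (step n)

ι-∸≤ : ∀ a b {x} → 0ℚ ℚ.≤ x → ι a ℚ.≤ x ℚ.+ ι b → ι (a ∸ b) ℚ.≤ x
ι-∸≤ a b {x} 0≤x p = case (ℕₚ.≤-total a b)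
  where
  case : a ℕ.≤ b ⊎ b ℕ.≤ a → ι (a ∸ b) ℚ.≤ x
  case (inj₁ a≤b) = subst (λ m → ι m ℚ.≤ x) (sym (ℕₚ.m≤n⇒m∸n≡0 a≤b)) 0≤x
  case (inj₂ b≤a) = subst₂ ℚ._≤_
    (trans (cong (ℚ._- ι b) (trans (cong ι (sym (ℕₚ.m∸n+n≡m b≤a))) (ι-+ (a ∸ b) b))) (solve 2 (λ y b → y :+ b :+ :- b := y) refl (ι (a ∸ b)) (ι b)))
    (solve 2 (λ x b → x :+ b :+ :- b := x) refl x (ι b))
    (ℚₚ.+-monoˡ-≤ (ℚ.- ι b) p)
    where open +-*-Solver

h-2^≡ : ∀ i → h (2 ℕ.^ i) ≡ h (2 ℕ.^ i ∸ 1) ℚ.+ w i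
h-2^≡ i = subst (λ m → .{{_ : NonZero m}} → h m ≡ h (m ∸ 1) ℚ.+ + 1 / m) (sym (2^-suc i)) refl {{ℕₚ.m^n≢0 2 i}}

-- Reciprocals are summed only up to 2^(M+1). Further lower values are extrapolated with `β`, which
-- bounds h(2^(M+1)) - h(2^M) from below in units of 1/H.
module FixedPoint (H M β : ℕ) .{{_ : NonZero H}} (β≤ : β ℕ.+ hceil H (2 ℕ.^ M) ℕ.≤ hfloor H (2 ℕ.^ suc M)) where

  β-lower : ι β ℚ.≤ (h (2 ℕ.^ M ℕ.+ 2 ℕ.^ M) ℚ.- h (2 ℕ.^ M)) ℚ.* ι H
  β-lower = subst₂ ℚ._≤_ (solve 2 (λ b c → b :+ c :+ :- c := b) refl (ι β) c)
    (solve 3 (λ a b H → a :* H :+ :- (b :* H) := (a :+ :- b) :* H) refl (h (2 ℕ.^ M ℕ.+ 2 ℕ.^ M)) (h (2 ℕ.^ M)) (ι H))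
    (ℚₚ.+-monoˡ-≤ (ℚ.- c) (begin
      ι β ℚ.+ h (2 ℕ.^ M) ℚ.* ι H            ≤⟨ ℚₚ.+-monoʳ-≤ (ι β) (hceil-upper H (2 ℕ.^ M)) ⟩
      ι β ℚ.+ ι (hceil H (2 ℕ.^ M))          ≡⟨ ι-+ β (hceil H (2 ℕ.^ M)) ⟨
      ι (β ℕ.+ hceil H (2 ℕ.^ M))            ≤⟨ ι-mono-≤ β≤ ⟩
      ι (hfloor H (2 ℕ.^ suc M))             ≤⟨ hfloor-lower H (2 ℕ.^ suc M) ⟩
      h (2 ℕ.^ suc M) ℚ.* ι H                ≡⟨ cong (λ m → h m ℚ.* ι H) (2^suc M) ⟩
      h (2 ℕ.^ M ℕ.+ 2 ℕ.^ M) ℚ.* ι H        ∎))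
    where
    open ℚₚ.≤-Reasoning
    open +-*-Solver
    c : ℚ
    c = h (2 ℕ.^ M) ℚ.* ι H

  h[2^M+k]-lower : ∀ k → ι (hfloor H (2 ℕ.^ M) ℕ.+ k ℕ.* β) ℚ.≤ h (2 ℕ.^ (k ℕ.+ M)) ℚ.* ι H
  h[2^M+k]-lower zero    = subst (λ m → ι m ℚ.≤ h (2 ℕ.^ M) ℚ.* ι H) (sym (ℕₚ.+-identityʳ (hfloor H (2 ℕ.^ M)))) (hfloor-lower H (2 ℕ.^ M))
  h[2^M+k]-lower (suc k) = begin
    ι (hfloor H (2 ℕ.^ M) ℕ.+ (β ℕ.+ k ℕ.* β))             ≡⟨ cong ι (regroup (hfloor H (2 ℕ.^ M)) β (k ℕ.* β)) ⟩
    ι (hfloor H (2 ℕ.^ M) ℕ.+ k ℕ.* β ℕ.+ β)               ≡⟨ ι-+ (hfloor H (2 ℕ.^ M) ℕ.+ k ℕ.* β) β ⟩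
    ι (hfloor H (2 ℕ.^ M) ℕ.+ k ℕ.* β) ℚ.+ ι β             ≤⟨ ℚₚ.+-mono-≤ (h[2^M+k]-lower k) (ℚₚ.≤-trans β-lower
                                                               (ℚₚ.*-monoʳ-≤-nonNeg (ι H) {{ℚ.nonNegative (ι≥0 H)}} (h[2n]-h[n]-mono (ℕₚ.^-monoʳ-≤ 2 (ℕₚ.m≤n+m M k))))) ⟩
    h m ℚ.* ι H ℚ.+ (h (m ℕ.+ m) ℚ.- h m) ℚ.* ι H          ≡⟨ solve 3 (λ a b H → a :* H :+ (b :+ :- a) :* H := b :* H) refl (h m) (h (m ℕ.+ m)) (ι H) ⟩
    h (m ℕ.+ m) ℚ.* ι H                                    ≡⟨ cong (λ j → h j ℚ.* ι H) (2^suc (k ℕ.+ M)) ⟨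
    h (2 ℕ.^ (suc k ℕ.+ M)) ℚ.* ι H                        ∎
    where
    open ℚₚ.≤-Reasoning
    open +-*-Solver
    m : ℕ
    m = 2 ℕ.^ (k ℕ.+ M)
    regroup : ∀ a b c → a ℕ.+ (b ℕ.+ c) ≡ a ℕ.+ c ℕ.+ b
    regroup = ℕ-Tactic.solve-∀

  -- Sums up to 2^i are followed because these double neatly; the last term 1/2^i, rounded up, is
  -- taken off at the end to reach the index 2^i - 1.
  lowerH : ℕ → ℕ
  lowerH i = hfloor H (2 ℕ.^ (i ⊓ M)) ℕ.+ (i ∸ M) ℕ.* β ∸ (H /⌈ 2 ℕ.^ i ⌉) {{ℕₚ.m^n≢0 2 i}}

  -- Beyond `M` every doubling is charged a full 1. The margin below 1.638 is about 10⁻³ and can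
  -- afford this.
  upperH : ℕ → ℕ
  upperH i = hceil H (2 ℕ.^ (i ⊓ M) ∸ 1) ℕ.+ (i ∸ M) ℕ.* H

  private
    cases : ∀ i (Q : ℕ → ℕ → ℕ → Set) → (i ℕ.≤ M → Q i i 0) → (∀ k → Q (k ℕ.+ M) M k) → Q i (i ⊓ M) (i ∸ M)
    cases i Q low high = go (ℕₚ.≤-total i M)
      where
      go : i ℕ.≤ M ⊎ M ℕ.≤ i → Q i (i ⊓ M) (i ∸ M)
      go (inj₁ i≤M) = subst₂ (Q i) (sym (ℕₚ.m≤n⇒m⊓n≡m i≤M)) (sym (ℕₚ.m≤n⇒m∸n≡0 i≤M)) (low i≤M)
      go (inj₂ M≤i) = subst₂ (λ i m → Q i m (i ∸ M)) (ℕₚ.m∸n+n≡m M≤i) (sym (ℕₚ.m≥n⇒m⊓n≡n M≤i))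
        (subst (Q (i ∸ M ℕ.+ M) M) (cong (_∸ M) (sym (ℕₚ.m∸n+n≡m M≤i))) (high (i ∸ M)))

  lowerH-correct : ∀ i → ι (lowerH i) ℚ.≤ h (2 ℕ.^ i ∸ 1) ℚ.* ι H
  lowerH-correct i = ι-∸≤ (hfloor H (2 ℕ.^ (i ⊓ M)) ℕ.+ (i ∸ M) ℕ.* β) c
    (ℚₚ.nonNegative⁻¹ (h (2 ℕ.^ i ∸ 1) ℚ.* ι H) {{ℚₚ.nonNeg*nonNeg⇒nonNeg (h (2 ℕ.^ i ∸ 1)) {{h-nonNeg (2 ℕ.^ i ∸ 1)}} (ι H) {{ℚ.nonNegative (ι≥0 H)}}}})
    (begin
      ι (hfloor H (2 ℕ.^ (i ⊓ M)) ℕ.+ (i ∸ M) ℕ.* β)      ≤⟨ cases i (λ i m k → ι (hfloor H (2 ℕ.^ m) ℕ.+ k ℕ.* β) ℚ.≤ h (2 ℕ.^ i) ℚ.* ι H)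
                                                                (λ _ → subst (λ m → ι m ℚ.≤ h (2 ℕ.^ i) ℚ.* ι H) (sym (ℕₚ.+-identityʳ (hfloor H (2 ℕ.^ i)))) (hfloor-lower H (2 ℕ.^ i)))
                                                                h[2^M+k]-lower ⟩
      h (2 ℕ.^ i) ℚ.* ι H                                 ≡⟨ trans (cong (ℚ._* ι H) (h-2^≡ i)) (ℚₚ.*-distribʳ-+ (ι H) (h (2 ℕ.^ i ∸ 1)) (w i)) ⟩
      h (2 ℕ.^ i ∸ 1) ℚ.* ι H ℚ.+ w i ℚ.* ι H             ≤⟨ ℚₚ.+-monoʳ-≤ (h (2 ℕ.^ i ∸ 1) ℚ.* ι H) (ι-/-upper H (2 ℕ.^ i) {{ℕₚ.m^n≢0 2 i}}) ⟩
      h (2 ℕ.^ i ∸ 1) ℚ.* ι H ℚ.+ ι c                     ∎)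
    where
    open ℚₚ.≤-Reasoning
    c : ℕ
    c = (H /⌈ 2 ℕ.^ i ⌉) {{ℕₚ.m^n≢0 2 i}}

  upperH-correct : ∀ i → h (2 ℕ.^ i ∸ 1) ℚ.* ι H ℚ.≤ ι (upperH i)
  upperH-correct i = cases i (λ i m k → h (2 ℕ.^ i ∸ 1) ℚ.* ι H ℚ.≤ ι (hceil H (2 ℕ.^ m ∸ 1) ℕ.+ k ℕ.* H))
    (λ _ → subst (λ m → h (2 ℕ.^ i ∸ 1) ℚ.* ι H ℚ.≤ ι m) (sym (ℕₚ.+-identityʳ (hceil H (2 ℕ.^ i ∸ 1)))) (hceil-upper H (2 ℕ.^ i ∸ 1)))
    high
    where
    high : ∀ k → h (2 ℕ.^ (k ℕ.+ M) ∸ 1) ℚ.* ι H ℚ.≤ ι (hceil H (2 ℕ.^ M ∸ 1) ℕ.+ k ℕ.* H)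
    high zero    = subst (λ m → h (2 ℕ.^ M ∸ 1) ℚ.* ι H ℚ.≤ ι m) (sym (ℕₚ.+-identityʳ (hceil H (2 ℕ.^ M ∸ 1)))) (hceil-upper H (2 ℕ.^ M ∸ 1))
    high (suc k) = begin
      h (2 ℕ.^ suc (k ℕ.+ M) ∸ 1) ℚ.* ι H                 ≤⟨ ℚₚ.*-monoʳ-≤-nonNeg (ι H) {{ℚ.nonNegative (ι≥0 H)}} (h-double (k ℕ.+ M)) ⟩
      (h (2 ℕ.^ (k ℕ.+ M) ∸ 1) ℚ.+ 1ℚ) ℚ.* ι H            ≡⟨ trans (ℚₚ.*-distribʳ-+ (ι H) (h (2 ℕ.^ (k ℕ.+ M) ∸ 1)) 1ℚ) (cong (h (2 ℕ.^ (k ℕ.+ M) ∸ 1) ℚ.* ι H ℚ.+_) (ℚₚ.*-identityˡ (ι H))) ⟩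
      h (2 ℕ.^ (k ℕ.+ M) ∸ 1) ℚ.* ι H ℚ.+ ι H             ≤⟨ ℚₚ.+-monoˡ-≤ (ι H) (high k) ⟩
      ι (c ℕ.+ k ℕ.* H) ℚ.+ ι H                           ≡⟨ trans (sym (ι-+ (c ℕ.+ k ℕ.* H) H)) (cong ι (regroup c (k ℕ.* H) H)) ⟩
      ι (c ℕ.+ (H ℕ.+ k ℕ.* H))                           ∎
      where
      open ℚₚ.≤-Reasoning
      c : ℕ
      c = hceil H (2 ℕ.^ M ∸ 1)
      regroup : ∀ a b d → a ℕ.+ b ℕ.+ d ≡ a ℕ.+ (d ℕ.+ b)
      regroup = ℕ-Tactic.solve-∀

  -- With the factor H 2^i the recursion for partial sums becomes N ↦ 2N + H log₂ h, which can be
  -- rounded to naturals at each step.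
  scaledS : ℕ → ℕ → ℚ
  scaledS i n = ι (H ℕ.* 2 ℕ.^ i) ℚ.* S i n

  scaledS-suc : ∀ i n → scaledS (suc i) n ≡ ι 2 ℚ.* scaledS i n ℚ.+ ι H ℚ.* loghᴾ (suc i) n
  scaledS-suc i n = begin
    ι (H ℕ.* 2 ℕ.^ suc i) ℚ.* S (suc i) n                 ≡⟨ cong (ℚ._* S (suc i) n) (ι-* H (2 ℕ.^ suc i)) ⟩
    ι H ℚ.* K ℚ.* S (suc i) n                             ≡⟨ ℚₚ.*-assoc (ι H) K (S (suc i) n) ⟩
    ι H ℚ.* (K ℚ.* S (suc i) n)                           ≡⟨ cong (ι H ℚ.*_) (2^*S-suc n i) ⟩
    ι H ℚ.* (K ℚ.* S i n ℚ.+ lam)                         ≡⟨ cong (λ x → ι H ℚ.* (x ℚ.* S i n ℚ.+ lam)) (ι-* 2 (2 ℕ.^ i)) ⟩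
    ι H ℚ.* (ι 2 ℚ.* ι (2 ℕ.^ i) ℚ.* S i n ℚ.+ lam)       ≡⟨ solve 5 (λ H t D s l → H :* (t :* D :* s :+ l) := t :* (H :* D :* s) :+ H :* l) refl (ι H) (ι 2) (ι (2 ℕ.^ i)) (S i n) lam ⟩
    ι 2 ℚ.* (ι H ℚ.* ι (2 ℕ.^ i) ℚ.* S i n) ℚ.+ ι H ℚ.* lam ≡⟨ cong (λ x → ι 2 ℚ.* (x ℚ.* S i n) ℚ.+ ι H ℚ.* lam) (ι-* H (2 ℕ.^ i)) ⟨
    ι 2 ℚ.* scaledS i n ℚ.+ ι H ℚ.* lam                   ∎
    where
    open ≡-Reasoning
    open +-*-Solver
    K lam : ℚ
    K = ι (2 ℕ.^ suc i)
    lam = loghᴾ (suc i) n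

  module _ (i N p q : ℕ) .{{_ : NonZero q}} where
    private
      u v : ℕ → ℚ
      u n = ι q ℚ.* loghᴾ (suc i) n
      v n = ι H ℚ.* loghᴾ (suc i) n
      r : ℚ
      r = + 1 / q
      v≡ : ∀ n → v n ≡ ι H ℚ.* (r ℚ.* u n)
      v≡ n = cong (ι H ℚ.*_) (sym (1/c*c q (loghᴾ (suc i) n)))
      c≡ : ι H ℚ.* (r ℚ.* ι p) ≡ r ℚ.* ι (H ℕ.* p)
      c≡ = trans (solve 3 (λ H r p → H :* (r :* p) := r :* (H :* p)) refl (ι H) r (ι p)) (cong (r ℚ.*_) (sym (ι-* H p)))
        where open +-*-Solver

    lower-step : 2 ℕ.^ p ℕ.* H ℕ.^ q ℕ.≤ lowerH (suc i) ℕ.^ q → (λ _ → ι N) ≼ scaledS i →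
                 (λ _ → ι (2 ℕ.* N ℕ.+ (H ℕ.* p) ℕ./ q)) ≼ scaledS (suc i)
    lower-step le inv =
      ≼-trans {λ _ → ι (2 ℕ.* N ℕ.+ a)} {λ n → ι 2 ℚ.* scaledS i n ℚ.+ v n} {scaledS (suc i)}
        (≼-trans {λ _ → ι (2 ℕ.* N ℕ.+ a)} {λ _ → ι 2 ℚ.* ι N ℚ.+ ι a} {λ n → ι 2 ℚ.* scaledS i n ℚ.+ v n}
          (pointwise (λ _ → ι (2 ℕ.* N ℕ.+ a)) (λ _ → ι 2 ℚ.* ι N ℚ.+ ι a)
            (λ _ → ℚₚ.≤-reflexive (trans (ι-+ (2 ℕ.* N) a) (cong (ℚ._+ ι a) (ι-* 2 N)))))
          (≼-+ {λ _ → ι 2 ℚ.* ι N} {λ n → ι 2 ℚ.* scaledS i n} {λ _ → ι a} {v} (≼-* {λ _ → ι N} {scaledS i} (ι 2) (ι≥0 2) inv) a≼v))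
        (pointwise (λ n → ι 2 ℚ.* scaledS i n ℚ.+ v n) (scaledS (suc i)) (λ n → ℚₚ.≤-reflexive (sym (scaledS-suc i n))))
      where
      a : ℕ
      a = (H ℕ.* p) ℕ./ q
      a≼v : (λ _ → ι a) ≼ v
      a≼v = ≼-trans {λ _ → ι a} {λ _ → ι H ℚ.* (r ℚ.* ι p)} {v}
        (pointwise (λ _ → ι a) (λ _ → ι H ℚ.* (r ℚ.* ι p)) (λ _ → ℚₚ.≤-trans (ι-/-lower (H ℕ.* p) q) (ℚₚ.≤-reflexive (sym c≡))))
        (≼-trans {λ _ → ι H ℚ.* (r ℚ.* ι p)} {λ n → ι H ℚ.* (r ℚ.* u n)} {v}
          (≼-* {λ _ → r ℚ.* ι p} {λ n → r ℚ.* u n} (ι H) (ι≥0 H) (≼-* {λ _ → ι p} {u} r (1/≥0 q)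
            (logh-lower (lowerH (suc i)) H p q (2 ℕ.^ suc i ∸ 1) {{nonZero-j = 2^suc∸1≢0 i}} (lowerH-correct (suc i)) le)))
          (pointwise (λ n → ι H ℚ.* (r ℚ.* u n)) v (λ n → ℚₚ.≤-reflexive (sym (v≡ n)))))

    upper-step : upperH (suc i) ℕ.^ q ℕ.≤ 2 ℕ.^ p ℕ.* H ℕ.^ q → scaledS i ≼ (λ _ → ι N) →
                 scaledS (suc i) ≼ (λ _ → ι (2 ℕ.* N ℕ.+ (H ℕ.* p) /⌈ q ⌉))
    upper-step le inv =
      ≼-trans {scaledS (suc i)} {λ n → ι 2 ℚ.* scaledS i n ℚ.+ v n} {λ _ → ι (2 ℕ.* N ℕ.+ a)}
        (pointwise (scaledS (suc i)) (λ n → ι 2 ℚ.* scaledS i n ℚ.+ v n) (λ n → ℚₚ.≤-reflexive (scaledS-suc i n)))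
        (≼-trans {λ n → ι 2 ℚ.* scaledS i n ℚ.+ v n} {λ _ → ι 2 ℚ.* ι N ℚ.+ ι a} {λ _ → ι (2 ℕ.* N ℕ.+ a)}
          (≼-+ {λ n → ι 2 ℚ.* scaledS i n} {λ _ → ι 2 ℚ.* ι N} {v} {λ _ → ι a} (≼-* {scaledS i} {λ _ → ι N} (ι 2) (ι≥0 2) inv) v≼a)
          (pointwise (λ _ → ι 2 ℚ.* ι N ℚ.+ ι a) (λ _ → ι (2 ℕ.* N ℕ.+ a))
            (λ _ → ℚₚ.≤-reflexive (sym (trans (ι-+ (2 ℕ.* N) a) (cong (ℚ._+ ι a) (ι-* 2 N)))))))
      where
      a : ℕ
      a = (H ℕ.* p) /⌈ q ⌉
      v≼a : v ≼ (λ _ → ι a)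
      v≼a = ≼-trans {v} {λ _ → ι H ℚ.* (r ℚ.* ι p)} {λ _ → ι a}
        (≼-trans {v} {λ n → ι H ℚ.* (r ℚ.* u n)} {λ _ → ι H ℚ.* (r ℚ.* ι p)}
          (pointwise v (λ n → ι H ℚ.* (r ℚ.* u n)) (λ n → ℚₚ.≤-reflexive (v≡ n)))
          (≼-* {λ n → r ℚ.* u n} {λ _ → r ℚ.* ι p} (ι H) (ι≥0 H) (≼-* {u} {λ _ → ι p} r (1/≥0 q)
            (logh-upper (upperH (suc i)) H p q (2 ℕ.^ suc i ∸ 1) {{nonZero-j = 2^suc∸1≢0 i}} (upperH-correct (suc i)) le))))
        (pointwise (λ _ → ι H ℚ.* (r ℚ.* ι p)) (λ _ → ι a) (λ _ → ℚₚ.≤-trans (ℚₚ.≤-reflexive c≡) (ι-/-upper (H ℕ.* p) q)))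

  scale>0 : ∀ i → NonZero (H ℕ.* 2 ℕ.^ i)
  scale>0 i = ℕₚ.m*n≢0 H (2 ℕ.^ i) {{recompute-nonZero H}} {{ℕₚ.m^n≢0 2 i}}

  unscale : ℕ → ℕ → ℚ
  unscale i N = (+ 1 / (H ℕ.* 2 ℕ.^ i)) {{scale>0 i}} ℚ.* ι N

  private
    unscale-* : ∀ i N b → unscale i N ℚ.* (ι b ℚ.* ι (H ℕ.* 2 ℕ.^ i)) ≡ ι (b ℕ.* N)
    unscale-* i N b = trans (solve 4 (λ r N b K → r :* N :* (b :* K) := r :* (K :* (b :* N))) refl r (ι N) (ι b) (ι (H ℕ.* 2 ℕ.^ i)))
      (trans (1/c*c (H ℕ.* 2 ℕ.^ i) {{scale>0 i}} (ι b ℚ.* ι N)) (sym (ι-* b N)))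
      where
      open +-*-Solver
      r : ℚ
      r = (+ 1 / (H ℕ.* 2 ℕ.^ i)) {{scale>0 i}}

    /-* : ∀ i a b .{{_ : NonZero b}} → + 1 / b ℚ.* ι a ℚ.* (ι b ℚ.* ι (H ℕ.* 2 ℕ.^ i)) ≡ ι (a ℕ.* (H ℕ.* 2 ℕ.^ i))
    /-* i a b = trans (solve 4 (λ r a b K → r :* a :* (b :* K) := r :* (b :* (a :* K))) refl (+ 1 / b) (ι a) (ι b) (ι (H ℕ.* 2 ℕ.^ i)))
      (trans (1/c*c b (ι a ℚ.* ι (H ℕ.* 2 ℕ.^ i))) (sym (ι-* a (H ℕ.* 2 ℕ.^ i))))
      where open +-*-Solver

    common : ∀ i b .{{_ : NonZero b}} → Positive (ι b ℚ.* ι (H ℕ.* 2 ℕ.^ i))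
    common i b = ℚ.positive (*-pos (ι>0 b) (ι>0 (H ℕ.* 2 ℕ.^ i) {{scale>0 i}}))

    unscale-S : ∀ i n → (+ 1 / (H ℕ.* 2 ℕ.^ i)) {{scale>0 i}} ℚ.* scaledS i n ≡ S i n
    unscale-S i n = 1/c*c (H ℕ.* 2 ℕ.^ i) {{scale>0 i}} (S i n)

    unscale≥0 : ∀ i → 0ℚ ℚ.≤ (+ 1 / (H ℕ.* 2 ℕ.^ i)) {{scale>0 i}}
    unscale≥0 i = 1/≥0 (H ℕ.* 2 ℕ.^ i) {{scale>0 i}}

  -- A certificate (p , q) stands for the bound p/(q+1) of the next logarithm.
  lowerCheck : ℕ → ℕ → ℕ → ℕ → List (ℕ × ℕ) → Bool
  lowerCheck a b i N []             = a ℕ.* (H ℕ.* 2 ℕ.^ i) ℕ.<ᵇ b ℕ.* N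
  lowerCheck a b i N ((p , q) ∷ cs) =
    (2 ℕ.^ p ℕ.* H ℕ.^ suc q ℕ.≤ᵇ lowerH (suc i) ℕ.^ suc q) ∧ lowerCheck a b (suc i) (2 ℕ.* N ℕ.+ (H ℕ.* p) ℕ./ suc q) cs

  -- The summand `H * suc i` is `tail i` in the unit of `N`; it pays for the terms after the last
  -- certificate, which a lower bound may drop as they are nonnegative.
  upperCheck : ℕ → ℕ → ℕ → ℕ → List (ℕ × ℕ) → Bool
  upperCheck a b i N []             = b ℕ.* (N ℕ.+ H ℕ.* suc i) ℕ.<ᵇ a ℕ.* (H ℕ.* 2 ℕ.^ i)
  upperCheck a b i N ((p , q) ∷ cs) =
    (upperH (suc i) ℕ.^ suc q ℕ.≤ᵇ 2 ℕ.^ p ℕ.* H ℕ.^ suc q) ∧ upperCheck a b (suc i) (2 ℕ.* N ℕ.+ (H ℕ.* p) /⌈ suc q ⌉) cs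

  -- An explicit rational strictly beyond a/b is returned because `<ᴿ` needs a positive gap that
  -- survives the rounding errors.
  lower-sound : ∀ a b .{{_ : NonZero b}} i N cs → T (lowerCheck a b i N cs) → (λ _ → ι N) ≼ scaledS i →
                ∃[ x ] (+ 1 / b ℚ.* ι a ℚ.< x) × ((λ _ → x) ≼ seq s)
  lower-sound a b i N [] ok inv = unscale i N ,
    ℚₚ.*-cancelʳ-<-nonNeg (ι b ℚ.* ι (H ℕ.* 2 ℕ.^ i)) {{ℚₚ.pos⇒nonNeg (ι b ℚ.* ι (H ℕ.* 2 ℕ.^ i)) {{common i b}}}}
      (subst₂ ℚ._<_ (sym (/-* i a b)) (sym (unscale-* i N b)) (ι-mono-< (ℕₚ.<ᵇ⇒< (a ℕ.* (H ℕ.* 2 ℕ.^ i)) (b ℕ.* N) ok))) ,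
    ≼-trans {λ _ → unscale i N} {S i} {seq s}
      (≼-trans {λ _ → unscale i N} {λ n → (+ 1 / (H ℕ.* 2 ℕ.^ i)) {{scale>0 i}} ℚ.* scaledS i n} {S i}
        (≼-* {λ _ → ι N} {scaledS i} ((+ 1 / (H ℕ.* 2 ℕ.^ i)) {{scale>0 i}}) (unscale≥0 i) inv)
        (pointwise (λ n → (+ 1 / (H ℕ.* 2 ℕ.^ i)) {{scale>0 i}} ℚ.* scaledS i n) (S i) (λ n → ℚₚ.≤-reflexive (unscale-S i n))))
      (S≼s i)
  lower-sound a b i N ((p , q) ∷ cs) ok inv = lower-sound a b (suc i) (2 ℕ.* N ℕ.+ (H ℕ.* p) ℕ./ suc q) cs (proj₂ both)
    (lower-step i N p (suc q) (ℕₚ.≤ᵇ⇒≤ (2 ℕ.^ p ℕ.* H ℕ.^ suc q) (lowerH (suc i) ℕ.^ suc q) (proj₁ both)) inv)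
    where
    both : T (2 ℕ.^ p ℕ.* H ℕ.^ suc q ℕ.≤ᵇ lowerH (suc i) ℕ.^ suc q) × T (lowerCheck a b (suc i) (2 ℕ.* N ℕ.+ (H ℕ.* p) ℕ./ suc q) cs)
    both = Equivalence.to T-∧ ok

  upper-sound : ∀ a b .{{_ : NonZero b}} i N cs → T (upperCheck a b i N cs) → scaledS i ≼ (λ _ → ι N) →
                ∃[ x ] (x ℚ.< + 1 / b ℚ.* ι a) × (seq s ≼ (λ _ → x))
  upper-sound a b i N [] ok inv = unscale i N′ ,
    ℚₚ.*-cancelʳ-<-nonNeg (ι b ℚ.* ι (H ℕ.* 2 ℕ.^ i)) {{ℚₚ.pos⇒nonNeg (ι b ℚ.* ι (H ℕ.* 2 ℕ.^ i)) {{common i b}}}}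
      (subst₂ ℚ._<_ (sym (unscale-* i N′ b)) (sym (/-* i a b)) (ι-mono-< (ℕₚ.<ᵇ⇒< (b ℕ.* N′) (a ℕ.* (H ℕ.* 2 ℕ.^ i)) ok))) ,
    ≼-trans {seq s} {λ n → S i n ℚ.+ tail i} {λ _ → unscale i N′} (s≼S+tail i)
      (≼-trans {λ n → S i n ℚ.+ tail i} {λ n → r ℚ.* (scaledS i n ℚ.+ ι (H ℕ.* suc i))} {λ _ → unscale i N′}
        (pointwise (λ n → S i n ℚ.+ tail i) (λ n → r ℚ.* (scaledS i n ℚ.+ ι (H ℕ.* suc i))) (λ n → ℚₚ.≤-reflexive (sym (add-tail n))))
        (≼-* {λ n → scaledS i n ℚ.+ ι (H ℕ.* suc i)} {λ _ → ι N′} r (unscale≥0 i)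
          (≼-trans {λ n → scaledS i n ℚ.+ ι (H ℕ.* suc i)} {λ _ → ι N ℚ.+ ι (H ℕ.* suc i)} {λ _ → ι N′}
            (≼-+ {scaledS i} {λ _ → ι N} {λ _ → ι (H ℕ.* suc i)} {λ _ → ι (H ℕ.* suc i)} inv (≃⇒≼ ≃-refl))
            (pointwise (λ _ → ι N ℚ.+ ι (H ℕ.* suc i)) (λ _ → ι N′) (λ _ → ℚₚ.≤-reflexive (sym (ι-+ N (H ℕ.* suc i))))))))
    where
    open +-*-Solver
    N′ : ℕ
    N′ = N ℕ.+ H ℕ.* suc i
    r : ℚ
    r = (+ 1 / (H ℕ.* 2 ℕ.^ i)) {{scale>0 i}}
    tail≡ : r ℚ.* ι (H ℕ.* suc i) ≡ tail i
    tail≡ = begin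
      r ℚ.* ι (H ℕ.* suc i)                                      ≡⟨ cong (r ℚ.*_) (ι-* H (suc i)) ⟩
      r ℚ.* (ι H ℚ.* ι (suc i))                                  ≡⟨ ℚₚ.*-identityʳ (r ℚ.* (ι H ℚ.* ι (suc i))) ⟨
      r ℚ.* (ι H ℚ.* ι (suc i)) ℚ.* 1ℚ                           ≡⟨ cong (r ℚ.* (ι H ℚ.* ι (suc i)) ℚ.*_) (w*2^ i) ⟨
      r ℚ.* (ι H ℚ.* ι (suc i)) ℚ.* (w i ℚ.* ι (2 ℕ.^ i))        ≡⟨ solve 5 (λ r H j w D → r :* (H :* j) :* (w :* D) := r :* ((H :* D) :* (j :* w))) refl r (ι H) (ι (suc i)) (w i) (ι (2 ℕ.^ i)) ⟩
      r ℚ.* ((ι H ℚ.* ι (2 ℕ.^ i)) ℚ.* tail i)                   ≡⟨ cong (λ x → r ℚ.* (x ℚ.* tail i)) (ι-* H (2 ℕ.^ i)) ⟨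
      r ℚ.* (ι (H ℕ.* 2 ℕ.^ i) ℚ.* tail i)                       ≡⟨ 1/c*c (H ℕ.* 2 ℕ.^ i) {{scale>0 i}} (tail i) ⟩
      tail i                                                     ∎
      where open ≡-Reasoning
    add-tail : ∀ n → r ℚ.* (scaledS i n ℚ.+ ι (H ℕ.* suc i)) ≡ S i n ℚ.+ tail i
    add-tail n = trans (ℚₚ.*-distribˡ-+ r (scaledS i n) (ι (H ℕ.* suc i))) (cong₂ ℚ._+_ (unscale-S i n) tail≡)
  upper-sound a b i N ((p , q) ∷ cs) ok inv = upper-sound a b (suc i) (2 ℕ.* N ℕ.+ (H ℕ.* p) /⌈ suc q ⌉) cs (proj₂ both)
    (upper-step i N p (suc q) (ℕₚ.≤ᵇ⇒≤ (upperH (suc i) ℕ.^ suc q) (2 ℕ.^ p ℕ.* H ℕ.^ suc q) (proj₁ both)) inv)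
    where
    both : T (upperH (suc i) ℕ.^ suc q ℕ.≤ᵇ 2 ℕ.^ p ℕ.* H ℕ.^ suc q) × T (upperCheck a b (suc i) (2 ℕ.* N ℕ.+ (H ℕ.* p) /⌈ suc q ⌉) cs)
    both = Equivalence.to T-∧ ok

  scaledS-zero : ∀ n → scaledS 0 n ≡ ι 0
  scaledS-zero n = ℚₚ.*-zeroʳ (ι (H ℕ.* 1))

-- Half of the gap t - y absorbs the error in `≼`, the other half is the gap for `<ᴿ`.
<ᴿ-from-lower : ∀ x {y t} → y ℚ.< t → (λ _ → t) ≼ seq x → fromℚ (1ℚ ℚ.+ y) <ᴿ fromℚ 1ℚ +ᴿ x
<ᴿ-from-lower x {y} {t} y<t t≼x = ℚ.½ ℚ.* (t ℚ.- y) , 0<δ , proj₁ close , λ n N≤n → ℚₚ.≤-trans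
    (ℚₚ.≤-reflexive (solve 2 (λ y t → con 1ℚ :+ y :+ con ℚ.½ :* (t :+ :- y) := con 1ℚ :+ (t :+ :- (con ℚ.½ :* (t :+ :- y)))) refl y t))
    (ℚₚ.+-monoʳ-≤ 1ℚ (ℚₚ.≤-trans (ℚₚ.+-monoˡ-≤ (ℚ.- (ℚ.½ ℚ.* (t ℚ.- y))) (proj₂ close n N≤n))
      (ℚₚ.≤-reflexive (solve 2 (λ a d → a :+ d :+ :- d := a) refl (seq x n) (ℚ.½ ℚ.* (t ℚ.- y))))))
  where
  open +-*-Solver
  0<δ : 0ℚ ℚ.< ℚ.½ ℚ.* (t ℚ.- y)
  0<δ = half (p<q⇒0<q-p y<t)
  close : ∃[ N ] (∀ n → N ℕ.≤ n → t ℚ.≤ seq x n ℚ.+ ℚ.½ ℚ.* (t ℚ.- y))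
  close = eventually t≼x (ℚ.½ ℚ.* (t ℚ.- y)) 0<δ

<ᴿ-from-upper : ∀ x {y t} → t ℚ.< y → seq x ≼ (λ _ → t) → fromℚ 1ℚ +ᴿ x <ᴿ fromℚ (1ℚ ℚ.+ y)
<ᴿ-from-upper x {y} {t} t<y x≼t = ℚ.½ ℚ.* (y ℚ.- t) , 0<δ , proj₁ close , λ n N≤n → ℚₚ.≤-trans
    (ℚₚ.+-monoˡ-≤ (ℚ.½ ℚ.* (y ℚ.- t)) (ℚₚ.+-monoʳ-≤ 1ℚ (proj₂ close n N≤n)))
    (ℚₚ.≤-reflexive (solve 2 (λ y t → con 1ℚ :+ (t :+ con ℚ.½ :* (y :+ :- t)) :+ con ℚ.½ :* (y :+ :- t) := con 1ℚ :+ y) refl y t))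
  where
  open +-*-Solver
  0<δ : 0ℚ ℚ.< ℚ.½ ℚ.* (y ℚ.- t)
  0<δ = half (p<q⇒0<q-p t<y)
  close : ∃[ N ] (∀ n → N ℕ.≤ n → seq x n ℚ.≤ t ℚ.+ ℚ.½ ℚ.* (y ℚ.- t))
  close = eventually x≼t (ℚ.½ ℚ.* (y ℚ.- t)) 0<δ

-- One-sided rational approximations of log₂ h_{2^i-1} for i = 1, 2, …; α exceeds
-- 1.637 by only 1.5 · 10⁻⁶, so 26 terms and denominators up to 2119 are needed.
lowerCertificates upperCertificates : List (ℕ × ℕ)
lowerCertificates =
  (0 , 0) ∷ (1853 , 2118) ∷ (1501 , 1091) ∷ (2054 , 1186) ∷ (1642 , 816) ∷ (1096 , 488) ∷
  (1315 , 538) ∷ (2841 , 1086) ∷ (335 , 120) ∷ (381 , 130) ∷ (85 , 27) ∷ (227 , 71) ∷ (75 , 22) ∷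
  (121 , 35) ∷ (38 , 10) ∷ (85 , 23) ∷ (29 , 7) ∷ (37 , 9) ∷ (15 , 3) ∷ (19 , 4) ∷ (19 , 4) ∷
  (11 , 2) ∷ (4 , 0) ∷ (4 , 0) ∷ (4 , 0) ∷ (4 , 0) ∷ []
upperCertificates =
  (0 , 0) ∷ (209 , 238) ∷ (378 , 274) ∷ (199 , 114) ∷ (193 , 95) ∷ (65 , 28) ∷ (61 , 24) ∷
  (34 , 12) ∷ (17 , 5) ∷ (73 , 23) ∷ (16 , 4) ∷ (17 , 4) ∷ (7 , 1) ∷ (11 , 2) ∷ (4 , 0) ∷ (4 , 0) ∷
  []

-- 692659137012 is a rounded-down value of 10^12 (h_1024 - h_512).
open FixedPoint 1000000000000 9 692659137012 (ℕₚ.≤ᵇ⇒≤ (692659137012 ℕ.+ hceil 1000000000000 (2 ℕ.^ 9)) (hfloor 1000000000000 (2 ℕ.^ 10)) tt)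

s-lower : ∃[ x ] (+ 1 / 1000 ℚ.* ι 637 ℚ.< x) × ((λ _ → x) ≼ seq s)
s-lower = lower-sound 637 1000 0 0 lowerCertificates tt (pointwise (λ _ → ι 0) (scaledS 0) (λ n → ℚₚ.≤-reflexive (sym (scaledS-zero n))))

s-upper : ∃[ x ] (x ℚ.< + 1 / 1000 ℚ.* ι 638) × (seq s ≼ (λ _ → x))
s-upper = upper-sound 638 1000 0 0 upperCertificates tt (pointwise (scaledS 0) (λ _ → ι 0) (λ n → ℚₚ.≤-reflexive (scaledS-zero n)))

lemma2p3 : (∀ k .{{_ : NonZero k}} (T : Tree) → size T ≡ k → (MostLikely k T ⇔ T ≅ CBT k))
    × (∃[ s ] αTerm SumsTo s ×
    (let α = fromℚ 1ℚ +ᴿ s in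
    (Σ[ o ∈ (ℕ → ℝ) ] (o ⟶ fromℚ 0ℚ) ×
    (∀ k .{{_ : NonZero k}} → 2^ (- (+ k / 1)) ⋆ (α +ᴿ o k) ≐ ℙ[ DTCS k ≡ CBT k ]))
    × (fromℚ (+ 1637 / 1000) <ᴿ α) × (α <ᴿ fromℚ (+ 1638 / 1000))))
lemma2p3 =
  (λ k → mostLikely⇔≅CBT k) ,
  s , αTerm-sumsTo-s , (o , o⟶0 , λ k → 2^-k[α+o]≐ℙ k) ,
  <ᴿ-from-lower s (proj₁ (proj₂ s-lower)) (proj₂ (proj₂ s-lower)) ,
  <ᴿ-from-upper s (proj₁ (proj₂ s-upper)) (proj₂ (proj₂ s-upper))
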